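{- The problem \textsc{Trivially Perfect Completion} admits a proper kernel with $O(k^7)$ vertices. That is, there is a polynomial-time algorithm that, given an instance $(G,k)$ of \textsc{Trivially Perfect Completion}, outputs an instance $(G',k')$ such that $(G,k)$ is a yes-instance if and only if $(G',k')$ is a yes-instance, $k'\le k$, and $|V(G')|\le c\cdot k^7$ for an absolute constant $c$.
   Context: All graphs are finite, simple and undirected. A graph is trivially perfect if it contains neither $C_4$ nor $P_4$ as an induced subgraph. \textsc{Trivially Perfect Completion}: given a graph $G$ and a non-negative integer $k$ (the parameter), decide whether there is a set $S\subseteq\binom{V(G)}{2}\setminus E(G)$ with $|S|\le k$ such that the graph $(V(G),E(G)\cup S)$ is trivially perfect. A kernel is a polynomial-time algorithm mapping an instance $(G,k)$ to an equivalent instance $(G',k')$ whose size is bounded by a function of $k$; it is proper if moreover $k'\le k$.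
   Formalization: The bound |V(G')| ≤ c·k^7 is stated as c·(k+1)^7: at k = 0 the original would force G' to be empty, a yes-instance, although (P_4, 0) is a no-instance; for k ≥ 1 the two forms agree up to the constant. -}

module Defs where

open import Data.Bool using (Bool; true; false; if_then_else_)
open import Data.Nat using (ℕ; zero; suc; _+_; _*_; _^_; _<_)
open import Data.Nat.Binary as B using (ℕᵇ)
open import Data.Fin using (Fin; toℕ)
open import Data.List using (List; []; _∷_; _++_; concatMap; allFin; replicate; length; reverse; takeWhile)
open import Data.Maybe using (Maybe; just; nothing)
open import Data.Product using (Σ; _×_; _,_)
open import Relation.Binary.PropositionalEquality using (_≡_; _≢_)
open import Relation.Nullary using (¬_; Dec; yes; no)

record Graph (n : ℕ) : Set where
  field
    adj    : Fin n → Fin n → Bool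
    sym    : ∀ i j → adj i j ≡ adj j i
    irrefl : ∀ i → adj i i ≡ false
open Graph public

Edge : ∀ {n} → Graph n → Fin n → Fin n → Set
Edge G i j = adj G i j ≡ true

NonEdge : ∀ {n} → Graph n → Fin n → Fin n → Set
NonEdge G i j = adj G i j ≡ false

AllDistinct4 : ∀ {n} → Fin n → Fin n → Fin n → Fin n → Set
AllDistinct4 a b c d =
  a ≢ b × a ≢ c × a ≢ d × b ≢ c × b ≢ d × c ≢ d

InducedP4 : ∀ {n} → Graph n → Fin n → Fin n → Fin n → Fin n → Set
InducedP4 G a b c d = AllDistinct4 a b c d ×
  Edge G a b × Edge G b c × Edge G c d ×
  NonEdge G a c × NonEdge G b d × NonEdge G a d

InducedC4 : ∀ {n} → Graph n → Fin n → Fin n → Fin n → Fin n → Set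
InducedC4 G a b c d = AllDistinct4 a b c d ×
  Edge G a b × Edge G b c × Edge G c d × Edge G d a ×
  NonEdge G a c × NonEdge G b d

TriviallyPerfect : ∀ {n} → Graph n → Set
TriviallyPerfect G = ∀ a b c d → ¬ InducedP4 G a b c d × ¬ InducedC4 G a b c d

b2n : Bool → ℕ
b2n true = 1
b2n false = 0

sumL : List ℕ → ℕ
sumL [] = 0
sumL (x ∷ xs) = x + sumL xs

isNewEdge : ∀ {n} → Graph n → Graph n → Fin n → Fin n → Bool
isNewEdge G H i j with toℕ i Data.Nat.<? toℕ j
... | no _ = false
... | yes _ = if adj H i j then (if adj G i j then false else true) else false

addedEdges : ∀ {n} → Graph n → Graph n → ℕ
addedEdges {n} G H =
  sumL (concatMap (λ i → Data.List.map (λ j → b2n (isNewEdge G H i j)) (allFin n)) (allFin n))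

Supergraph : ∀ {n} → Graph n → Graph n → Set
Supergraph G H = ∀ i j → Edge G i j → Edge H i j

record Instance : Set where
  constructor inst
  field
    nV  : ℕ
    gr  : Graph nV
    par : ℕ
open Instance public

-- (G,k) is a yes-instance: there is a set S of non-edges, |S| ≤ k, with
-- G + S trivially perfect.  (H = G + S.)
YesInstance : Instance → Set
YesInstance I = Σ (Graph (nV I)) λ H →
  Supergraph (gr I) H × (addedEdges (gr I) H Data.Nat.≤ par I) × TriviallyPerfect H

data Sym : Set where
  blank b0 b1 sep : Sym

data Move : Set where
  L R : Move

record TM : Set where
  field
    Q     : ℕ
    start : Fin Q
    δ     : Fin Q → Sym → Maybe (Fin Q × Sym × Move)   -- nothing = halt
open TM public

record Config (M : TM) : Set where
  constructor cfg
  field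
    state : Fin (Q M)
    left  : List Sym      -- cells left of the head, nearest first
    head  : Sym
    right : List Sym      -- cells right of the head, nearest first
open Config public

moveL : ∀ {M} → Fin (Q M) → List Sym → Sym → List Sym → Config M
moveL q [] h r = cfg q [] blank (h ∷ r)
moveL q (x ∷ l) h r = cfg q l x (h ∷ r)

moveR : ∀ {M} → Fin (Q M) → List Sym → Sym → List Sym → Config M
moveR q l h [] = cfg q (h ∷ l) blank []
moveR q l h (x ∷ r) = cfg q (h ∷ l) x r

step : (M : TM) → Config M → Maybe (Config M)
step M (cfg q l h r) with δ M q h
... | nothing = nothing
... | just (q' , s , L) = just (moveL q' l s r)
... | just (q' , s , R) = just (moveR q' l s r)

exec : (M : TM) → ℕ → Config M → Maybe (Config M)
exec M zero c with step M c
... | nothing = just c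
... | just _  = nothing
exec M (suc t) c with step M c
... | nothing = just c
... | just c' = exec M t c'

initConfig : (M : TM) → List Sym → Config M
initConfig M [] = cfg (start M) [] blank []
initConfig M (x ∷ w) = cfg (start M) [] x w

isNotBlank : Sym → Bool
isNotBlank blank = false
isNotBlank _ = true

output : ∀ {M} → Config M → List Sym
output c = takeWhile (λ s → Data.Bool.T? (isNotBlank s)) (head c ∷ right c)

bit : Bool → Sym
bit true = b1
bit false = b0

encBin : ℕᵇ → List Sym
encBin B.zero = []
encBin (B.2[1+ x ]) = b0 ∷ encBin x
encBin (B.1+[2 x ]) = b1 ∷ encBin x
-- This is the bijective base-2 numeral of the stdlib ℕᵇ term: injective,
-- length O(log k).

encNat : ℕ → List Sym
encNat m = encBin (B.fromℕ m)

encode : Instance → List Sym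
encode (inst n G k) =
  encNat k ++ sep ∷ replicate n b1 ++ sep ∷
  concatMap (λ i → Data.List.map (λ j → bit (adj G i j)) (allFin n)) (allFin n)

_⇔_ : Set → Set → Set
A ⇔ B = (A → B) × (B → A)

{-# OPTIONS --safe #-}
{-
An obstruction is a path a-b-c-d with ac and bd missing; a graph is trivially perfect iff
it has none, and every completion must add ac or bd.  Call x a partner of the missing edge
ac if some obstruction has ac and xy as its two missing pairs.  A completion with at most k
new edges that omits ac covers all partners of ac by the ends of its edges, so a pair with
more than 2k partners is forced: add it and decrease k.  When no pair is forced, each new
edge accounts for its ends and at most 2k partners, so a yes-instance has at most 2k(2k+1)
vertices in obstructions; and all other vertices can be deleted.

For the machine, registers and memory bits are interleaved in columns on the tape.  The
algorithm is written in a small loop language over them, whose vertex predicates are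
compiled from formulas with counting quantifiers.
-}
module Submission where

open import Defs renaming (sym to adj-sym)
open import Data.Bool using (Bool; true; false; if_then_else_; not; _∧_; _∨_; T)
import Data.Bool as Bool
open import Data.Bool.Properties using (∧-conicalˡ; ∧-conicalʳ; ∧-comm; ∨-comm)
open import Data.Empty using (⊥; ⊥-elim)
open import Data.Fin using (Fin; zero; suc; toℕ; fromℕ<; splitAt; join)
open import Data.Fin.Properties as Fin using (splitAt-join; toℕ<n; toℕ-injective)
open import Data.List using (List; []; _∷_; _++_; _ʳ++_; allFin; concat; concatMap; filter; length; lookup; map; replicate; reverse; tabulate; takeWhile)
open import Data.List.Membership.Propositional using (_∈_)
open import Data.List.Membership.Propositional.Properties using (∈-filter⁺; ∈-filter⁻; ∈-allFin; ∈-++⁺ˡ; ∈-++⁺ʳ; ∈-lookup)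
import Data.List.Properties as List
open import Data.List.Relation.Unary.All as All using (All; []; _∷_)
import Data.List.Relation.Unary.All.Properties as AllP
open import Data.List.Relation.Unary.AllPairs using (_∷_)
import Data.List.Relation.Unary.Any as Any
open import Data.List.Relation.Unary.Any.Properties using (lookup-index)
open import Data.List.Relation.Unary.Unique.Propositional using (Unique)
import Data.List.Relation.Unary.Unique.Propositional.Properties as Unique
open import Data.Maybe using (just; nothing)
open import Data.Nat
open import Data.Nat.Binary as ℕᵇ using (2[1+_]; 1+[2_])
import Data.Nat.Binary.Properties as ℕᵇ
open import Data.Nat.Divisibility using (n∣m*n)
open import Data.Nat.DivMod using (_/_; _%_; m≡m%n+[m/n]*n; [m+kn]%n≡m%n; m<n⇒m%n≡m; m<n⇒m/n≡0; m*n/n≡m; +-distrib-/-∣ʳ)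
open import Data.Nat.Properties
open import Data.Product using (Σ; ∃; _×_; _,_; proj₁; proj₂)
open import Data.Sum as Sum using (_⊎_; inj₁; inj₂)
open import Data.Unit using (⊤; tt)
open import Data.Vec as Vec using (Vec; []; _∷_)
open import Function using (_∘_; id)
open import Relation.Binary.Definitions using (tri<; tri≈; tri>)
open import Relation.Binary.PropositionalEquality using (_≡_; _≢_; refl; sym; trans; cong; cong₂; subst; subst₂; module ≡-Reasoning)
open import Relation.Nullary using (¬_; yes; no; does; contradiction)
open import Algebra.Properties.CommutativeMonoid.Sum +-0-commutativeMonoid using (sum; sum-cong-≗; ∑-distrib-+; ∑-comm)
open import Algebra.Properties.Semiring.Sum +-*-semiring using (*-distribʳ-sum; *-distribˡ-sum)

-- What makes the deletion possible is a converse to restriction: a vertex in no obstruction can be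
-- put back into any solution at no cost, after the solution has been cut down to a subgraph that
-- respects the neighbourhood of that vertex.
--
-- The obstacle on the machine side is the parameter. It is written in binary and may be exponential
-- in the input length, whereas registers are unary and stop at the input length `B`. The program
-- therefore works with `k ⊓ B` and with thresholds capped at `B`. This loses nothing: the adjacency
-- matrix is part of the input, so `n * n ≤ B`; no completion has more than `n * n` new ordered
-- pairs, and the counts compared with thresholds are at most `n`.
--
-- When the budget is spent while a pair is still forced, or when too many vertices lie in
-- obstructions, the output is a fixed no-instance, the path on 4 vertices with parameter 0. The
-- constant 4 of the size bound pays for this graph, and also for `2k(2k+1) ≤ 4(k+1)²`.

eqᵇ : ∀ {n} → Fin n → Fin n → Bool
eqᵇ i j = does (i Fin.≟ j)

eqᵇ-refl : ∀ {n} (i : Fin n) → eqᵇ i i ≡ true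
eqᵇ-refl i with i Fin.≟ i
... | yes _ = refl
... | no q = contradiction refl q

eqᵇ⇒≡ : ∀ {n} {i j : Fin n} → eqᵇ i j ≡ true → i ≡ j
eqᵇ⇒≡ {i = i} {j} e with i Fin.≟ j
... | yes p = p
eqᵇ⇒≡ () | no _

∨-true : ∀ x {y} → x ∨ y ≡ true → x ≡ true ⊎ y ≡ true
∨-true true  _ = inj₁ refl
∨-true false e = inj₂ e

∨-introʳ : ∀ x {y} → y ≡ true → x ∨ y ≡ true
∨-introʳ true  _ = refl
∨-introʳ false e = e

∨-introˡ : ∀ {x} y → x ≡ true → x ∨ y ≡ true
∨-introˡ y refl = refl

∨-false : ∀ x {y} → x ∨ y ≡ false → x ≡ false × y ≡ false
∨-false false e = refl , e

∧-true : ∀ {x y} → x ≡ true → y ≡ true → x ∧ y ≡ true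
∧-true refl refl = refl

not-true : ∀ {x} → not x ≡ true → x ≡ false
not-true {false} _ = refl

not-false : ∀ {x} → x ≡ false → not x ≡ true
not-false refl = refl

true≢false : ∀ {x} → x ≡ true → x ≡ false → ⊥
true≢false refl ()

<ᵇ-true : ∀ {m n} → (m <ᵇ n) ≡ true → m < n
<ᵇ-true {m} e = <ᵇ⇒< m _ (subst T (sym e) tt)

<ᵇ-false : ∀ {m n} → (m <ᵇ n) ≡ false → n ≤ m
<ᵇ-false {m} {n} e with m <? n
... | no q = ≮⇒≥ q
... | yes p with m <ᵇ n | <⇒<ᵇ p
<ᵇ-false () | yes p | true | _

<⇒<ᵇ-true : ∀ {m n} → m < n → (m <ᵇ n) ≡ true
<⇒<ᵇ-true {m} {n} p with m <ᵇ n | <⇒<ᵇ p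
... | true | _ = refl

≤⇒<ᵇ-false : ∀ {m n} → n ≤ m → (m <ᵇ n) ≡ false
≤⇒<ᵇ-false {m} {n} p with m <ᵇ n in e
... | false = refl
... | true = contradiction (<ᵇ-true {m} e) (≤⇒≯ p)

-- Finite sums and counting

sum-mono : ∀ {n} {f g : Fin n → ℕ} → (∀ i → f i ≤ g i) → sum f ≤ sum g
sum-mono {zero}  p = z≤n
sum-mono {suc n} p = +-mono-≤ (p zero) (sum-mono (p ∘ suc))

term≤sum : ∀ {n} (f : Fin n → ℕ) i → f i ≤ sum f
term≤sum f zero    = m≤m+n _ _
term≤sum f (suc i) = ≤-trans (term≤sum (f ∘ suc) i) (m≤n+m _ (f zero))

sum-pos : ∀ {n} (f : Fin n → ℕ) → 0 < sum f → ∃ λ i → 0 < f i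
sum-pos {suc n} f p with f zero in e
... | suc _ = zero , subst (0 <_) (sym e) (s≤s z≤n)
... | zero with sum-pos (f ∘ suc) p
...   | i , q = suc i , q

sum-zero : ∀ n → sum {n} (λ _ → 0) ≡ 0
sum-zero zero    = refl
sum-zero (suc n) = sum-zero n

sum-const-1 : ∀ n → sum {n} (λ _ → 1) ≡ n
sum-const-1 zero    = refl
sum-const-1 (suc n) = cong suc (sum-const-1 n)

cnt : ∀ {n} → (Fin n → Bool) → ℕ
cnt p = sum (λ i → b2n (p i))

b2n≤1 : ∀ b → b2n b ≤ 1
b2n≤1 true  = ≤-refl
b2n≤1 false = z≤n

b2n-pos : ∀ {b} → 0 < b2n b → b ≡ true
b2n-pos {true} _ = refl

cnt≤n : ∀ {n} (p : Fin n → Bool) → cnt p ≤ n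
cnt≤n {n} p = ≤-trans (sum-mono (λ i → b2n≤1 (p i))) (≤-reflexive (sum-const-1 n))

cnt-unique : ∀ {n} (p : Fin n → Bool) → (∀ i j → p i ≡ true → p j ≡ true → i ≡ j) → cnt p ≤ 1
cnt-unique {zero}  p u = z≤n
cnt-unique {suc n} p u with p zero in e
... | false = cnt-unique (p ∘ suc) (λ i j a b → Fin.suc-injective (u (suc i) (suc j) a b))
... | true = s≤s (≤-trans (sum-mono none) (≤-reflexive (sum-zero n)))
  where
  none : ∀ i → b2n (p (suc i)) ≤ 0
  none i with p (suc i) in e'
  ... | false = z≤n
  ... | true with u zero (suc i) e e'
  ...   | ()

sum-δ : ∀ {n} (c : Fin n) (f : Fin n → ℕ) → sum (λ i → b2n (eqᵇ c i) * f i) ≡ f c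
sum-δ {suc n} zero f = trans (cong₂ _+_ (*-identityˡ (f zero)) (sum-zero n)) (+-identityʳ (f zero))
sum-δ (suc c) f = trans (sum-cong-≗ same) (sum-δ c (f ∘ suc))
  where
  same : ∀ i → b2n (eqᵇ (suc c) (suc i)) * f (suc i) ≡ b2n (eqᵇ c i) * f (suc i)
  same i with c Fin.≟ i
  ... | yes _ = refl
  ... | no _  = refl

-- Writing each `f (τ a)` as a sum over all `i` with `τ a ≡ i` and exchanging the sums, `f i` gets
-- as factor the number of preimages of `i`, which is at most one.
sum-injective : ∀ {m n} (τ : Fin m → Fin n) → (∀ {a b} → τ a ≡ τ b → a ≡ b) →
                (f : Fin n → ℕ) → sum (f ∘ τ) ≤ sum f
sum-injective τ inj f = begin
  sum (f ∘ τ)                                          ≡⟨ sum-cong-≗ (λ a → sym (sum-δ (τ a) f)) ⟩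
  sum (λ a → sum (λ i → b2n (eqᵇ (τ a) i) * f i))      ≡⟨ ∑-comm (λ a i → b2n (eqᵇ (τ a) i) * f i) ⟩
  sum (λ i → sum (λ a → b2n (eqᵇ (τ a) i) * f i))      ≡⟨ sum-cong-≗ (λ i → sym (*-distribʳ-sum (f i) (λ a → b2n (eqᵇ (τ a) i)))) ⟩
  sum (λ i → cnt (λ a → eqᵇ (τ a) i) * f i)            ≤⟨ sum-mono (λ i → ≤-trans (*-monoˡ-≤ (f i) (one i)) (≤-reflexive (*-identityˡ (f i)))) ⟩
  sum f                                                ∎
  where
  open ≤-Reasoning
  one : ∀ i → cnt (λ a → eqᵇ (τ a) i) ≤ 1
  one i = cnt-unique _ (λ a b p q → inj (trans (eqᵇ⇒≡ p) (sym (eqᵇ⇒≡ q))))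

-- The number of added edges as a double sum

sumL-++ : ∀ xs ys → sumL (xs ++ ys) ≡ sumL xs + sumL ys
sumL-++ []       ys = refl
sumL-++ (x ∷ xs) ys = trans (cong (x +_) (sumL-++ xs ys)) (sym (+-assoc x _ _))

sumL-map-tabulate : ∀ {A : Set} {n} (f : A → ℕ) (g : Fin n → A) →
                    sumL (map f (tabulate g)) ≡ sum (f ∘ g)
sumL-map-tabulate {n = zero}  f g = refl
sumL-map-tabulate {n = suc n} f g = cong (f (g zero) +_) (sumL-map-tabulate f (g ∘ suc))

sumL-concatMap-tabulate : ∀ {A : Set} {n} (f : A → List ℕ) (g : Fin n → A) →
                          sumL (concatMap f (tabulate g)) ≡ sum (λ i → sumL (f (g i)))
sumL-concatMap-tabulate {n = zero}  f g = refl
sumL-concatMap-tabulate {n = suc n} f g =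
  trans (sumL-++ (f (g zero)) _) (cong (sumL (f (g zero)) +_) (sumL-concatMap-tabulate f (g ∘ suc)))

newᵇ : ∀ {n} → Graph n → Graph n → Fin n → Fin n → Bool
newᵇ G H i j = adj H i j ∧ not (adj G i j)

-- Each added edge is counted twice, once for each order of its ends.
D : ∀ {n} → Graph n → Graph n → ℕ
D G H = sum λ i → sum λ j → b2n (newᵇ G H i j)

new-split : ∀ {n} (G H : Graph n) i j →
            b2n (newᵇ G H i j) ≡ b2n (isNewEdge G H i j) + b2n (isNewEdge G H j i)
new-split G H i j with toℕ i <? toℕ j | toℕ j <? toℕ i
... | yes p | yes q = contradiction q (<-asym p)
... | no p | no q with toℕ-injective (≤-antisym (≮⇒≥ q) (≮⇒≥ p))
-- On the diagonal neither order counts, and `newᵇ` vanishes because `H` has no loops.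
...   | refl rewrite irrefl H i = refl
new-split G H i j | yes _ | no _ with adj H i j | adj G i j
... | true  | true  = refl
... | true  | false = refl
... | false | _     = refl
new-split G H i j | no _ | yes _ rewrite adj-sym H i j | adj-sym G i j with adj H j i | adj G j i
... | true  | true  = refl
... | true  | false = refl
... | false | _     = refl

D≡2*added : ∀ {n} (G H : Graph n) → D G H ≡ addedEdges G H + addedEdges G H
D≡2*added {n} G H = begin
  D G H
    ≡⟨ sum-cong-≗ (λ i → trans (sum-cong-≗ (new-split G H i)) (∑-distrib-+ (λ j → ine i j) (λ j → ine j i))) ⟩
  sum (λ i → sum (λ j → ine i j) + sum (λ j → ine j i))
    ≡⟨ ∑-distrib-+ (λ i → sum (λ j → ine i j)) (λ i → sum (λ j → ine j i)) ⟩
  sum (λ i → sum (λ j → ine i j)) + sum (λ i → sum (λ j → ine j i))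
    ≡⟨ cong (sum (λ i → sum (λ j → ine i j)) +_) (∑-comm (λ i j → ine j i)) ⟩
  sum (λ i → sum (λ j → ine i j)) + sum (λ j → sum (λ i → ine j i))
    ≡⟨ cong₂ _+_ (sym added) (sym added) ⟩
  addedEdges G H + addedEdges G H ∎
  where
  open ≡-Reasoning
  ine : Fin n → Fin n → ℕ
  ine i j = b2n (isNewEdge G H i j)
  added : addedEdges G H ≡ sum (λ i → sum (λ j → ine i j))
  added = trans (sumL-concatMap-tabulate (λ i → map (ine i) (allFin n)) id)
                (sum-cong-≗ (λ i → sumL-map-tabulate (ine i) id))

-- Obstructions and solutions

Obs : ∀ {n} → Graph n → Fin n → Fin n → Fin n → Fin n → Set
Obs G a b c d = Edge G a b × Edge G b c × Edge G c d × NonEdge G a c × NonEdge G b d × a ≢ c × b ≢ d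

Free : ∀ {n} → Graph n → Set
Free G = ∀ a b c d → ¬ Obs G a b c d

edge≢ : ∀ {n} (G : Graph n) {i j} → Edge G i j → i ≢ j
edge≢ G {i} e refl = true≢false e (irrefl G i)

edge-sym : ∀ {n} (G : Graph n) {i j} → Edge G i j → Edge G j i
edge-sym G {i} {j} e = trans (adj-sym G j i) e

nonEdge-sym : ∀ {n} (G : Graph n) {i j} → NonEdge G i j → NonEdge G j i
nonEdge-sym G {i} {j} e = trans (adj-sym G j i) e

Obs-reverse : ∀ {n} (G : Graph n) {a b c d} → Obs G a b c d → Obs G d c b a
Obs-reverse G (ab , bc , cd , ac , bd , a≢c , b≢d) =
  edge-sym G cd , edge-sym G bc , edge-sym G ab , nonEdge-sym G bd , nonEdge-sym G ac , b≢d ∘ sym , a≢c ∘ sym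

Free⇒TP : ∀ {n} (G : Graph n) → Free G → TriviallyPerfect G
Free⇒TP G free a b c d =
  (λ { ((_ , a≢c , _ , _ , b≢d , _) , ab , bc , cd , ac , bd , _) → free a b c d (ab , bc , cd , ac , bd , a≢c , b≢d) }) ,
  (λ { ((_ , a≢c , _ , _ , b≢d , _) , ab , bc , cd , _ , ac , bd) → free a b c d (ab , bc , cd , ac , bd , a≢c , b≢d) })

-- An obstruction leaves the pair `d a` open: if present, it closes an induced C4; if absent, it
-- leaves an induced P4. Three of the inequalities come from the edges, and `a ≢ d` holds because
-- `c` is adjacent to `d` but not to `a`.
TP⇒Free : ∀ {n} (G : Graph n) → TriviallyPerfect G → Free G
TP⇒Free G tp a b c d (ab , bc , cd , ac , bd , a≢c , b≢d) = go (adj G d a) refl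
  where
  distinct : AllDistinct4 a b c d
  distinct = edge≢ G ab , a≢c , (λ { refl → true≢false cd (nonEdge-sym G ac) }) , edge≢ G bc , b≢d , edge≢ G cd
  go : ∀ x → adj G d a ≡ x → ⊥
  go true  da = proj₂ (tp a b c d) (distinct , ab , bc , cd , da , ac , bd)
  go false da = proj₁ (tp a b c d) (distinct , ab , bc , cd , ac , bd , nonEdge-sym G da)

-- Cost and budget are both doubled, so that the argument can work with sums over ordered pairs
-- throughout; `D` then also counts the ends of added edges.
Sol : ∀ {n} → Graph n → ℕ → Set
Sol {n} G k = Σ (Graph n) λ H → Supergraph G H × D G H ≤ k + k × Free H

Yes⇒Sol : ∀ {n} (G : Graph n) k → YesInstance (inst n G k) → Sol G k
Yes⇒Sol G k (H , sup , c , tp) = H , sup , ≤-trans (≤-reflexive (D≡2*added G H)) (+-mono-≤ c c) , TP⇒Free H tp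

Sol⇒Yes : ∀ {n} (G : Graph n) k → Sol G k → YesInstance (inst n G k)
Sol⇒Yes G k (H , sup , c , free) = H , sup , ≮⇒≥ big , Free⇒TP H free
  where
  big : ¬ (k < addedEdges G H)
  big lt = <⇒≱ (+-mono-< lt lt) (≤-trans (≤-reflexive (sym (D≡2*added G H))) c)

-- No completion has more than `n * n` new ordered pairs, so a budget beyond that can be lowered.
-- This lets a machine with bounded registers treat a parameter of any size.
Sol-cap : ∀ {n} (G : Graph n) k → n * n ≤ k → ∀ k' → Sol G k' → Sol G (k' ⊓ k)
Sol-cap {n} G k n²≤k k' (H , sup , c , free) with k' ≤? k
... | yes p = H , sup , subst (λ z → D G H ≤ z + z) (sym (m≤n⇒m⊓n≡m p)) c , free
... | no p = H , sup , subst (λ z → D G H ≤ z + z) (sym (m≥n⇒m⊓n≡n (<⇒≤ (≰⇒> p)))) (≤-trans small (m≤m+n k k)) , free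
  where
  open ≤-Reasoning
  small : D G H ≤ k
  small = begin
    D G H                                 ≤⟨ sum-mono (λ i → cnt≤n (newᵇ G H i)) ⟩
    sum {n} (λ _ → n)                     ≡⟨ sum-cong-≗ {n} (λ _ → sym (*-identityˡ n)) ⟩
    sum {n} (λ _ → 1 * n)                 ≡⟨ sym (*-distribʳ-sum {n} n (λ _ → 1)) ⟩
    sum {n} (λ _ → 1) * n                 ≡⟨ cong (_* n) (sum-const-1 n) ⟩
    n * n                                 ≤⟨ n²≤k ⟩
    k                                     ∎

Sol-mono : ∀ {n} (G : Graph n) {k k'} → k ≤ k' → Sol G k → Sol G k'
Sol-mono G p (H , sup , c , free) = H , sup , ≤-trans c (+-mono-≤ p p) , free

-- Distinct new pairs of the pullback of `H` have distinct images among the new pairs of `H`, so the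
-- cost does not grow. It serves to pass to the kernel, and in `kernel⇒Sol` to renumber the
-- vertices.
Sol-induced : ∀ {m n} (G : Graph m) (G' : Graph n) (τ : Fin n → Fin m) → (∀ {a b} → τ a ≡ τ b → a ≡ b) →
              (∀ i j → adj G' i j ≡ adj G (τ i) (τ j)) → ∀ {k} → Sol G k → Sol G' k
Sol-induced G G' τ inj ind (H , sup , c , free) = H' , sup' , ≤-trans cost c , free'
  where
  open ≤-Reasoning
  H' : Graph _
  H' = record { adj = λ i j → adj H (τ i) (τ j) ; sym = λ i j → adj-sym H (τ i) (τ j) ; irrefl = λ i → irrefl H (τ i) }
  sup' : Supergraph G' H'
  sup' i j e = sup (τ i) (τ j) (trans (sym (ind i j)) e)
  free' : Free H'
  free' a b c d (ab , bc , cd , ac , bd , a≢c , b≢d) =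
    free (τ a) (τ b) (τ c) (τ d) (ab , bc , cd , ac , bd , (λ e → a≢c (inj e)) , (λ e → b≢d (inj e)))
  cost : D G' H' ≤ D G H
  cost = begin
    D G' H' ≡⟨ sum-cong-≗ (λ i → sum-cong-≗ (λ j → cong (λ z → b2n (adj H (τ i) (τ j) ∧ not z)) (ind i j))) ⟩
    sum (λ i → sum (λ j → b2n (newᵇ G H (τ i) (τ j)))) ≤⟨ sum-mono (λ i → sum-injective τ inj (λ j → b2n (newᵇ G H (τ i) j))) ⟩
    sum (λ i → sum (λ j → b2n (newᵇ G H (τ i) j)))     ≤⟨ sum-injective τ inj (λ i → sum (λ j → b2n (newᵇ G H i j))) ⟩
    D G H ∎

-- The three edges survive in `H`, so if neither missing pair were added, the same four vertices
-- would obstruct `H`.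
hit : ∀ {n} (G H : Graph n) → Supergraph G H → Free H → ∀ {a b c d} → Obs G a b c d →
      newᵇ G H a c ≡ true ⊎ newᵇ G H b d ≡ true
hit G H sup free {a} {b} {c} {d} (ab , bc , cd , ac , bd , a≢c , b≢d)
  with adj H a c in eac | adj H b d in ebd
... | true  | _     = inj₁ (not-false ac)
... | false | true  = inj₂ (not-false bd)
... | false | false = ⊥-elim (free a b c d (sup a b ab , sup b c bc , sup c d cd , eac , ebd , a≢c , b≢d))

new-sym : ∀ {n} (G H : Graph n) {i j} → newᵇ G H i j ≡ true → newᵇ G H j i ≡ true
new-sym G H {i} {j} e = trans (cong₂ (λ x y → x ∧ not y) (adj-sym H j i) (adj-sym G j i)) e

-- Partners and forced pairs

neᵇ : ∀ {n} → Fin n → Fin n → Bool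
neᵇ i j = (toℕ i <ᵇ toℕ j) ∨ (toℕ j <ᵇ toℕ i)

neᵇ⇒≢ : ∀ {n} {i j : Fin n} → neᵇ i j ≡ true → i ≢ j
neᵇ⇒≢ {i = i} e refl with ∨-true (toℕ i <ᵇ toℕ i) e
... | inj₁ p = <-irrefl refl (<ᵇ-true {toℕ i} p)
... | inj₂ p = <-irrefl refl (<ᵇ-true {toℕ i} p)

≢⇒neᵇ : ∀ {n} {i j : Fin n} → i ≢ j → neᵇ i j ≡ true
≢⇒neᵇ {i = i} {j} ne with <-cmp (toℕ i) (toℕ j)
... | tri< a _ _ = ∨-introˡ _ (<⇒<ᵇ-true a)
... | tri≈ _ b _ = contradiction (toℕ-injective b) ne
... | tri> _ _ c = ∨-introʳ (toℕ i <ᵇ toℕ j) (<⇒<ᵇ-true c)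

-- A positive count, so that existence becomes the case of threshold 0 of the counting quantifier
-- which the program evaluates. For the same reason `neᵇ` is built from `<ᵇ`, the only comparison
-- between registers.
exᵇ : ∀ {n} → (Fin n → Bool) → Bool
exᵇ p = 0 <ᵇ cnt p

exᵇ⇒∃ : ∀ {n} {p : Fin n → Bool} → exᵇ p ≡ true → ∃ λ i → p i ≡ true
exᵇ⇒∃ {p = p} e with sum-pos (λ i → b2n (p i)) (<ᵇ-true {0} e)
... | i , q = i , b2n-pos q

∃⇒exᵇ : ∀ {n} (p : Fin n → Bool) i → p i ≡ true → exᵇ p ≡ true
∃⇒exᵇ p i e = <⇒<ᵇ-true (≤-trans (≤-reflexive (cong b2n (sym e))) (term≤sum (λ j → b2n (p j)) i))

obsᵇ : ∀ {n} → Graph n → Fin n → Fin n → Fin n → Fin n → Bool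
obsᵇ G a b c d = adj G a b ∧ (adj G b c ∧ (adj G c d ∧ (not (adj G a c) ∧ (not (adj G b d) ∧ (neᵇ a c ∧ neᵇ b d)))))

-- Some obstruction has ac and xy as its two non-adjacent pairs.
quadᵇ : ∀ {n} → Graph n → Fin n → Fin n → Fin n → Fin n → Bool
quadᵇ G a c x y = obsᵇ G a x c y ∨ (obsᵇ G c x a y ∨ (obsᵇ G a y c x ∨ obsᵇ G c y a x))

partᵇ : ∀ {n} → Graph n → Fin n → Fin n → Fin n → Bool
partᵇ G a c x = exᵇ (λ y → quadᵇ G a c x y)

badᵇ : ∀ {n} → Graph n → Fin n → Bool
badᵇ G v = exᵇ (λ c → exᵇ (λ x → partᵇ G v c x))

forcedᵇ : ∀ {n} → Graph n → ℕ → Fin n → Fin n → Bool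
forcedᵇ G t a c = neᵇ a c ∧ (not (adj G a c) ∧ (t <ᵇ cnt (partᵇ G a c)))

obsᵇ⇒Obs : ∀ {n} (G : Graph n) {a b c d} → obsᵇ G a b c d ≡ true → Obs G a b c d
obsᵇ⇒Obs G {a} {b} {c} {d} e =
  ∧-conicalˡ _ _ e , ∧-conicalˡ _ _ e₁ , ∧-conicalˡ _ _ e₂ , not-true (∧-conicalˡ _ _ e₃) , not-true (∧-conicalˡ _ _ e₄) ,
  neᵇ⇒≢ (∧-conicalˡ _ _ e₅) , neᵇ⇒≢ (∧-conicalʳ (neᵇ a c) _ e₅)
  where
  e₁ = ∧-conicalʳ (adj G a b) _ e
  e₂ = ∧-conicalʳ (adj G b c) _ e₁
  e₃ = ∧-conicalʳ (adj G c d) _ e₂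
  e₄ = ∧-conicalʳ (not (adj G a c)) _ e₃
  e₅ = ∧-conicalʳ (not (adj G b d)) _ e₄

Obs⇒obsᵇ : ∀ {n} (G : Graph n) {a b c d} → Obs G a b c d → obsᵇ G a b c d ≡ true
Obs⇒obsᵇ G (ab , bc , cd , ac , bd , a≢c , b≢d) =
  ∧-true ab (∧-true bc (∧-true cd (∧-true (not-false ac) (∧-true (not-false bd) (∧-true (≢⇒neᵇ a≢c) (≢⇒neᵇ b≢d))))))

-- There are eight ways to place the two pairs on the positions 1, 3 and 2, 4 of a path. Reversing
-- the path exchanges these sets of positions, which leaves the four ways with `a` and `c` on
-- positions 1 and 3.
data Quad {n} (G : Graph n) (a c x y : Fin n) : Set where
  axcy : Obs G a x c y → Quad G a c x y
  cxay : Obs G c x a y → Quad G a c x y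
  aycx : Obs G a y c x → Quad G a c x y
  cyax : Obs G c y a x → Quad G a c x y

quadᵇ⇒Quad : ∀ {n} (G : Graph n) {a c x y} → quadᵇ G a c x y ≡ true → Quad G a c x y
quadᵇ⇒Quad G {a} {c} {x} {y} e with ∨-true (obsᵇ G a x c y) e
... | inj₁ p = axcy (obsᵇ⇒Obs G p)
... | inj₂ e' with ∨-true (obsᵇ G c x a y) e'
...   | inj₁ p = cxay (obsᵇ⇒Obs G p)
...   | inj₂ e'' with ∨-true (obsᵇ G a y c x) e''
...     | inj₁ p = aycx (obsᵇ⇒Obs G p)
...     | inj₂ p = cyax (obsᵇ⇒Obs G p)

Quad⇒quadᵇ : ∀ {n} (G : Graph n) {a c x y} → Quad G a c x y → quadᵇ G a c x y ≡ true
Quad⇒quadᵇ G {a} {c} {x} {y} (axcy p) = ∨-introˡ _ (Obs⇒obsᵇ G p)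
Quad⇒quadᵇ G {a} {c} {x} {y} (cxay p) = ∨-introʳ (obsᵇ G a x c y) (∨-introˡ _ (Obs⇒obsᵇ G p))
Quad⇒quadᵇ G {a} {c} {x} {y} (aycx p) = ∨-introʳ (obsᵇ G a x c y) (∨-introʳ (obsᵇ G c x a y) (∨-introˡ _ (Obs⇒obsᵇ G p)))
Quad⇒quadᵇ G {a} {c} {x} {y} (cyax p) = ∨-introʳ (obsᵇ G a x c y) (∨-introʳ (obsᵇ G c x a y) (∨-introʳ (obsᵇ G a y c x) (Obs⇒obsᵇ G p)))

-- Reversal exchanges the two missing pairs. So with `Quad G v c x y` the vertex `v` is an end of
-- `v c` and at the same time a partner of `x y`.
Quad-swap : ∀ {n} (G : Graph n) {a c x y} → Quad G a c x y → Quad G x y a c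
Quad-swap G (axcy p) = cyax (Obs-reverse G p)
Quad-swap G (cxay p) = cxay (Obs-reverse G p)
Quad-swap G (aycx p) = aycx (Obs-reverse G p)
Quad-swap G (cyax p) = axcy (Obs-reverse G p)

Quad-hit : ∀ {n} (G H : Graph n) → Supergraph G H → Free H → ∀ {a c x y} → Quad G a c x y →
           newᵇ G H a c ≡ true ⊎ newᵇ G H x y ≡ true
Quad-hit G H sup free (axcy p) = hit G H sup free p
Quad-hit G H sup free (cxay p) with hit G H sup free p
... | inj₁ q = inj₁ (new-sym G H q)
... | inj₂ q = inj₂ q
Quad-hit G H sup free (aycx p) with hit G H sup free p
... | inj₁ q = inj₁ q
... | inj₂ q = inj₂ (new-sym G H q)
Quad-hit G H sup free (cyax p) with hit G H sup free p
... | inj₁ q = inj₁ (new-sym G H q)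
... | inj₂ q = inj₂ (new-sym G H q)

Obs⇒bad₁ : ∀ {n} (G : Graph n) {a b c d} → Obs G a b c d → badᵇ G a ≡ true
Obs⇒bad₁ G {a} {b} {c} {d} o = ∃⇒exᵇ _ c (∃⇒exᵇ _ b (∃⇒exᵇ _ d (Quad⇒quadᵇ G (axcy o))))

Obs⇒bad₂ : ∀ {n} (G : Graph n) {a b c d} → Obs G a b c d → badᵇ G b ≡ true
Obs⇒bad₂ G {a} {b} {c} {d} o = ∃⇒exᵇ _ d (∃⇒exᵇ _ a (∃⇒exᵇ _ c (Quad⇒quadᵇ G (Quad-swap G (axcy o)))))

-- The threshold is `D G H` itself, without a factor: row `x` of `D` is positive for every end `x`
-- of an added edge, so `D` bounds the number of ends.
forced⇒edge : ∀ {n} (G H : Graph n) → Supergraph G H → Free H → ∀ {a c} → D G H < cnt (partᵇ G a c) → newᵇ G H a c ≡ true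
forced⇒edge G H sup free {a} {c} lt with newᵇ G H a c in e
... | true  = refl
... | false = contradiction lt (≤⇒≯ (sum-mono covered))
  where
  covered : ∀ x → b2n (partᵇ G a c x) ≤ sum (λ y → b2n (newᵇ G H x y))
  covered x with partᵇ G a c x in p
  ... | false = z≤n
  ... | true with exᵇ⇒∃ {p = quadᵇ G a c x} p
  ...   | y , q with Quad-hit G H sup free (quadᵇ⇒Quad G {a} {c} {x} {y} q)
  ...     | inj₁ r = ⊥-elim (true≢false r e)
  ...     | inj₂ r = ≤-trans (≤-reflexive (cong b2n (sym r))) (term≤sum (λ z → b2n (newᵇ G H x z)) y)

addEdge : ∀ {n} (G : Graph n) (a c : Fin n) → a ≢ c → Graph n
addEdge G a c a≢c = record
  { adj = λ i j → adj G i j ∨ (isPair a c i j ∨ isPair c a i j)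
  ; sym = λ i j → cong₂ _∨_ (adj-sym G i j) (flip a c i j)
  ; irrefl = λ i → trans (cong (_∨ (isPair a c i i ∨ isPair c a i i)) (irrefl G i)) (off i) }
  where
  isPair : Fin _ → Fin _ → Fin _ → Fin _ → Bool
  isPair a c i j = eqᵇ c j ∧ eqᵇ a i
  flip : ∀ a c i j → isPair a c i j ∨ isPair c a i j ≡ isPair a c j i ∨ isPair c a j i
  flip a c i j = trans (∨-comm (isPair a c i j) _) (cong₂ _∨_ (∧-comm (eqᵇ a j) _) (∧-comm (eqᵇ c j) _))
  off : ∀ i → isPair a c i i ∨ isPair c a i i ≡ false
  off i with a Fin.≟ i | c Fin.≟ i
  ... | yes refl | yes refl = contradiction refl a≢c
  ... | yes _    | no _  = refl
  ... | no _     | yes _ = refl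
  ... | no _     | no _  = refl

sum-pair : ∀ {n} (a c : Fin n) → sum (λ i → sum (λ j → b2n (eqᵇ c j ∧ eqᵇ a i))) ≡ 1
sum-pair a c = trans (sum-cong-≗ inner) (sum-δ a (λ _ → 1))
  where
  b2n-∧ : ∀ x y → b2n (x ∧ y) ≡ b2n x * b2n y
  b2n-∧ true  y = sym (*-identityˡ (b2n y))
  b2n-∧ false y = refl
  inner : ∀ i → sum (λ j → b2n (eqᵇ c j ∧ eqᵇ a i)) ≡ b2n (eqᵇ a i) * 1
  inner i = trans (sum-cong-≗ (λ j → b2n-∧ (eqᵇ c j) (eqᵇ a i)))
                  (trans (sum-δ c (λ _ → b2n (eqᵇ a i))) (sym (*-identityʳ _)))

D-addEdge : ∀ {n} (G H : Graph n) {a c} (a≢c : a ≢ c) → newᵇ G H a c ≡ true →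
            D G H ≡ D (addEdge G a c a≢c) H + 2
D-addEdge {n} G H {a} {c} a≢c new = begin
  D G H
    ≡⟨ sum-cong-≗ (λ i → trans (sum-cong-≗ (term i)) (∑-distrib-+ (λ j → b2n (newᵇ G' H i j)) (λ j → one a c i j + one c a i j))) ⟩
  sum (λ i → sum (λ j → b2n (newᵇ G' H i j)) + sum (λ j → one a c i j + one c a i j))
    ≡⟨ ∑-distrib-+ (λ i → sum (λ j → b2n (newᵇ G' H i j))) (λ i → sum (λ j → one a c i j + one c a i j)) ⟩
  D G' H + sum (λ i → sum (λ j → one a c i j + one c a i j))
    ≡⟨ cong (D G' H +_) (trans (sum-cong-≗ (λ i → ∑-distrib-+ (one a c i) (one c a i)))
         (trans (∑-distrib-+ (λ i → sum (one a c i)) (λ i → sum (one c a i))) (cong₂ _+_ (sum-pair a c) (sum-pair c a)))) ⟩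
  D G' H + 2 ∎
  where
  open ≡-Reasoning
  G' = addEdge G a c a≢c
  one : Fin n → Fin n → Fin n → Fin n → ℕ
  one a c i j = b2n (eqᵇ c j ∧ eqᵇ a i)
  cases : ∀ h g e₁ e₂ → (e₁ ≡ true → h ∧ not g ≡ true) → (e₂ ≡ true → h ∧ not g ≡ true) → (e₁ ≡ true → e₂ ≡ true → ⊥) →
          b2n (h ∧ not g) ≡ b2n (h ∧ not (g ∨ (e₁ ∨ e₂))) + (b2n e₁ + b2n e₂)
  cases h     g     true  true  p q r = ⊥-elim (r refl refl)
  cases true  false true  false p q r = refl
  cases true  false false true  p q r = refl
  cases true  true  true  false p q r with p refl
  ... | ()
  cases false g     true  false p q r with p refl
  ... | ()
  cases true  true  false true  p q r with q refl
  ... | ()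
  cases false g     false true  p q r with q refl
  ... | ()
  cases true  true  false false p q r = refl
  cases true  false false false p q r = refl
  cases false g     false false p q r = refl
  at : ∀ {a c i j} → newᵇ G H a c ≡ true → eqᵇ c j ∧ eqᵇ a i ≡ true → newᵇ G H i j ≡ true
  at {a} {c} {i} {j} e p with eqᵇ⇒≡ {i = c} {j} (∧-conicalˡ _ _ p) | eqᵇ⇒≡ {i = a} {i} (∧-conicalʳ (eqᵇ c j) _ p)
  ... | refl | refl = e
  term : ∀ i j → b2n (newᵇ G H i j) ≡ b2n (newᵇ G' H i j) + (one a c i j + one c a i j)
  term i j = cases (adj H i j) (adj G i j) (eqᵇ c j ∧ eqᵇ a i) (eqᵇ a j ∧ eqᵇ c i) (at new) (at (new-sym G H new))
    -- The two orders of the pair are different entries of the matrix; an entry equal to both would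
    -- give `a ≡ c`.
    (λ p q → a≢c (trans (eqᵇ⇒≡ {i = a} {i} (∧-conicalʳ (eqᵇ c j) _ p)) (sym (eqᵇ⇒≡ {i = c} {i} (∧-conicalʳ (eqᵇ a j) _ q)))))

addEdge-⊇ : ∀ {n} (G : Graph n) {a c} (a≢c : a ≢ c) → Supergraph G (addEdge G a c a≢c)
addEdge-⊇ G a≢c i j e = ∨-introˡ _ e

addEdge-new : ∀ {n} (G : Graph n) {a c} (a≢c : a ≢ c) → Edge (addEdge G a c a≢c) a c
addEdge-new G {a} {c} a≢c = ∨-introʳ (adj G a c) (∨-introˡ _ (∧-true (eqᵇ-refl c) (eqᵇ-refl a)))

forced⇒≢ : ∀ {n} (G : Graph n) {t a c} → forcedᵇ G t a c ≡ true → a ≢ c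
forced⇒≢ G {t} {a} {c} e = neᵇ⇒≢ (∧-conicalˡ _ _ e)

forced⇒nonEdge : ∀ {n} (G : Graph n) {t a c} → forcedᵇ G t a c ≡ true → NonEdge G a c
forced⇒nonEdge G {t} {a} {c} e = not-true (∧-conicalˡ _ _ (∧-conicalʳ (neᵇ a c) _ e))

forced⇒many : ∀ {n} (G : Graph n) {t a c} → forcedᵇ G t a c ≡ true → t < cnt (partᵇ G a c)
forced⇒many G {t} {a} {c} e = <ᵇ-true (∧-conicalʳ (not (adj G a c)) _ (∧-conicalʳ (neᵇ a c) _ e))

-- With budget 0 a single partner forces the pair, and adding the pair already exceeds the budget.
-- The same fact certifies the fixed no-instance.
forced-zero : ∀ {n} (G : Graph n) {a c} → 0 < cnt (partᵇ G a c) → ¬ Sol G 0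
forced-zero G {a} {c} f (H , sup , cost , free)
  with forced⇒edge G H sup free {a} {c} (≤-<-trans cost f)
... | new = contradiction (≤-trans (≤-reflexive (cong b2n (sym new)))
      (≤-trans (term≤sum (λ j → b2n (newᵇ G H a j)) c) (≤-trans (term≤sum (λ i → sum (λ j → b2n (newᵇ G H i j))) a) cost))) λ ()

forced-down : ∀ {n} (G : Graph n) {k a c} (a≢c : a ≢ c) → suc k + suc k < cnt (partᵇ G a c) →
              Sol G (suc k) → Sol (addEdge G a c a≢c) k
forced-down G {k} {a} {c} a≢c f (H , sup , cost , free) = H , sup' , +-cancelʳ-≤ 2 _ _ drop2 , free
  where
  new : newᵇ G H a c ≡ true
  new = forced⇒edge G H sup free {a} {c} (≤-<-trans cost f)
  open ≤-Reasoning
  drop2 : D (addEdge G a c a≢c) H + 2 ≤ k + k + 2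
  drop2 = begin
    D (addEdge G a c a≢c) H + 2 ≡⟨ sym (D-addEdge G H a≢c new) ⟩
    D G H                       ≤⟨ cost ⟩
    suc k + suc k               ≡⟨ cong suc (+-suc k k) ⟩
    2 + (k + k)                 ≡⟨ +-comm 2 (k + k) ⟩
    k + k + 2                   ∎
  sup' : Supergraph (addEdge G a c a≢c) H
  sup' i j e with ∨-true (adj G i j) e
  ... | inj₁ p = sup i j p
  ... | inj₂ p with ∨-true (eqᵇ c j ∧ eqᵇ a i) p
  ...   | inj₁ q with eqᵇ⇒≡ {i = c} {j} (∧-conicalˡ _ _ q) | eqᵇ⇒≡ {i = a} {i} (∧-conicalʳ (eqᵇ c j) _ q)
  ...     | refl | refl = ∧-conicalˡ _ _ new
  sup' i j e | inj₂ p | inj₂ q with eqᵇ⇒≡ {i = a} {j} (∧-conicalˡ _ _ q) | eqᵇ⇒≡ {i = c} {i} (∧-conicalʳ (eqᵇ a j) _ q)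
  ...     | refl | refl = edge-sym H (∧-conicalˡ _ _ new)

forced-up : ∀ {n} (G : Graph n) {k a c} (a≢c : a ≢ c) → NonEdge G a c → Sol (addEdge G a c a≢c) k → Sol G (suc k)
forced-up G {k} {a} {c} a≢c ne (H , sup , cost , free) =
  H , (λ i j e → sup i j (addEdge-⊇ G a≢c i j e)) , more , free
  where
  open ≤-Reasoning
  more : D G H ≤ suc k + suc k
  more = begin
    D G H ≡⟨ D-addEdge G H a≢c (∧-true (sup a c (addEdge-new G a≢c)) (not-false ne)) ⟩
    D (addEdge G a c a≢c) H + 2 ≤⟨ +-monoˡ-≤ 2 cost ⟩
    k + k + 2                   ≡⟨ +-comm (k + k) 2 ⟩
    2 + (k + k)                 ≡⟨ cong suc (sym (+-suc k k)) ⟩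
    suc k + suc k               ∎

-- Every vertex of an obstruction is an end of an added edge or a partner of one.
bad-bound : ∀ {n} (G : Graph n) k t → (∀ a c → forcedᵇ G t a c ≡ false) → Sol G k → cnt (badᵇ G) ≤ (k + k) * suc t
bad-bound {n} G k t none (H , sup , cost , free) = begin
  cnt (badᵇ G)                                                ≤⟨ sum-mono covered ⟩
  sum (λ v → sum (λ a → sum (λ c → new a c * near a c v)))    ≡⟨ ∑-comm (λ v a → sum (λ c → new a c * near a c v)) ⟩
  sum (λ a → sum (λ v → sum (λ c → new a c * near a c v)))    ≡⟨ sum-cong-≗ (λ a → ∑-comm (λ v c → new a c * near a c v)) ⟩
  sum (λ a → sum (λ c → sum (λ v → new a c * near a c v)))    ≤⟨ sum-mono (λ a → sum-mono (λ c → few a c)) ⟩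
  sum (λ a → sum (λ c → new a c * suc t))                     ≡⟨ sum-cong-≗ (λ a → sym (*-distribʳ-sum (suc t) (new a))) ⟩
  sum (λ a → sum (new a) * suc t)                             ≡⟨ sym (*-distribʳ-sum (suc t) (λ a → sum (new a))) ⟩
  D G H * suc t                                               ≤⟨ *-monoˡ-≤ (suc t) cost ⟩
  (k + k) * suc t                                             ∎
  where
  open ≤-Reasoning
  new : Fin n → Fin n → ℕ
  new a c = b2n (newᵇ G H a c)
  -- Only the end `a` is charged here; the other end is charged when the same edge appears in the
  -- order `c`, `a`. This is the `1` in `suc t`.
  near : Fin n → Fin n → Fin n → ℕ
  near a c v = b2n (eqᵇ a v) * 1 + b2n (partᵇ G a c v)
  few : ∀ a c → sum (λ v → new a c * near a c v) ≤ new a c * suc t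
  few a c = ≤-trans (≤-reflexive (sym (*-distribˡ-sum (new a c) (near a c)))) go
    where
    go : new a c * sum (near a c) ≤ new a c * suc t
    go with newᵇ G H a c in e
    ... | false = z≤n
    ... | true = *-monoʳ-≤ 1 (≤-trans (≤-reflexive (trans (∑-distrib-+ (λ v → b2n (eqᵇ a v) * 1) (λ v → b2n (partᵇ G a c v)))
                    (cong (_+ cnt (partᵇ G a c)) (sum-δ a (λ _ → 1))))) (s≤s small))
      where
      small : cnt (partᵇ G a c) ≤ t
      small with none a c
      -- The pair is new, hence distinct and missing in `G`. The only conjunct of `forcedᵇ` left to
      -- fail is the comparison with `t`.
      ... | f rewrite ≢⇒neᵇ (edge≢ H (∧-conicalˡ (adj H a c) _ e)) | ∧-conicalʳ (adj H a c) _ e = <ᵇ-false {t} f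
  one : ∀ a c v → newᵇ G H a c ≡ true → 1 ≤ near a c v → 1 ≤ sum (λ a → sum (λ c → new a c * near a c v))
  one a c v e p = ≤-trans p (≤-trans (≤-reflexive (trans (sym (*-identityˡ _)) (cong (_* near a c v) (cong b2n (sym e)))))
    (≤-trans (term≤sum (λ c → new a c * near a c v) c) (term≤sum (λ a → sum (λ c → new a c * near a c v)) a)))
  covered : ∀ v → b2n (badᵇ G v) ≤ sum (λ a → sum (λ c → new a c * near a c v))
  covered v with badᵇ G v in e
  ... | false = z≤n
  ... | true with exᵇ⇒∃ {p = λ c → exᵇ (λ x → partᵇ G v c x)} e
  ...   | c , e₁ with exᵇ⇒∃ {p = partᵇ G v c} e₁
  ...     | x , e₂ with exᵇ⇒∃ {p = quadᵇ G v c x} e₂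
  ...       | y , e₃ with Quad-hit G H sup free (quadᵇ⇒Quad G {v} {c} {x} {y} e₃)
  ...         | inj₁ r = one v c v r (≤-trans (≤-reflexive (cong (λ z → b2n z * 1) (sym (eqᵇ-refl v)))) (m≤m+n _ _))
  ...         | inj₂ r = one x y v r (≤-trans (≤-reflexive (cong b2n (sym (∃⇒exᵇ (quadᵇ G x y v) c
                           (Quad⇒quadᵇ G (Quad-swap G (quadᵇ⇒Quad G {v} {c} {x} {y} e₃))))))) (m≤n+m _ _))

-- Putting back a vertex that lies in no obstruction

allᵇ : ∀ {n} → (Fin n → Bool) → Bool
allᵇ {zero}  p = true
allᵇ {suc n} p = p zero ∧ allᵇ (p ∘ suc)

allᵇ⇒∀ : ∀ {n} {p : Fin n → Bool} → allᵇ p ≡ true → ∀ i → p i ≡ true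
allᵇ⇒∀ {suc n} e zero    = ∧-conicalˡ _ _ e
allᵇ⇒∀ {suc n} {p} e (suc i) = allᵇ⇒∀ {p = p ∘ suc} (∧-conicalʳ (p zero) _ e) i

∀⇒allᵇ : ∀ {n} {p : Fin n → Bool} → (∀ i → p i ≡ true) → allᵇ p ≡ true
∀⇒allᵇ {zero}  f = refl
∀⇒allᵇ {suc n} f = ∧-true (f zero) (∀⇒allᵇ (f ∘ suc))

allᵇ-false : ∀ {n} {p : Fin n → Bool} → allᵇ p ≡ false → ∃ λ i → p i ≡ false
allᵇ-false {suc n} {p} e with p zero in q
... | false = zero , q
... | true with allᵇ-false {p = p ∘ suc} e
...   | i , r = suc i , r

_≡?_ : Bool → Bool → Bool
true  ≡? b = b
false ≡? b = not b

≡?-sound : ∀ x y → (x ≡? y) ≡ true → x ≡ y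
≡?-sound true  y e = sym e
≡?-sound false y e = sym (not-true e)

≡?-complete : ∀ x {y} → x ≡ y → (x ≡? y) ≡ true
≡?-complete true  refl = refl
≡?-complete false refl = refl

bool-case : ∀ {A : Set} x → (x ≡ true → A) → (x ≡ false → A) → A
bool-case true  f g = f refl
bool-case false f g = g refl

-- A vertex v in no obstruction can be put back into any solution H of G - v.
-- The vertices outside N[v] are grouped by their neighbours in N(v); adjacent
-- ones lie in one group.  Keep H inside N(v) and inside each group, and between
-- x ∈ N(v) and a group only if x is H-adjacent to all of both N(v) and the group.
-- The result is a subgraph of H on G - v, hence costs no more.
module Insert {n} (G : Graph (suc n)) where

  G⁻ : Graph n
  G⁻ = record { adj = λ i j → adj G (suc i) (suc j) ; sym = λ i j → adj-sym G (suc i) (suc j) ; irrefl = λ i → irrefl G (suc i) }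

  N : Fin n → Bool
  N i = adj G zero (suc i)

  module _ (¬bad : badᵇ G zero ≡ false) (H : Graph n) (sup : Supergraph G⁻ H) (free : Free H) where

    group : Fin n → Fin n → Bool
    group x y = allᵇ (λ u → not (N u) ∨ (adj G⁻ u x ≡? adj G⁻ u y))

    group-sym : ∀ {x y} → group x y ≡ true → group y x ≡ true
    group-sym {x} {y} e = ∀⇒allᵇ λ u → flip (N u) (adj G⁻ u x) (adj G⁻ u y) (allᵇ⇒∀ e u)
      where
      flip : ∀ a b c → not a ∨ (b ≡? c) ≡ true → not a ∨ (c ≡? b) ≡ true
      flip false _ _ _ = refl
      flip true b c e = ≡?-complete c (sym (≡?-sound b c e))

    group-trans : ∀ {x y z} → group x y ≡ true → group y z ≡ true → group x z ≡ true
    group-trans {x} {y} {z} e f = ∀⇒allᵇ λ u → comp (N u) (adj G⁻ u x) (adj G⁻ u y) (adj G⁻ u z) (allᵇ⇒∀ e u) (allᵇ⇒∀ f u)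
      where
      comp : ∀ a b c d → not a ∨ (b ≡? c) ≡ true → not a ∨ (c ≡? d) ≡ true → not a ∨ (b ≡? d) ≡ true
      comp false _ _ _ _ _ = refl
      comp true b c d e f = ≡?-complete b (trans (≡?-sound b c e) (≡?-sound c d f))

    group-refl : ∀ x → group x x ≡ true
    group-refl x = ∀⇒allᵇ λ u → ∨-introʳ (not (N u)) (≡?-complete (adj G⁻ u x) refl)

    group-adj : ∀ {x y u} → group x y ≡ true → N u ≡ true → adj G⁻ u x ≡ adj G⁻ u y
    group-adj {x} {y} {u} e nu with allᵇ⇒∀ e u
    ... | r rewrite nu = ≡?-sound (adj G⁻ u x) _ r

    dom : Fin n → Bool
    dom x = allᵇ (λ z → not (N z) ∨ (eqᵇ x z ∨ adj H x z))

    full : Fin n → Fin n → Bool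
    full x y = dom x ∧ allᵇ (λ z → N z ∨ (not (group y z) ∨ adj H x z))

    dom-adj : ∀ {x z} → dom x ≡ true → N z ≡ true → x ≢ z → adj H x z ≡ true
    dom-adj {x} {z} e nz ne with allᵇ⇒∀ e z
    ... | r rewrite nz with ∨-true (eqᵇ x z) r
    ...   | inj₁ p = contradiction (eqᵇ⇒≡ p) ne
    ...   | inj₂ p = p

    full-adj : ∀ {x y z} → full x y ≡ true → N z ≡ false → group y z ≡ true → adj H x z ≡ true
    full-adj {x} {y} {z} e nz g with allᵇ⇒∀ (∧-conicalʳ (dom x) _ e) z
    ... | r rewrite nz | g = r

    full-dom : ∀ {x y} → full x y ≡ true → dom x ≡ true
    full-dom e = ∧-conicalˡ _ _ e

    full-group : ∀ {x y z} → full x y ≡ true → group y z ≡ true → full x z ≡ true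
    full-group {x} {y} {z} e g = ∧-true (full-dom {x} {y} e) (∀⇒allᵇ λ w → go w (N w) (group z w) refl refl)
      where
      go : ∀ w a b → N w ≡ a → group z w ≡ b → a ∨ (not b ∨ adj H x w) ≡ true
      go w true  _     _  _  = refl
      go w false false _  _  = refl
      go w false true  nw gw = full-adj {x} {y} e nw (group-trans {y} {z} {w} g gw)

    full-false : ∀ {x y} → dom x ≡ true → full x y ≡ false → ∃ λ z → N z ≡ false × group y z ≡ true × adj H x z ≡ false
    full-false {x} {y} d e rewrite d with allᵇ-false e
    ... | z , r with ∨-false (N z) r
    ...   | p , q with ∨-false (not (group y z)) q
    ...     | s , t = z , p , not-false⁻ s , t
      where
      not-false⁻ : ∀ {b} → not b ≡ false → b ≡ true
      not-false⁻ {true} _ = refl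

    link : Bool → Bool → Fin n → Fin n → Bool
    link true  true  i j = adj H i j
    link true  false i j = full i j
    link false true  i j = full j i
    link false false i j = adj H i j ∧ group i j

    h : Fin n → Fin n → Bool
    h i j = link (N i) (N j) i j

    group-comm : ∀ i j → group i j ≡ group j i
    group-comm i j with group i j in e | group j i in f
    ... | true  | true  = refl
    ... | false | false = refl
    ... | true  | false = ⊥-elim (true≢false (group-sym {i} {j} e) f)
    ... | false | true  = ⊥-elim (true≢false (group-sym {j} {i} f) e)

    link-sym : ∀ a b i j → link a b i j ≡ link b a j i
    link-sym true  true  i j = adj-sym H i j
    link-sym true  false i j = refl
    link-sym false true  i j = refl
    link-sym false false i j = cong₂ _∧_ (adj-sym H i j) (group-comm i j)

    link-irrefl : ∀ i → h i i ≡ false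
    link-irrefl i with N i
    ... | true  = irrefl H i
    ... | false = cong (_∧ group i i) (irrefl H i)

    H⁺ : Graph (suc n)
    H⁺ = record { adj = a ; sym = s ; irrefl = r }
      where
      a : Fin (suc n) → Fin (suc n) → Bool
      a zero    zero    = false
      a zero    (suc j) = N j
      a (suc i) zero    = N i
      a (suc i) (suc j) = h i j
      s : ∀ i j → a i j ≡ a j i
      s zero    zero    = refl
      s zero    (suc j) = refl
      s (suc i) zero    = refl
      s (suc i) (suc j) = link-sym (N i) (N j) i j
      r : ∀ i → a i i ≡ false
      r zero    = refl
      r (suc i) = link-irrefl i

    dom⇒h : ∀ {x z} → N x ≡ true → dom x ≡ true → N z ≡ true → x ≢ z → h x z ≡ true
    dom⇒h nx d nz ne rewrite nx | nz = dom-adj d nz ne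

    out-dom : ∀ {x y} → N x ≡ true → N y ≡ false → h x y ≡ true → full x y ≡ true
    out-dom nx ny e rewrite nx | ny = e

    suc≢ : ∀ {i j : Fin n} → Fin.suc i ≢ suc j → i ≢ j
    suc≢ ne refl = ne refl

    -- A vertex of `N` with an edge leaving `N` is `dom`, so it has no missing pair inside `N`; and
    -- it is joined to a whole group or to none of it. This rules out every obstruction through the
    -- new vertex and almost every one that meets both `N` and its complement. One inside `N`, or
    -- wholly outside, would already obstruct `H`: outside, its edges keep it within one group,
    -- where `H` is unchanged.
    free⁺ : Free H⁺
    free⁺ a zero zero d (_ , () , _)
    free⁺ zero zero (suc c) d (() , _)
    free⁺ (suc a) zero (suc c) zero (_ , _ , _ , _ , _ , _ , b≢b) = b≢b refl
    free⁺ (suc a) zero (suc c) (suc d) (na , nc , cd , ac , nd , a≢c , _) =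
      true≢false (dom⇒h nc (full-dom {c} {d} (out-dom {c} {d} nc nd cd)) na (λ e → a≢c (cong suc (sym e))))
                 (trans (link-sym (N c) (N a) c a) ac)
    free⁺ zero (suc b) zero d (_ , _ , _ , _ , _ , a≢a , _) = a≢a refl
    free⁺ (suc a) (suc b) zero zero (_ , _ , () , _)
    free⁺ (suc a) (suc b) zero (suc d) (ab , nb , nd , na , bd , _ , b≢d) =
      true≢false (dom⇒h nb (full-dom {b} {a} (out-dom {b} {a} nb na (trans (link-sym (N b) (N a) b a) ab))) nd (λ e → b≢d (cong suc e))) bd
    free⁺ zero (suc b) (suc c) zero (nb , bc , nc , nc' , _) = true≢false nc nc'
    free⁺ zero (suc b) (suc c) (suc d) (nb , bc , cd , nc , bd , _ , b≢d) =
      bool-case (N d)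
        (λ nd → true≢false (dom⇒h nb (full-dom {b} {c} fbc) nd (λ e → b≢d (cong suc e))) bd)
        (λ nd → true≢false (full-group {b} {c} {d} fbc (inner nc nd cd)) (out nb nd bd))
      where
      fbc = out-dom {b} {c} nb nc bc
      inner : ∀ {i j} → N i ≡ false → N j ≡ false → h i j ≡ true → group i j ≡ true
      inner {i} {j} ni nj e rewrite ni | nj = ∧-conicalʳ (adj H i j) _ e
      out : ∀ {x y z} → N x ≡ true → N y ≡ false → h x y ≡ z → full x y ≡ z
      out nx ny e rewrite nx | ny = e
    free⁺ (suc a) (suc b) (suc c) zero (ab , bc , nc , ac , nb , a≢c , _) =
      bool-case (N a)
        (λ na → true≢false (dom⇒h nc (full-dom {c} {b} fcb) na (λ e → a≢c (cong suc (sym e)))) (trans (link-sym (N c) (N a) c a) ac))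
        (λ na → true≢false (full-group {c} {b} {a} fcb (inner nb na (trans (link-sym (N b) (N a) b a) ab)))
                           (out nc na (trans (link-sym (N c) (N a) c a) ac)))
      where
      fcb = out-dom {c} {b} nc nb (trans (link-sym (N c) (N b) c b) bc)
      inner : ∀ {i j} → N i ≡ false → N j ≡ false → h i j ≡ true → group i j ≡ true
      inner {i} {j} ni nj e rewrite ni | nj = ∧-conicalʳ (adj H i j) _ e
      out : ∀ {x y z} → N x ≡ true → N y ≡ false → h x y ≡ z → full x y ≡ z
      out nx ny e rewrite nx | ny = e
    free⁺ (suc a) (suc b) (suc c) (suc d) (ab , bc , cd , ac , bd , a≢c' , b≢d') =
      go (N a) (N b) (N c) (N d) refl refl refl refl ab bc cd ac bd
      where
      a≢c = suc≢ a≢c'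
      b≢d = suc≢ b≢d'
      go : ∀ x y z w → N a ≡ x → N b ≡ y → N c ≡ z → N d ≡ w →
           link x y a b ≡ true → link y z b c ≡ true → link z w c d ≡ true → link x z a c ≡ false → link y w b d ≡ false → ⊥
      go true true true true na nb nc nd ab bc cd ac bd = free a b c d (ab , bc , cd , ac , bd , a≢c , b≢d)
      go true true true false na nb nc nd ab bc cd ac bd =
        true≢false (dom-adj (full-dom {c} {d} cd) na (a≢c ∘ sym)) (trans (adj-sym H c a) ac)
      go false true true true na nb nc nd ab bc cd ac bd =
        true≢false (dom-adj (full-dom {b} {a} ab) nd b≢d) bd
      -- The one mixed pattern without an immediate contradiction: the ends lie outside and the
      -- middle inside `N`. As `ac` is missing, some `p` in the group of `a` is not `H`-adjacent to
      -- `c`; likewise some `q` in the group of `d` is not `H`-adjacent to `b`. Then `p`, `b`, `c`,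
      -- `q` obstruct `H`.
      go false true true false na nb nc nd ab bc cd ac bd
        with full-false {c} {a} (full-dom {c} {d} cd) ac | full-false {b} {d} (full-dom {b} {a} ab) bd
      ... | p , np , gp , cp | q , nq , gq , bq =
        free p b c q ( edge-sym H (full-adj {b} {a} ab np gp) , bc , full-adj {c} {d} cd nq gq
                     , nonEdge-sym H cp , bq , (λ { refl → true≢false nc np }) , (λ { refl → true≢false nb nq }))
      go x true false true na nb nc nd ab bc cd ac bd = true≢false (dom-adj (full-dom {b} {c} bc) nd b≢d) bd
      go x true false false na nb nc nd ab bc cd ac bd =
        true≢false (full-group {b} {c} {d} bc (∧-conicalʳ (adj H c d) _ cd)) bd
      go true false true w na nb nc nd ab bc cd ac bd =
        true≢false (dom-adj (full-dom {c} {b} bc) na (a≢c ∘ sym)) (trans (adj-sym H c a) ac)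
      go false false true w na nb nc nd ab bc cd ac bd =
        true≢false (full-group {c} {b} {a} bc (group-sym {a} {b} (∧-conicalʳ (adj H a b) _ ab))) ac
      go true false false w na nb nc nd ab bc cd ac bd =
        true≢false (full-group {a} {b} {c} ab (∧-conicalʳ (adj H b c) _ bc)) ac
      go false false false true na nb nc nd ab bc cd ac bd =
        true≢false (full-group {d} {c} {b} cd (group-sym {b} {c} (∧-conicalʳ (adj H b c) _ bc))) bd
      go false false false false na nb nc nd ab bc cd ac bd =
        free a b c d ( ∧-conicalˡ _ _ ab , ∧-conicalˡ _ _ bc , ∧-conicalˡ _ _ cd
                     , strip ac (group-trans {a} {b} {c} (∧-conicalʳ (adj H a b) _ ab) (∧-conicalʳ (adj H b c) _ bc))
                     , strip bd (group-trans {b} {c} {d} (∧-conicalʳ (adj H b c) _ bc) (∧-conicalʳ (adj H c d) _ cd))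
                     , a≢c , b≢d)
        where
        strip : ∀ {p q} → p ∧ q ≡ false → q ≡ true → p ≡ false
        strip {false} _ _ = refl
        strip {true} e f = ⊥-elim (true≢false f e)

    no-obs₁ : ∀ {a b c} → ¬ Obs G zero a b c
    no-obs₁ o = true≢false (Obs⇒bad₁ G o) ¬bad

    no-obs₂ : ∀ {a b c} → ¬ Obs G a zero b c
    no-obs₂ o = true≢false (Obs⇒bad₂ G o) ¬bad

    -- Let `v` be the vertex `zero`. If some `z` in `N` were not adjacent to `x`, then `z`, `v`,
    -- `x`, `y` would be an obstruction, missing `zx` and `vy`.
    out⇒dom : ∀ {x y} → N x ≡ true → N y ≡ false → adj G⁻ x y ≡ true → dom x ≡ true
    out⇒dom {x} {y} nx ny xy = ∀⇒allᵇ λ z → go z (N z) (eqᵇ x z) (adj G⁻ x z) refl refl refl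
      where
      go : ∀ z p q r → N z ≡ p → eqᵇ x z ≡ q → adj G⁻ x z ≡ r → not p ∨ (q ∨ adj H x z) ≡ true
      go z false _     _     _  _  _  = refl
      go z true  true  _     _  _  _  = refl
      go z true  false true  _  _  xz = sup x z xz
      go z true  false false nz ne xz = ⊥-elim (no-obs₂ {suc z} {suc x} {suc y}
        ( edge-sym G nz , nx , xy , nonEdge-sym G xz , ny , (λ { refl → true≢false (eqᵇ-refl x) ne }) , (λ ())))

    -- A vertex `u` of `N` adjacent to `y` but not to `z` would give the obstruction `v`, `u`, `y`,
    -- `z`, missing `vy` and `uz`, where `v` is `zero`.
    out⇒group : ∀ {y z} → N y ≡ false → N z ≡ false → adj G⁻ y z ≡ true → group y z ≡ true
    out⇒group {y} {z} ny nz yz = ∀⇒allᵇ λ u → go u (N u) (adj G⁻ u y) (adj G⁻ u z) refl refl refl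
      where
      go : ∀ u p q r → N u ≡ p → adj G⁻ u y ≡ q → adj G⁻ u z ≡ r → not p ∨ (q ≡? r) ≡ true
      go u false _     _     _  _  _ = refl
      go u true  true  true  _  _  _ = refl
      go u true  false false _  _  _ = refl
      go u true  true  false nu uy uz = ⊥-elim (no-obs₁ {suc u} {suc y} {suc z}
        (nu , uy , yz , ny , uz , (λ ()) , (λ { refl → true≢false nu nz })))
      go u true  false true  nu uy uz = ⊥-elim (no-obs₁ {suc u} {suc z} {suc y}
        (nu , uz , edge-sym G yz , nz , uy , (λ ()) , (λ { refl → true≢false nu ny })))

    -- This is where groups pay off: all members of the group of `y` have the `G`-neighbour `x`, so
    -- `H`, which contains `G` without the new vertex, joins `x` to all of them.
    cross : ∀ {x y} → N x ≡ true → N y ≡ false → adj G⁻ x y ≡ true → full x y ≡ true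
    cross {x} {y} nx ny xy = ∧-true (out⇒dom nx ny xy) (∀⇒allᵇ λ z → go z (N z) (group y z) refl refl)
      where
      go : ∀ z p q → N z ≡ p → group y z ≡ q → p ∨ (not q ∨ adj H x z) ≡ true
      go z true  _     _ _ = refl
      go z false false _ _ = refl
      go z false true  _ g = sup x z (trans (sym (group-adj {y} {z} {x} g nx)) xy)

    sup⁺ : Supergraph G H⁺
    sup⁺ zero zero e = ⊥-elim (true≢false e (irrefl G zero))
    sup⁺ zero (suc j) e = e
    sup⁺ (suc i) zero e = edge-sym G e
    sup⁺ (suc i) (suc j) e = go (N i) (N j) refl refl
      where
      go : ∀ p q → N i ≡ p → N j ≡ q → link p q i j ≡ true
      go true  true  ni nj = sup i j e
      go true  false ni nj = cross ni nj e
      go false true  ni nj = cross nj ni (edge-sym G e)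
      go false false ni nj = ∧-true (sup i j e) (out⇒group ni nj e)

    link⇒H : ∀ i j → h i j ≡ true → adj H i j ≡ true
    link⇒H i j = go (N i) (N j) refl refl
      where
      go : ∀ p q → N i ≡ p → N j ≡ q → link p q i j ≡ true → adj H i j ≡ true
      go true  true  _  _  e = e
      go true  false _  nj e = full-adj {i} {j} e nj (group-refl j)
      go false true  ni _  e = edge-sym H (full-adj {j} {i} e ni (group-refl i))
      go false false _  _  e = ∧-conicalˡ _ _ e

    x∧¬x : ∀ x → b2n (x ∧ not x) ≡ 0
    x∧¬x true  = refl
    x∧¬x false = refl

    cost⁺ : D G H⁺ ≤ D G⁻ H
    cost⁺ = ≤-trans (≤-reflexive (cong (_+ sum (λ i → sum (λ j → b2n (newᵇ G H⁺ (suc i) j)))) top)) (sum-mono row)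
      where
      top : sum (λ j → b2n (newᵇ G H⁺ zero j)) ≡ 0
      top = trans (sum-cong-≗ (λ j → x∧¬x (N j))) (sum-zero n)
      new-mono : ∀ p q g → (p ≡ true → q ≡ true) → b2n (p ∧ not g) ≤ b2n (q ∧ not g)
      new-mono false q g f = z≤n
      new-mono true  q g f rewrite f refl = ≤-refl
      row : ∀ i → sum (λ j → b2n (newᵇ G H⁺ (suc i) j)) ≤ sum (λ j → b2n (newᵇ G⁻ H i j))
      row i = ≤-trans (≤-reflexive (cong (_+ sum (λ j → b2n (newᵇ G H⁺ (suc i) (suc j))))
                (trans (cong (λ z → b2n (N i ∧ not z)) (adj-sym G (suc i) zero)) (x∧¬x (N i)))))
              (sum-mono (λ j → new-mono (h i j) (adj H i j) (adj G⁻ i j) (link⇒H i j)))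

  Sol-insert : badᵇ G zero ≡ false → ∀ {k} → Sol G⁻ k → Sol G k
  Sol-insert ¬bad (H , sup , c , free) =
    H⁺ ¬bad H sup free , sup⁺ ¬bad H sup free , ≤-trans (cost⁺ ¬bad H sup free) c , free⁺ ¬bad H sup free

-- The kernel: the vertices in obstructions

induced : ∀ {n} → Graph n → (l : List (Fin n)) → Graph (length l)
induced G l = record
  { adj = λ i j → adj G (lookup l i) (lookup l j)
  ; sym = λ i j → adj-sym G (lookup l i) (lookup l j)
  ; irrefl = λ i → irrefl G (lookup l i) }

lookup-injective : ∀ {A : Set} {l : List A} → Unique l → ∀ {i j} → lookup l i ≡ lookup l j → i ≡ j
lookup-injective (_ ∷ _) {zero}  {zero}  e = refl
lookup-injective (p ∷ _) {zero}  {suc j} e = contradiction e (All.lookup p (∈-lookup j))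
lookup-injective (p ∷ _) {suc i} {zero}  e = contradiction (sym e) (All.lookup p (∈-lookup i))
lookup-injective (_ ∷ u) {suc i} {suc j} e = cong suc (lookup-injective u e)

Quad-induced : ∀ {n} (G : Graph n) {l} → Unique l → ∀ {a c x y} →
               Quad (induced G l) a c x y → Quad G (lookup l a) (lookup l c) (lookup l x) (lookup l y)
Quad-induced G {l} u = lift
  where
  obs : ∀ {a b c d} → Obs (induced G l) a b c d → Obs G (lookup l a) (lookup l b) (lookup l c) (lookup l d)
  obs (ab , bc , cd , ac , bd , a≢c , b≢d) =
    ab , bc , cd , ac , bd , (λ q → a≢c (lookup-injective u q)) , (λ q → b≢d (lookup-injective u q))
  lift : ∀ {a c x y} → Quad (induced G l) a c x y → Quad G (lookup l a) (lookup l c) (lookup l x) (lookup l y)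
  lift (axcy o) = axcy (obs o)
  lift (cxay o) = cxay (obs o)
  lift (aycx o) = aycx (obs o)
  lift (cyax o) = cyax (obs o)

bad-induced : ∀ {n} (G : Graph n) {l} → Unique l → ∀ i → badᵇ (induced G l) i ≡ true → badᵇ G (lookup l i) ≡ true
bad-induced G {l} u i e =
  let c , e₁ = exᵇ⇒∃ {p = λ c → exᵇ (λ x → partᵇ (induced G l) i c x)} e
      x , e₂ = exᵇ⇒∃ {p = partᵇ (induced G l) i c} e₁
      y , e₃ = exᵇ⇒∃ {p = quadᵇ (induced G l) i c x} e₂
  in ∃⇒exᵇ _ (lookup l c) (∃⇒exᵇ _ (lookup l x) (∃⇒exᵇ _ (lookup l y)
       (Quad⇒quadᵇ G (Quad-induced G u (quadᵇ⇒Quad (induced G l) {i} {c} {x} {y} e₃)))))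

-- Each insertion needs a vertex in no obstruction of the graph reached so far. That graph is
-- induced in `G`, so by `bad-induced` it suffices that the vertex is in no obstruction of `G`.
Sol-insertList : ∀ {n} (G : Graph n) l K {k} → Unique (l ++ K) → (∀ {v} → v ∈ l → badᵇ G v ≡ false) →
                 Sol (induced G K) k → Sol (induced G (l ++ K)) k
Sol-insertList G []      K {k} u b s = s
Sol-insertList G (v ∷ l) K {k} u@(_ ∷ u') b s =
  Insert.Sol-insert (induced G (v ∷ l ++ K)) ok {k} (Sol-insertList G l K {k} u' (λ p → b (Any.there p)) s)
  where
  ok : badᵇ (induced G (v ∷ l ++ K)) zero ≡ false
  ok = bool-case (badᵇ (induced G (v ∷ l ++ K)) zero)
         (λ e → ⊥-elim (true≢false (bad-induced G u zero e) (b (Any.here refl)))) id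

keep : ∀ {n} → Graph n → List (Fin n)
keep G = filter (λ v → badᵇ G v Bool.≟ true) (allFin _)

kernel : ∀ {n} (G : Graph n) → Graph (length (keep G))
kernel G = induced G (keep G)

Sol⇒kernel : ∀ {n} (G : Graph n) {k} → Sol G k → Sol (kernel G) k
Sol⇒kernel G {k} = Sol-induced G (kernel G) (lookup (keep G))
  (lookup-injective (Unique.filter⁺ (λ v → badᵇ G v Bool.≟ true) (Unique.allFin⁺ _))) (λ _ _ → refl) {k}

-- Insertion puts each vertex in front, which solves `G` with its vertices in the order
-- `rest ++ keep G`. Pulling back along `pos` restores the original order.
kernel⇒Sol : ∀ {n} (G : Graph n) {k} → Sol (kernel G) k → Sol G k
kernel⇒Sol {n} G {k} s = Sol-induced (induced G (rest ++ keep G)) G pos pos-injective same {k}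
                       (Sol-insertList G rest (keep G) {k} unique (λ p → proj₂ (∈-filter⁻ f? {xs = allFin n} p)) s)
  where
  t? = λ v → badᵇ G v Bool.≟ true
  f? = λ v → badᵇ G v Bool.≟ false
  rest = filter f? (allFin n)
  unique : Unique (rest ++ keep G)
  unique = Unique.++⁺ (Unique.filter⁺ f? (Unique.allFin⁺ n)) (Unique.filter⁺ t? (Unique.allFin⁺ n))
    (λ { (p , q) → true≢false (proj₂ (∈-filter⁻ t? {xs = allFin n} q)) (proj₂ (∈-filter⁻ f? {xs = allFin n} p)) })
  mem : ∀ v → v ∈ rest ++ keep G
  mem v = bool-case (badᵇ G v) (λ e → ∈-++⁺ʳ rest (∈-filter⁺ t? (∈-allFin v) e)) (λ e → ∈-++⁺ˡ (∈-filter⁺ f? (∈-allFin v) e))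
  pos : Fin n → Fin (length (rest ++ keep G))
  pos v = Any.index (mem v)
  at : ∀ v → v ≡ lookup (rest ++ keep G) (pos v)
  at v = lookup-index (mem v)
  pos-injective : ∀ {a b} → pos a ≡ pos b → a ≡ b
  pos-injective {a} {b} e = trans (at a) (trans (cong (lookup (rest ++ keep G)) e) (sym (at b)))
  same : ∀ i j → adj G i j ≡ adj (induced G (rest ++ keep G)) (pos i) (pos j)
  same i j = cong₂ (adj G) (at i) (at j)

-- Structured commands and their Turing machines

record Tape : Set where
  constructor tp
  field
    before : List Sym
    cur    : Sym
    after  : List Sym
open Tape

mv : Move → Tape → Tape
mv L (tp []      h r)       = tp [] blank (h ∷ r)
mv L (tp (x ∷ l) h r)       = tp l x (h ∷ r)
mv R (tp l       h [])      = tp (h ∷ l) blank []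
mv R (tp l       h (x ∷ r)) = tp (h ∷ l) x r

write : Sym → Tape → Tape
write s (tp l _ r) = tp l s r

opp : Move → Move
opp L = R
opp R = L

-- A branching command decides on the scanned symbol, but the machine has to move
-- in every step, so the test makes a detour in the given direction.
data Cmd : Set where
  act : (Sym → Sym) → Move → Cmd
  _⨾_ : Cmd → Cmd → Cmd
  ite : Move → (Sym → Bool) → Cmd → Cmd → Cmd
  whl : Move → (Sym → Bool) → Cmd → Cmd

infixr 5 _⨾_

-- Not the identity on representations: at the end of the visited tape the detour leaves an explicit
-- blank behind.
probe : Move → Tape → Tape
probe d t = mv (opp d) (mv d t)

data Run : Cmd → Tape → ℕ → Tape → Set where
  run-act : ∀ {f d t} → Run (act f d) t 1 (mv d (write (f (cur t)) t))
  run-seq : ∀ {a b t u v m n} → Run a t m u → Run b u n v → Run (a ⨾ b) t (m + n) v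
  run-then : ∀ {d p a b t u n} → p (cur t) ≡ true → Run a (probe d t) n u → Run (ite d p a b) t (2 + n) u
  run-else : ∀ {d p a b t u n} → p (cur t) ≡ false → Run b (probe d t) n u → Run (ite d p a b) t (2 + n) u
  run-stop : ∀ {d p c t} → p (cur t) ≡ false → Run (whl d p c) t 2 (probe d t)
  run-loop : ∀ {d p c t u v m n} → p (cur t) ≡ true → Run c (probe d t) m u → Run (whl d p c) u n v →
             Run (whl d p c) t (2 + (m + n)) v

-- A test needs three points: one to read the symbol and move away, and one per outcome to come
-- back. The outcome has to be kept in the state during the detour.
Ctl : Cmd → Set
Ctl (act _ _)     = ⊤
Ctl (a ⨾ b)       = Ctl a ⊎ Ctl b
Ctl (ite _ _ a b) = Fin 3 ⊎ (Ctl a ⊎ Ctl b)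
Ctl (whl _ _ c)   = Fin 3 ⊎ Ctl c

size : Cmd → ℕ
size (act _ _)     = 1
size (a ⨾ b)       = size a + size b
size (ite _ _ a b) = 3 + (size a + size b)
size (whl _ _ c)   = 3 + size c

enc : ∀ c → Ctl c → Fin (size c)
enc (act _ _)     _ = zero
enc (a ⨾ b)       q = join _ _ (Sum.map (enc a) (enc b) q)
enc (ite _ _ a b) q = join 3 _ (Sum.map id (λ r → join _ _ (Sum.map (enc a) (enc b) r)) q)
enc (whl _ _ c)   q = join 3 _ (Sum.map id (enc c) q)

dec : ∀ c → Fin (size c) → Ctl c
dec (act _ _)     _ = tt
dec (a ⨾ b)       i = Sum.map (dec a) (dec b) (splitAt (size a) i)
dec (ite _ _ a b) i = Sum.map id (λ r → Sum.map (dec a) (dec b) (splitAt (size a) r)) (splitAt 3 i)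
dec (whl _ _ c)   i = Sum.map id (dec c) (splitAt 3 i)

dec-enc : ∀ c q → dec c (enc c q) ≡ q
dec-enc (act _ _) _ = refl
dec-enc (a ⨾ b) (inj₁ q) rewrite splitAt-join (size a) (size b) (inj₁ (enc a q)) = cong inj₁ (dec-enc a q)
dec-enc (a ⨾ b) (inj₂ q) rewrite splitAt-join (size a) (size b) (inj₂ (enc b q)) = cong inj₂ (dec-enc b q)
dec-enc (ite _ _ a b) (inj₁ i) = cong (Sum.map _ _) (splitAt-join 3 (size a + size b) (inj₁ i))
dec-enc (ite _ _ a b) (inj₂ (inj₁ q))
  rewrite splitAt-join 3 (size a + size b) (inj₂ (join (size a) (size b) (inj₁ (enc a q))))
        | splitAt-join (size a) (size b) (inj₁ (enc a q)) = cong (inj₂ ∘ inj₁) (dec-enc a q)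
dec-enc (ite _ _ a b) (inj₂ (inj₂ q))
  rewrite splitAt-join 3 (size a + size b) (inj₂ (join (size a) (size b) (inj₂ (enc b q))))
        | splitAt-join (size a) (size b) (inj₂ (enc b q)) = cong (inj₂ ∘ inj₂) (dec-enc b q)
dec-enc (whl _ _ c) (inj₁ i) = cong (Sum.map _ _) (splitAt-join 3 (size c) (inj₁ i))
dec-enc (whl _ _ c) (inj₂ q) rewrite splitAt-join 3 (size c) (inj₂ (enc c q)) = cong inj₂ (dec-enc c q)

entry : ∀ c → Ctl c
entry (act _ _)     = tt
entry (a ⨾ b)       = inj₁ (entry a)
entry (ite _ _ _ _) = inj₁ zero
entry (whl _ _ _)   = inj₁ zero

-- The transitions of c inside a machine with states K: ι embeds the control
-- points of c, and e is where control goes when c is finished.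
trans-of : ∀ c {K : Set} → (Ctl c → K) → K → Ctl c → Sym → K × Sym × Move
trans-of (act f d)     ι e _ s = e , f s , d
trans-of (a ⨾ b)       ι e (inj₁ q) s = trans-of a (ι ∘ inj₁) (ι (inj₂ (entry b))) q s
trans-of (a ⨾ b)       ι e (inj₂ q) s = trans-of b (ι ∘ inj₂) e q s
trans-of (ite d p a b) ι e (inj₁ zero) s = ι (inj₁ (if p s then suc zero else suc (suc zero))) , s , d
trans-of (ite d p a b) ι e (inj₁ (suc zero)) s = ι (inj₂ (inj₁ (entry a))) , s , opp d
trans-of (ite d p a b) ι e (inj₁ (suc (suc zero))) s = ι (inj₂ (inj₂ (entry b))) , s , opp d
trans-of (ite d p a b) ι e (inj₂ (inj₁ q)) s = trans-of a (ι ∘ inj₂ ∘ inj₁) e q s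
trans-of (ite d p a b) ι e (inj₂ (inj₂ q)) s = trans-of b (ι ∘ inj₂ ∘ inj₂) e q s
trans-of (whl d p c)   ι e (inj₁ zero) s = ι (inj₁ (if p s then suc zero else suc (suc zero))) , s , d
trans-of (whl d p c)   ι e (inj₁ (suc zero)) s = ι (inj₂ (entry c)) , s , opp d
trans-of (whl d p c)   ι e (inj₁ (suc (suc zero))) s = e , s , opp d
trans-of (whl d p c)   ι e (inj₂ q) s = trans-of c (ι ∘ inj₂) (ι (inj₁ zero)) q s

module _ (M : TM) where

  conf : Fin (Q M) → Tape → Config M
  conf q (tp l h r) = cfg q l h r

  data Steps : ℕ → Config M → Config M → Set where
    done : ∀ {c} → Steps 0 c c
    more : ∀ {n c c' c''} → step M c ≡ just c' → Steps n c' c'' → Steps (suc n) c c''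

  _⊙_ : ∀ {m n c c' c''} → Steps m c c' → Steps n c' c'' → Steps (m + n) c c''
  done     ⊙ t = t
  more e s ⊙ t = more e (s ⊙ t)

  step-conf : ∀ {q t q' s d} → δ M q (cur t) ≡ just (q' , s , d) → step M (conf q t) ≡ just (conf q' (mv d (write s t)))
  step-conf {q} {tp l h r} {d = L} e with δ M q h
  step-conf {q} {tp []      h r} {d = L} refl | just _ = refl
  step-conf {q} {tp (_ ∷ _) h r} {d = L} refl | just _ = refl
  step-conf {q} {tp l h r} {d = R} e with δ M q h
  step-conf {q} {tp l h []}      {d = R} refl | just _ = refl
  step-conf {q} {tp l h (_ ∷ _)} {d = R} refl | just _ = refl

  -- The embedding `ι` and the exit `e` are arbitrary, so that a part of a command runs inside the
  -- machine of the whole: the body of a loop, for instance, exits to the test of the loop.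
  simulate : ∀ {c t n u} → Run c t n u → (ι : Ctl c → Fin (Q M)) (e : Fin (Q M)) →
             (∀ q s → δ M (ι q) s ≡ just (trans-of c ι e q s)) → Steps n (conf (ι (entry c)) t) (conf e u)
  simulate {t = t} run-act ι e tr = more (step-conf {t = t} (tr tt (cur t))) done
  simulate (run-seq r r') ι e tr =
    simulate r (ι ∘ inj₁) _ (λ q → tr (inj₁ q)) ⊙ simulate r' (ι ∘ inj₂) e (λ q → tr (inj₂ q))
  simulate {ite d p a b} {t = t} (run-then pt r) ι e tr =
    more (step-conf {t = t} (trans (tr (inj₁ zero) (cur t)) (cong (λ z → just (ι (inj₁ (if z then suc zero else suc (suc zero))) , cur t , d)) pt)))
    (more (step-conf {t = mv d t} (tr (inj₁ (suc zero)) (cur (mv d t))))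
    (simulate r (ι ∘ inj₂ ∘ inj₁) e (λ q → tr (inj₂ (inj₁ q)))))
  simulate {ite d p a b} {t = t} (run-else pt r) ι e tr =
    more (step-conf {t = t} (trans (tr (inj₁ zero) (cur t)) (cong (λ z → just (ι (inj₁ (if z then suc zero else suc (suc zero))) , cur t , d)) pt)))
    (more (step-conf {t = mv d t} (tr (inj₁ (suc (suc zero))) (cur (mv d t))))
    (simulate r (ι ∘ inj₂ ∘ inj₂) e (λ q → tr (inj₂ (inj₂ q)))))
  simulate {whl d p c} {t = t} (run-stop pt) ι e tr =
    more (step-conf {t = t} (trans (tr (inj₁ zero) (cur t)) (cong (λ z → just (ι (inj₁ (if z then suc zero else suc (suc zero))) , cur t , d)) pt)))
    (more (step-conf {t = mv d t} (tr (inj₁ (suc (suc zero))) (cur (mv d t)))) done)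
  simulate {whl d p c} {t = t} (run-loop pt r r') ι e tr =
    more (step-conf {t = t} (trans (tr (inj₁ zero) (cur t)) (cong (λ z → just (ι (inj₁ (if z then suc zero else suc (suc zero))) , cur t , d)) pt)))
    (more (step-conf {t = mv d t} (tr (inj₁ (suc zero)) (cur (mv d t))))
    (simulate r (ι ∘ inj₂) (ι (inj₁ zero)) (λ q → tr (inj₂ q)) ⊙ simulate r' ι e tr))

  exec-Steps : ∀ {n T c c'} → Steps n c c' → n ≤ T → step M c' ≡ nothing → exec M T c ≡ just c'
  exec-Steps {T = zero} {c} done _ h with step M c
  exec-Steps {T = zero} {c} done _ refl | nothing = refl
  exec-Steps {T = suc T} {c} done _ h with step M c
  exec-Steps {T = suc T} {c} done _ refl | nothing = refl
  exec-Steps {T = suc T} {c} (more e s) (s≤s p) h with step M c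
  exec-Steps {T = suc T} {c} (more refl s) (s≤s p) h | just _ = exec-Steps s p h

-- State `zero` is the exit of the command and the only halting state.
machine : Cmd → TM
machine c = record
  { Q = suc (size c)
  ; start = suc (enc c (entry c))
  ; δ = λ { zero _ → nothing ; (suc i) s → just (trans-of c (suc ∘ enc c) zero (dec c i) s) } }

machine-runs : ∀ {c t n u T} → Run c t n u → n ≤ T →
               exec (machine c) T (conf (machine c) (start (machine c)) t) ≡ just (conf (machine c) zero u)
machine-runs {c} {u = u} r p = exec-Steps (machine c)
  (simulate (machine c) r (suc ∘ enc c) zero (λ q s → cong (λ z → just (trans-of c (suc ∘ enc c) zero z s)) (dec-enc c q)))
  p refl

-- Runs with time bounds

Within : Cmd → Tape → Tape → ℕ → Set
Within c t u b = ∃ λ n → n ≤ b × Run c t n u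

_then_ : ∀ {a b t u v x y} → Within a t u x → Within b u v y → Within (a ⨾ b) t v (x + y)
(m , p , r) then (n , q , r') = m + n , +-mono-≤ p q , run-seq r r'

infixr 5 _then_

retarget : ∀ {c t u u' b} → u ≡ u' → Within c t u b → Within c t u' b
retarget refl w = w

loosen : ∀ {c t u b b'} → b ≤ b' → Within c t u b → Within c t u b'
loosen q (n , p , r) = n , ≤-trans p q , r

-- An empty second list stands for unvisited blank tape, so a step to the right has the same form
-- inside the visited part and at its end.
at : List Sym → List Sym → Tape
at l []       = tp l blank []
at l (x ∷ xs) = tp l x xs

at-right : ∀ {f l x xs} → Within (act f R) (at l (x ∷ xs)) (at (f x ∷ l) xs) 1
at-right {xs = []}    = 1 , ≤-refl , run-act
at-right {xs = _ ∷ _} = 1 , ≤-refl , run-act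

at-left : ∀ {f y l x xs} → Within (act f L) (at (y ∷ l) (x ∷ xs)) (at l (y ∷ f x ∷ xs)) 1
at-left = 1 , ≤-refl , run-act

-- Once a cell is recorded on the left, a detour to the left leaves no trace. This is why most tests
-- on the array go `L`: a blank always precedes the array.
probe-at : ∀ y l xs → probe L (at (y ∷ l) xs) ≡ at (y ∷ l) xs
probe-at y l []       = refl
probe-at y l (x ∷ xs) = refl

go : Move → Cmd
go d = act id d

-- Runs `c` once more than `n` says. Register `x` has offset `suc x` in its column, behind the
-- memory cell, so `rep x` makes exactly the moves between the two.
rep : ℕ → Cmd → Cmd
rep zero    c = c
rep (suc n) c = c ⨾ rep n c

nb : Sym → Bool
nb = isNotBlank

is1 : Sym → Bool
is1 b1 = true
is1 _  = false

-- Each symbol costs three steps, two for the detour of the test and one for the move; the final 2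
-- is the failing test.
scan-right : ∀ {y l} xs ys → All (λ s → nb s ≡ true) xs → nb (cur (at [] ys)) ≡ false →
             Within (whl L nb (go R)) (at (y ∷ l) (xs ++ ys)) (at (xs ʳ++ (y ∷ l)) ys) (3 * length xs + 2)
scan-right {y} {l} [] ys _ e = 2 , ≤-refl , subst (Run _ _ _) (probe-at y l ys) (run-stop (trans (cong nb (same ys)) e))
  where
  same : ∀ ys → cur (at (y ∷ l) ys) ≡ cur (at [] ys)
  same []      = refl
  same (_ ∷ _) = refl
scan-right {y} {l} (x ∷ xs) ys (p ∷ ps) e with at-right {id} {y ∷ l} {x} {xs ++ ys} | scan-right {x} {y ∷ l} xs ys ps e
... | m , m≤ , r | n , n≤ , r' = 2 + (m + n) ,
  ≤-trans (s≤s (s≤s (+-mono-≤ m≤ n≤))) (≤-reflexive (cong (_+ 2) (sym (*-suc 3 (length xs))))) , run-loop p r r'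

-- The head starts on the last of the symbols passed over.
scan-left : ∀ rs l r q → All (λ s → nb s ≡ true) rs → ∀ x → nb x ≡ true →
            Within (whl R nb (go L)) (at (rs ++ blank ∷ l) (x ∷ r ∷ q)) (at l (blank ∷ (rs ʳ++ (x ∷ r ∷ q)))) (3 * suc (length rs) + 2)
scan-left [] l r q _ x e = 5 , ≤-refl , run-loop e run-act (run-stop refl)
scan-left (y ∷ rs) l r q (p ∷ ps) x e with scan-left rs l x (r ∷ q) ps y p
... | n , n≤ , r' = 2 + (1 + n) ,
  ≤-trans (s≤s (s≤s (s≤s n≤))) (≤-reflexive (cong (_+ 2) (sym (*-suc 3 (suc (length rs)))))) , run-loop e run-act r'

suc-∸ : ∀ {i n} → i < n → n ∸ i ≡ suc (n ∸ suc i)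
suc-∸ {zero}  {suc n} _       = refl
suc-∸ {suc i} {suc n} (s≤s p) = suc-∸ p

-- Together with `rg` this presents the array as a function on positions: moving the head changes an
-- index, and writing changes one value of the function.
lf : (ℕ → Sym) → List Sym → ℕ → List Sym
lf g l zero    = l
lf g l (suc i) = g i ∷ lf g l i

rg : (ℕ → Sym) → List Sym → ℕ → ℕ → List Sym
rg g z i zero    = z
rg g z i (suc c) = g i ∷ rg g z (suc i) c

lf-cong : ∀ {g g' l} i → (∀ j → j < i → g j ≡ g' j) → lf g l i ≡ lf g' l i
lf-cong zero    e = refl
lf-cong (suc i) e = cong₂ _∷_ (e i ≤-refl) (lf-cong i (λ j p → e j (m≤n⇒m≤1+n p)))

rg-cong : ∀ {g g' z} i c → (∀ j → i ≤ j → g j ≡ g' j) → rg g z i c ≡ rg g' z i c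
rg-cong i zero    e = refl
rg-cong i (suc c) e = cong₂ _∷_ (e i ≤-refl) (rg-cong (suc i) c (λ j p → e j (≤-trans (n≤1+n i) p)))

upd : ∀ {A : Set} → (ℕ → A) → ℕ → A → ℕ → A
upd f x v y = if y ≡ᵇ x then v else f y

≡ᵇ-refl : ∀ x → (x ≡ᵇ x) ≡ true
≡ᵇ-refl zero    = refl
≡ᵇ-refl (suc x) = ≡ᵇ-refl x

≡ᵇ-true : ∀ x y → (x ≡ᵇ y) ≡ true → x ≡ y
≡ᵇ-true zero    zero    _ = refl
≡ᵇ-true (suc x) (suc y) e = cong suc (≡ᵇ-true x y e)

≡ᵇ-false : ∀ x y → x ≢ y → (x ≡ᵇ y) ≡ false
≡ᵇ-false x y ne with x ≡ᵇ y in e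
... | false = refl
... | true  = contradiction (≡ᵇ-true x y e) ne

upd-same : ∀ {A : Set} (f : ℕ → A) x v → upd f x v x ≡ v
upd-same f x v rewrite ≡ᵇ-refl x = refl

upd-other : ∀ {A : Set} (f : ℕ → A) {x y} v → y ≢ x → upd f x v y ≡ f y
upd-other f {x} {y} v ne rewrite ≡ᵇ-false y x ne = refl

-- A register language with saturating registers

record State : Set where
  field
    regs : ℕ → ℕ
    mem  : ℕ → Sym
    out  : List Sym
open State

-- Registers saturate at a capacity B, so every loop makes at most B rounds and the
-- running time of a program is bounded by a polynomial in B read off its syntax.
data Stm : Set where
  nop     : Stm
  inc clr : ℕ → Stm
  put     : ℕ → Stm
  emit    : Sym → Stm
  _⨟_     : Stm → Stm → Stm
  ifm     : ℕ → Sym → Stm → Stm → Stm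
  ifl     : ℕ → ℕ → Stm → Stm → Stm
  loop    : ℕ → ℕ → Stm → Stm

infixr 5 _⨟_

eqSym : Sym → Sym → Bool
eqSym blank blank = true
eqSym b0    b0    = true
eqSym b1    b1    = true
eqSym sep   sep   = true
eqSym _     _     = false

iterate : ∀ {A : Set} → ℕ → (A → A) → A → A
iterate zero    f s = s
iterate (suc r) f s = iterate r f (f s)

setReg : ℕ → ℕ → State → State
setReg x v s = record s { regs = upd (regs s) x v }

bump : ℕ → ℕ → State → State
bump B x s = setReg x (suc (regs s x) ⊓ B) s

⟦_∣_⟧ : ℕ → Stm → State → State
⟦ B ∣ nop ⟧ s = s
⟦ B ∣ inc x ⟧ s = bump B x s
⟦ B ∣ clr x ⟧ s = setReg x 0 s
⟦ B ∣ put x ⟧ s = record s { mem = upd (mem s) (regs s x) b1 }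
⟦ B ∣ emit c ⟧ s = record s { out = out s ++ c ∷ [] }
⟦ B ∣ p ⨟ q ⟧ s = ⟦ B ∣ q ⟧ (⟦ B ∣ p ⟧ s)
⟦ B ∣ ifm x c p q ⟧ s = if eqSym (mem s (regs s x)) c then ⟦ B ∣ p ⟧ s else ⟦ B ∣ q ⟧ s
⟦ B ∣ ifl x y p q ⟧ s = if regs s x <ᵇ regs s y then ⟦ B ∣ p ⟧ s else ⟦ B ∣ q ⟧ s
⟦ B ∣ loop x y p ⟧ s = iterate (regs s y ∸ regs s x) (λ s → bump B x (⟦ B ∣ p ⟧ s)) s

-- A syntactic bound on the registers written. On a concrete program it computes, so that most frame
-- conditions hold by `refl`.
wr : Stm → ℕ → Bool
wr nop z = false
wr (inc x) z = z ≡ᵇ x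
wr (clr x) z = z ≡ᵇ x
wr (put x) z = false
wr (emit c) z = false
wr (p ⨟ q) z = wr p z ∨ wr q z
wr (ifm x c p q) z = wr p z ∨ wr q z
wr (ifl x y p q) z = wr p z ∨ wr q z
wr (loop x y p) z = (z ≡ᵇ x) ∨ wr p z

puts : Stm → Bool
puts (put x)       = true
puts (p ⨟ q)       = puts p ∨ puts q
puts (ifm x c p q) = puts p ∨ puts q
puts (ifl x y p q) = puts p ∨ puts q
puts (loop x y p)  = puts p
puts _             = false

prints : Stm → Bool
prints (emit x)      = true
prints (p ⨟ q)       = prints p ∨ prints q
prints (ifm x c p q) = prints p ∨ prints q
prints (ifl x y p q) = prints p ∨ prints q
prints (loop x y p)  = prints p
prints _             = false

-- The body of a loop may write neither the counter nor the limit: then the number of rounds, which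
-- `⟦_∣_⟧` fixes at entry, agrees with the compiled loop, which tests before every round. Only
-- nonblank symbols may be printed, since a blank ends the output.
ok : ℕ → Stm → Bool
ok m nop = true
ok m (inc x) = x <ᵇ m
ok m (clr x) = x <ᵇ m
ok m (put x) = x <ᵇ m
ok m (emit c) = nb c
ok m (p ⨟ q) = ok m p ∧ ok m q
ok m (ifm x c p q) = (x <ᵇ m) ∧ (ok m p ∧ ok m q)
ok m (ifl x y p q) = (x <ᵇ m) ∧ ((y <ᵇ m) ∧ (ok m p ∧ ok m q))
ok m (loop x y p) = (x <ᵇ m) ∧ ((y <ᵇ m) ∧ (not (x ≡ᵇ y) ∧ (not (wr p x) ∧ (not (wr p y) ∧ ok m p))))

module Frames (B : ℕ) where
  iterate-keeps : ∀ {A : Set} (g : State → A) (f : State → State) → (∀ s → g (f s) ≡ g s) → ∀ r s → g (iterate r f s) ≡ g s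
  iterate-keeps g f e zero    s = refl
  iterate-keeps g f e (suc r) s = trans (iterate-keeps g f e r (f s)) (e s)

  frame-mem : ∀ p s → puts p ≡ false → mem (⟦ B ∣ p ⟧ s) ≡ mem s
  frame-mem nop s e = refl
  frame-mem (inc x) s e = refl
  frame-mem (clr x) s e = refl
  frame-mem (emit c) s e = refl
  frame-mem (p ⨟ q) s e with ∨-false (puts p) e
  ... | e₁ , e₂ = trans (frame-mem q (⟦ B ∣ p ⟧ s) e₂) (frame-mem p s e₁)
  frame-mem (ifm x c p q) s e with ∨-false (puts p) e | eqSym (mem s (regs s x)) c
  ... | e₁ , _ | true  = frame-mem p s e₁
  ... | _ , e₂ | false = frame-mem q s e₂
  frame-mem (ifl x y p q) s e with ∨-false (puts p) e | regs s x <ᵇ regs s y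
  ... | e₁ , _ | true  = frame-mem p s e₁
  ... | _ , e₂ | false = frame-mem q s e₂
  frame-mem (loop x y p) s e = iterate-keeps mem (λ s → bump B x (⟦ B ∣ p ⟧ s)) (λ s → frame-mem p s e) (regs s y ∸ regs s x) s

  frame-out : ∀ p s → prints p ≡ false → out (⟦ B ∣ p ⟧ s) ≡ out s
  frame-out nop s e = refl
  frame-out (inc x) s e = refl
  frame-out (clr x) s e = refl
  frame-out (put x) s e = refl
  frame-out (p ⨟ q) s e with ∨-false (prints p) e
  ... | e₁ , e₂ = trans (frame-out q (⟦ B ∣ p ⟧ s) e₂) (frame-out p s e₁)
  frame-out (ifm x c p q) s e with ∨-false (prints p) e | eqSym (mem s (regs s x)) c
  ... | e₁ , _ | true  = frame-out p s e₁
  ... | _ , e₂ | false = frame-out q s e₂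
  frame-out (ifl x y p q) s e with ∨-false (prints p) e | regs s x <ᵇ regs s y
  ... | e₁ , _ | true  = frame-out p s e₁
  ... | _ , e₂ | false = frame-out q s e₂
  frame-out (loop x y p) s e = iterate-keeps out (λ s → bump B x (⟦ B ∣ p ⟧ s)) (λ s → frame-out p s e) (regs s y ∸ regs s x) s

  frame : ∀ p z s → wr p z ≡ false → regs (⟦ B ∣ p ⟧ s) z ≡ regs s z
  frame nop z s e = refl
  frame (inc x) z s e rewrite e = refl
  frame (clr x) z s e rewrite e = refl
  frame (put x) z s e = refl
  frame (emit c) z s e = refl
  frame (p ⨟ q) z s e with ∨-false (wr p z) e
  ... | e₁ , e₂ = trans (frame q z (⟦ B ∣ p ⟧ s) e₂) (frame p z s e₁)
  frame (ifm x c p q) z s e with ∨-false (wr p z) e | eqSym (mem s (regs s x)) c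
  ... | e₁ , _ | true  = frame p z s e₁
  ... | _ , e₂ | false = frame q z s e₂
  frame (ifl x y p q) z s e with ∨-false (wr p z) e | regs s x <ᵇ regs s y
  ... | e₁ , _ | true  = frame p z s e₁
  ... | _ , e₂ | false = frame q z s e₂
  frame (loop x y p) z s e with ∨-false (z ≡ᵇ x) e
  ... | e₁ , e₂ = iterate-keeps (λ s → regs s z) (λ s → bump B x (⟦ B ∣ p ⟧ s))
                    (λ s → trans (cong (λ b → if b then suc (regs (⟦ B ∣ p ⟧ s) x) ⊓ B else regs (⟦ B ∣ p ⟧ s) z) e₁) (frame p z s e₂))
                    (regs s y ∸ regs s x) s

-- Control of the compiled program: the tape is L₀, blank, the array, blank, the
-- output.  Column j of the array consists of w cells: memory cell j, then for
-- each register x a mark that is 1 iff j < x.  The marks in the last column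
-- are sep, so that no register exceeds B.
module Compile (k : ℕ) where

  w : ℕ
  w = suc (suc k)

  -- The first step left brings the head into the array even when the preceding move has left it on
  -- the blank behind the array.
  homeC : Cmd
  homeC = go L ⨾ whl R nb (go L) ⨾ go R

  -- The first mark of `x` that is not 1 stands in the column whose index is the value of `x`. One
  -- search therefore serves three purposes: that mark is the one to set in an increment, the memory
  -- cell of that column is the one which `x` addresses, and the mark of `y` in that column tells
  -- whether `x < y`.
  findC : ℕ → Cmd
  findC x = rep x (go R) ⨾ whl L is1 (rep (suc k) (go R))

  testC : ℕ → ℕ → Cmd
  testC x y = findC x ⨾ rep x (go L) ⨾ rep y (go R)

  -- Leaving `sep` alone is what makes registers saturate at `B`.
  set1 : Sym → Sym
  set1 b0 = b1
  set1 s  = s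

  incC : ℕ → Cmd
  incC x = findC x ⨾ act set1 R ⨾ homeC

  comp : Stm → Cmd
  comp nop           = go R ⨾ go L
  comp (inc x)       = incC x
  comp (clr x)       = rep x (go R) ⨾ whl L is1 (act (λ _ → b0) R ⨾ rep k (go R)) ⨾ go R ⨾ homeC
  comp (put x)       = findC x ⨾ rep x (go L) ⨾ act (λ _ → b1) R ⨾ homeC
  comp (emit c)      = whl L nb (go R) ⨾ go R ⨾ whl L nb (go R) ⨾ act (λ _ → c) L ⨾ whl R nb (go L) ⨾ homeC
  comp (p ⨟ q)       = comp p ⨾ comp q
  comp (ifm x c p q) = findC x ⨾ rep x (go L) ⨾ ite L (λ s → eqSym s c) ((go R ⨾ homeC) ⨾ comp p) ((go R ⨾ homeC) ⨾ comp q)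
  comp (ifl x y p q) = testC x y ⨾ ite L is1 ((go R ⨾ homeC) ⨾ comp p) ((go R ⨾ homeC) ⨾ comp q)
  comp (loop x y p)  = testC x y ⨾ whl L is1 ((go R ⨾ homeC) ⨾ comp p ⨾ incC x ⨾ testC x y) ⨾ go R ⨾ homeC

  module _ (B : ℕ) where
    len : ℕ
    len = suc B * w

    tHome tFind tTest tInc : ℕ
    tHome = 1 + ((3 * len + 2) + 1)
    tFind = w + (B * (2 + w) + 2)
    tTest = tFind + (w + w)
    tInc  = tFind + (1 + tHome)

    -- Printing walks across all earlier output, so the length of the output enters the running
    -- time; the parameter `O` of `time` bounds it.
    emits : Stm → ℕ
    emits nop           = 0
    emits (inc x)       = 0
    emits (clr x)       = 0
    emits (put x)       = 0
    emits (emit c)      = 1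
    emits (p ⨟ q)       = emits p + emits q
    emits (ifm x c p q) = emits p + emits q
    emits (ifl x y p q) = emits p + emits q
    emits (loop x y p)  = B * emits p

    module _ (O : ℕ) where
      time : Stm → ℕ
      time nop           = 2
      time (inc x)       = tInc
      time (clr x)       = w + ((B * (2 + w) + 2) + (1 + tHome))
      time (put x)       = tFind + (w + (1 + tHome))
      time (emit c)      = (3 * len + 2) + (1 + ((3 * O + 2) + (1 + ((3 * O + 2) + tHome))))
      time (p ⨟ q)       = time p + time q
      time (ifm x c p q) = tFind + (w + (2 + ((1 + tHome) + (time p + time q))))
      time (ifl x y p q) = tTest + (2 + ((1 + tHome) + (time p + time q)))
      time (loop x y p)  = tTest + ((B * (2 + ((1 + tHome) + (time p + (tInc + tTest)))) + 2) + (1 + tHome))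

whl-loop : ∀ {p c t u v a b} → p (cur t) ≡ true → probe L t ≡ t → Within c t u a → Within (whl L p c) u v b →
           Within (whl L p c) t v (2 + (a + b))
whl-loop {p} {c} {t} {u} e q (m , p≤ , r) (n , q≤ , r') =
  2 + (m + n) , s≤s (s≤s (+-mono-≤ p≤ q≤)) , run-loop e (subst (λ z → Run c z m u) (sym q) r) r'

whl-stop : ∀ {p c t} → p (cur t) ≡ false → probe L t ≡ t → Within (whl L p c) t t 2
whl-stop {p} {c} {t} e q = 2 , ≤-refl , subst (Run (whl L p c) t 2) q (run-stop e)

choose-then : ∀ {p a b t u x} → p (cur t) ≡ true → probe L t ≡ t → Within a t u x → Within (ite L p a b) t u (2 + x)
choose-then {p} {a} e q (n , n≤ , r) = 2 + n , s≤s (s≤s n≤) , run-then e (subst (λ z → Run a z n _) (sym q) r)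

choose-else : ∀ {p a b t u x} → p (cur t) ≡ false → probe L t ≡ t → Within b t u x → Within (ite L p a b) t u (2 + x)
choose-else {p} {a} {b} e q (n , n≤ , r) = 2 + n , s≤s (s≤s n≤) , run-else e (subst (λ z → Run b z n _) (sym q) r)

All-ʳ++ : ∀ {A : Set} {P : A → Set} {xs ys} → All P xs → All P ys → All P (xs ʳ++ ys)
All-ʳ++ []       qs = qs
All-ʳ++ (p ∷ ps) qs = All-ʳ++ ps (p ∷ qs)

restart : ∀ {c t t' u b} → t ≡ t' → Within c t u b → Within c t' u b
restart refl r = r

-- Correctness of the compilation

module Correct (k B : ℕ) (L₀ : List Sym) where

  open Compile k
  open Frames B

  N : ℕ
  N = len B

  pos : (ℕ → Sym) → List Sym → ℕ → Tape
  pos g o i = at (lf g (blank ∷ L₀) i) (rg g (blank ∷ o) i (N ∸ i))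

  probe-pos : ∀ g o i → probe L (pos g o i) ≡ pos g o i
  probe-pos g o zero    = probe-at _ _ (rg g (blank ∷ o) 0 N)
  probe-pos g o (suc i) = probe-at _ _ (rg g (blank ∷ o) (suc i) (N ∸ suc i))

  cur-pos : ∀ {g o i} → i < N → cur (pos g o i) ≡ g i
  cur-pos i<N rewrite suc-∸ i<N = refl

  write-right : ∀ {f g g' o i} → i < N → g' i ≡ f (g i) → (∀ j → j ≢ i → g' j ≡ g j) →
                Within (act f R) (pos g o i) (pos g' o (suc i)) 1
  write-right {f} {g} {g'} {o} {i} i<N e same rewrite suc-∸ i<N =
    retarget (cong₂ at (cong₂ _∷_ (sym e) (lf-cong i (λ j j<i → sym (same j (<⇒≢ j<i)))))
                       (rg-cong (suc i) (N ∸ suc i) (λ j i<j → sym (same j (λ q → <⇒≢ i<j (sym q))))))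
             at-right

  move-left : ∀ {g o i} → suc i ≤ N → Within (go L) (pos g o (suc i)) (pos g o i) 1
  move-left {g} {o} {i} i<N rewrite suc-∸ i<N with N ∸ suc i
  ... | zero  = at-left {id}
  ... | suc c = at-left {id}

  rights : ∀ {g o} n {i} → suc n + i ≤ N → Within (rep n (go R)) (pos g o i) (pos g o (suc n + i)) (suc n)
  rights zero    p = write-right p refl (λ _ _ → refl)
  rights {g} {o} (suc n) {i} p =
    write-right (≤-trans (m≤n+m (suc i) (suc n)) (≤-trans (≤-reflexive (+-suc (suc n) i)) p)) refl (λ _ _ → refl) then
    retarget (cong (pos g o) (+-suc (suc n) i)) (rights n (≤-trans (≤-reflexive (+-suc (suc n) i)) p))

  lefts : ∀ {g o} n {i} → suc n + i ≤ N → Within (rep n (go L)) (pos g o (suc n + i)) (pos g o i) (suc n)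
  lefts zero    p = move-left p
  lefts (suc n) p = move-left p then lefts n (≤-trans (n≤1+n _) p)

  rewind : ∀ {g z} → (∀ j → nb (g j) ≡ true) → ∀ i c →
           Within (whl R nb (go L)) (at (lf g (blank ∷ L₀) i) (g i ∷ rg g (blank ∷ z) (suc i) c))
                  (at L₀ (blank ∷ rg g (blank ∷ z) 0 (i + suc c))) (3 * suc i + 2)
  rewind {g} nbg zero zero    = 5 , ≤-refl , run-loop (nbg 0) run-act (run-stop refl)
  rewind {g} nbg zero (suc c) = 5 , ≤-refl , run-loop (nbg 0) run-act (run-stop refl)
  rewind {g} {z} nbg (suc i) c with rewind {g} {z} nbg i (suc c)
  ... | n , n≤ , r = 2 + (1 + n) ,
    ≤-trans (s≤s (s≤s (s≤s n≤))) (≤-reflexive (cong (_+ 2) (sym (*-suc 3 (suc i))))) ,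
    first c (subst (λ x → Run (whl R nb (go L)) (at (lf g (blank ∷ L₀) i) (g i ∷ rg g (blank ∷ z) (suc i) (suc c))) n (at L₀ (blank ∷ rg g (blank ∷ z) 0 x)))
                   (+-suc i (suc c)) r)
    where
    first : ∀ c {u} → Run (whl R nb (go L)) (at (lf g (blank ∷ L₀) i) (g i ∷ rg g (blank ∷ z) (suc i) (suc c))) n u →
            Run (whl R nb (go L)) (at (lf g (blank ∷ L₀) (suc i)) (g (suc i) ∷ rg g (blank ∷ z) (suc (suc i)) c)) (2 + (1 + n)) u
    first zero    r = run-loop (nbg (suc i)) run-act r
    first (suc c) r = run-loop (nbg (suc i)) run-act r

  back : ∀ {g o} → (∀ j → nb (g j) ≡ true) → ∀ {i} → i < N → Within homeC (pos g o (suc i)) (pos g o 0) (tHome B)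
  back {g} {o} nbg {i} i<N =
    move-left i<N then
    loosen (+-monoˡ-≤ 2 (*-monoʳ-≤ 3 i<N)) (restart (sym here) (rewind nbg i (N ∸ suc i))) then
    retarget (cong (λ c → at (blank ∷ L₀) (rg g (blank ∷ o) 0 c)) whole) (at-right {id})
    where
    here : pos g o i ≡ at (lf g (blank ∷ L₀) i) (g i ∷ rg g (blank ∷ o) (suc i) (N ∸ suc i))
    here rewrite suc-∸ i<N = refl
    whole : i + suc (N ∸ suc i) ≡ N
    whole = trans (+-suc i (N ∸ suc i)) (m+[n∸m]≡n i<N)

  in-array : ∀ {v o} → v ≤ B → o < w → o + v * w < N
  in-array {v} p q = ≤-trans (+-monoˡ-≤ (v * w) q) (*-monoˡ-≤ w (s≤s p))

  scan-marks : ∀ {g o x v} → suc x < w → v ≤ B → (∀ j → j < v → g (suc x + j * w) ≡ b1) → is1 (g (suc x + v * w)) ≡ false →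
               ∀ r j → r + j ≡ v →
               Within (whl L is1 (rep (suc k) (go R))) (pos g o (suc x + j * w)) (pos g o (suc x + v * w)) (r * (2 + w) + 2)
  scan-marks {g} {o} {x} x<w v≤B ones end zero j refl =
    whl-stop (trans (cong is1 (cur-pos (in-array v≤B x<w))) end) (probe-pos g o (suc x + j * w))
  scan-marks {g} {o} {x} {v} x<w v≤B ones end (suc r) j e =
    loosen (≤-reflexive (cong (2 +_) (sym (+-assoc w (r * (2 + w)) 2))))
      (whl-loop (cong is1 (trans (cur-pos (in-array (≤-trans (<⇒≤ j<v) v≤B) x<w)) (ones j j<v))) (probe-pos g o (suc x + j * w))
        (retarget (cong (pos g o) shift) (rights (suc k) (≤-trans (≤-reflexive shift) (<⇒≤ (in-array (≤-trans j<v v≤B) x<w)))))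
        (scan-marks x<w v≤B ones end r (suc j) (trans (+-suc r j) e)))
    where
    j<v : j < v
    j<v = ≤-trans (s≤s (m≤n+m j r)) (≤-reflexive e)
    shift : w + (suc x + j * w) ≡ suc x + suc j * w
    shift = trans (sym (+-assoc w (suc x) (j * w))) (trans (cong (_+ j * w) (+-comm w (suc x))) (+-assoc (suc x) w (j * w)))

  mark : ℕ → ℕ → Sym
  mark j c = if j <ᵇ c then b1 else (if j ≡ᵇ B then sep else b0)

  cellAt : State → ℕ → ℕ → Sym
  cellAt s j zero    = mem s j
  cellAt s j (suc x) = mark j (regs s x)

  cell : State → ℕ → Sym
  cell s p = cellAt s (p / w) (p % w)

  record Good (s : State) : Set where
    field
      memOk : ∀ j → nb (mem s j) ≡ true
      regOk : ∀ x → regs s x ≤ B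
      outOk : All (λ c → nb c ≡ true) (out s)
  open Good public

  column : ∀ j {o} → o < w → (o + j * w) / w ≡ j × (o + j * w) % w ≡ o
  column j {o} p =
    trans (+-distrib-/-∣ʳ o (n∣m*n j)) (cong₂ _+_ (m<n⇒m/n≡0 p) (m*n/n≡m j w)) ,
    trans ([m+kn]%n≡m%n o j w) (m<n⇒m%n≡m p)

  cell-at : ∀ s j {o} → o < w → cell s (o + j * w) ≡ cellAt s j o
  cell-at s j p = cong₂ (cellAt s) (proj₁ (column j p)) (proj₂ (column j p))

  -- Quotient and remainder by `w` determine a position, so changing one entry of one column changes
  -- a single position of the array.
  cells-agree : ∀ {f f' : ℕ → ℕ → Sym} {j₀ o₀} →
                (∀ j o → ¬ (j ≡ j₀ × o ≡ o₀) → f' j o ≡ f j o) →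
                ∀ p → p ≢ o₀ + j₀ * w → f' (p / w) (p % w) ≡ f (p / w) (p % w)
  cells-agree e p ne = e (p / w) (p % w) (λ { (refl , refl) → ne (m≡m%n+[m/n]*n p w) })

  mark-1 : ∀ {j c} → j < c → mark j c ≡ b1
  mark-1 p rewrite <⇒<ᵇ-true p = refl

  mark-not1 : ∀ {j c} → c ≤ j → is1 (mark j c) ≡ false
  mark-not1 {j} p rewrite ≤⇒<ᵇ-false p with j ≡ᵇ B
  ... | true  = refl
  ... | false = refl

  is1-mark : ∀ j c → is1 (mark j c) ≡ (j <ᵇ c)
  is1-mark j c with j <ᵇ c in e
  ... | true  = refl
  ... | false with j ≡ᵇ B
  ...   | true  = refl
  ...   | false = refl

  nb-mark : ∀ j c → nb (mark j c) ≡ true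
  nb-mark j c with j <ᵇ c
  ... | true  = refl
  ... | false with j ≡ᵇ B
  ...   | true  = refl
  ...   | false = refl

  nb-cell : ∀ {s} → Good s → ∀ p → nb (cell s p) ≡ true
  nb-cell {s} gs p with p % w
  ... | zero  = memOk gs (p / w)
  ... | suc x = nb-mark (p / w) (regs s x)

  home : State → Tape
  home s = pos (cell s) (out s) 0

  find : ∀ {s x} → Good s → suc x < w → Within (findC x) (home s) (pos (cell s) (out s) (suc x + regs s x * w)) (tFind B)
  find {s} {x} gs x<w =
    loosen (<⇒≤ x<w) (retarget (cong (pos _ _) refl) (rights x (<⇒≤ (in-array {0} z≤n x<w)))) then
    loosen (+-monoˡ-≤ 2 (*-monoˡ-≤ (2 + w) (regOk gs x)))
      (scan-marks x<w (regOk gs x)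
        (λ j p → trans (cell-at s j x<w) (mark-1 p)) (trans (cong is1 (cell-at s (regs s x) x<w)) (mark-not1 {regs s x} ≤-refl))
        (regs s x) 0 (+-identityʳ _))

  column-start : ∀ {s x} → Good s → suc x < w →
                 Within (rep x (go L)) (pos (cell s) (out s) (suc x + regs s x * w)) (pos (cell s) (out s) (regs s x * w)) w
  column-start {s} {x} gs x<w = loosen (<⇒≤ x<w) (lefts x (<⇒≤ (in-array (regOk gs x) x<w)))

  test : ∀ {s x y} → Good s → suc x < w → suc y < w →
         Within (testC x y) (home s) (pos (cell s) (out s) (suc y + regs s x * w)) (tTest B)
  test {s} {x} {y} gs x<w y<w =
    find gs x<w then column-start gs x<w then loosen (<⇒≤ y<w) (rights y (<⇒≤ (in-array (regOk gs x) y<w)))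

  test-value : ∀ {s x y} → Good s → suc y < w → is1 (cur (pos (cell s) (out s) (suc y + regs s x * w))) ≡ (regs s x <ᵇ regs s y)
  test-value {s} {x} {y} gs y<w = trans (cong is1 (trans (cur-pos (in-array (regOk gs x) y<w)) (cell-at s (regs s x) y<w)))
                                        (is1-mark (regs s x) (regs s y))

  step-home : ∀ {s i} → Good s → i < N → Within (go R ⨾ homeC) (pos (cell s) (out s) i) (home s) (1 + tHome B)
  step-home gs i<N = write-right i<N refl (λ _ _ → refl) then back (nb-cell gs) i<N

  Good-setReg : ∀ {s} x {v} → Good s → v ≤ B → Good (setReg x v s)
  Good-setReg {s} x {v} gs v≤B = record { memOk = memOk gs ; outOk = outOk gs ; regOk = bounded }
    where
    bounded : ∀ y → upd (regs s) x v y ≤ B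
    bounded y with y ≡ᵇ x
    ... | true  = v≤B
    ... | false = regOk gs y

  inc-correct : ∀ {s x} → Good s → suc x < w → Within (incC x) (home s) (home (bump B x s)) (tInc B)
  inc-correct {s} {x} gs x<w =
    find gs x<w then
    write-right (in-array (regOk gs x) x<w)
      (trans (cell-at (bump B x s) v x<w) (trans there (cong set1 (sym (cell-at s v x<w)))))
      (cells-agree elsewhere) then
    back (nb-cell (Good-setReg x gs (m⊓n≤n _ B))) (in-array (regOk gs x) x<w)
    where
    v = regs s x
    there : mark v (regs (bump B x s) x) ≡ set1 (mark v v)
    there rewrite upd-same (regs s) x (suc v ⊓ B) | ≤⇒<ᵇ-false {v} ≤-refl with v ≡ᵇ B in e
    ... | true rewrite ≡ᵇ-true v B e | m≥n⇒m⊓n≡n (n≤1+n B) | ≤⇒<ᵇ-false {B} ≤-refl = refl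
    ... | false rewrite m≤n⇒m⊓n≡m (≤∧≢⇒< (regOk gs x) (λ q → true≢false (trans (cong (v ≡ᵇ_) (sym q)) (≡ᵇ-refl v)) e))
                      | <⇒<ᵇ-true (n<1+n v) = refl
    mark-other : ∀ j → j ≢ v → mark j (suc v ⊓ B) ≡ mark j v
    mark-other j ne with m≤n⇒m<n∨m≡n (regOk gs x)
    ... | inj₂ q rewrite q | m≥n⇒m⊓n≡n (n≤1+n B) = refl
    ... | inj₁ q rewrite m≤n⇒m⊓n≡m q with <-cmp j v
    ...   | tri< a _ _ rewrite <⇒<ᵇ-true a | <⇒<ᵇ-true (m≤n⇒m≤1+n a) = refl
    ...   | tri≈ _ b _ = contradiction b ne
    ...   | tri> _ _ c rewrite ≤⇒<ᵇ-false {j} c | ≤⇒<ᵇ-false {j} (<⇒≤ c) = refl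
    elsewhere : ∀ j o → ¬ (j ≡ v × o ≡ suc x) → cellAt (bump B x s) j o ≡ cellAt s j o
    elsewhere j zero    ne = refl
    elsewhere j (suc y) ne with y ≡ᵇ x in e
    ... | false = refl
    ... | true with ≡ᵇ-true y x e
    ...   | refl = mark-other j (λ q → ne (q , refl))

  clr-correct : ∀ {s x} → Good s → suc x < w → Within (comp (clr x)) (home s) (home (setReg x 0 s)) (time B 0 (clr x))
  clr-correct {s} {x} gs x<w =
    loosen (<⇒≤ x<w) (retarget start₀ (rights x (<⇒≤ (in-array {0} z≤n x<w)))) then
    loosen (+-monoˡ-≤ 2 (*-monoˡ-≤ (2 + w) (regOk gs x))) (erase v 0 (+-identityʳ v)) then
    write-right {g' = cell s'} (in-array (regOk gs x) x<w) (finish (suc x + v * w)) (λ j _ → finish j) then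
    back (nb-cell (Good-setReg x gs z≤n)) (in-array (regOk gs x) x<w)
    where
    s' = setReg x 0 s
    v = regs s x
    -- The invariant of the erasing loop: marks of `x` in columns below `n` are already `b0`, the
    -- others are old. At `n = 0` this is `s`. At `n = v` it is the cleared state, since the marks
    -- from column `v` on were not 1; the `sep` in column `B` survives because `v ≤ B`.
    part : ℕ → ℕ → ℕ → Sym
    part n j zero    = mem s j
    part n j (suc y) = if y ≡ᵇ x then (if j <ᵇ n then b0 else mark j v) else mark j (regs s y)
    erased : ℕ → ℕ → Sym
    erased n p = part n (p / w) (p % w)
    finish : ∀ p → cell s' p ≡ erased v p
    finish p with p % w
    ... | zero = refl
    ... | suc y with y ≡ᵇ x
    ...   | false = refl
    ...   | true with p / w <ᵇ v in e
    ...     | true rewrite ≡ᵇ-false (p / w) B (<⇒≢ (≤-trans (<ᵇ-true {p / w} e) (regOk gs x))) = refl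
    ...     | false = refl
    begin-erased : ∀ p → cell s p ≡ erased 0 p
    begin-erased p with p % w
    ... | zero = refl
    ... | suc y with y ≡ᵇ x in e
    ...   | false = refl
    ...   | true rewrite ≡ᵇ-true y x e = refl
    start₀ : pos (cell s) (out s) (suc x + 0) ≡ pos (erased 0) (out s) (suc x + 0)
    start₀ = cong₂ at (lf-cong (suc x + 0) (λ j _ → begin-erased j)) (rg-cong (suc x + 0) (N ∸ (suc x + 0)) (λ j _ → begin-erased j))
    at-mark : ∀ n j → n ≤ j → erased n (suc x + j * w) ≡ mark j v
    at-mark n j n≤j rewrite proj₁ (column j x<w) | proj₂ (column j x<w) | ≡ᵇ-refl x | ≤⇒<ᵇ-false {j} n≤j = refl
    erase : ∀ r j → r + j ≡ v → Within (whl L is1 (act (λ _ → b0) R ⨾ rep k (go R)))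
              (pos (erased j) (out s) (suc x + j * w)) (pos (erased v) (out s) (suc x + v * w)) (r * (2 + w) + 2)
    erase zero j refl = whl-stop (trans (cong is1 (trans (cur-pos (in-array (regOk gs x) x<w)) (at-mark j j ≤-refl))) (mark-not1 {j} ≤-refl))
                                 (probe-pos (erased j) (out s) (suc x + j * w))
    erase (suc r) j e =
      loosen (≤-reflexive (cong (2 +_) (sym (+-assoc w (r * (2 + w)) 2))))
        (whl-loop (cong is1 (trans (cur-pos (in-array j≤B x<w)) (trans (at-mark j j ≤-refl) (mark-1 j<v))))
                  (probe-pos (erased j) (out s) (suc x + j * w))
          (write-right (in-array j≤B x<w) here (cells-agree elsewhere) then
           retarget (cong (pos (erased (suc j)) (out s)) shift) (rights k (≤-trans (≤-reflexive shift) (<⇒≤ (in-array (≤-trans j<v (regOk gs x)) x<w)))))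
          (erase r (suc j) (trans (+-suc r j) e)))
      where
      j<v : j < v
      j<v = ≤-trans (s≤s (m≤n+m j r)) (≤-reflexive e)
      j≤B = ≤-trans (<⇒≤ j<v) (regOk gs x)
      shift : suc k + suc (suc x + j * w) ≡ suc x + suc j * w
      shift = trans (+-suc (suc k) (suc x + j * w))
                (trans (sym (+-assoc w (suc x) (j * w))) (trans (cong (_+ j * w) (+-comm w (suc x))) (+-assoc (suc x) w (j * w))))
      here : erased (suc j) (suc x + j * w) ≡ b0
      here rewrite proj₁ (column j x<w) | proj₂ (column j x<w) | ≡ᵇ-refl x | <⇒<ᵇ-true (n<1+n j) = refl
      elsewhere : ∀ i o → ¬ (i ≡ j × o ≡ suc x) → part (suc j) i o ≡ part j i o
      elsewhere i zero    ne = refl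
      elsewhere i (suc y) ne with y ≡ᵇ x in q
      ... | false = refl
      ... | true with <-cmp i j
      ...   | tri< a _ _ rewrite <⇒<ᵇ-true a | <⇒<ᵇ-true (m≤n⇒m≤1+n a) = refl
      ...   | tri≈ _ b _ = contradiction (b , cong suc (≡ᵇ-true y x q)) ne
      ...   | tri> _ _ c rewrite ≤⇒<ᵇ-false {i} c | ≤⇒<ᵇ-false {i} (<⇒≤ c) = refl

  Good-put : ∀ {s} x → Good s → Good (⟦ B ∣ put x ⟧ s)
  Good-put {s} x gs = record { regOk = regOk gs ; outOk = outOk gs ; memOk = ok' }
    where
    ok' : ∀ j → nb (upd (mem s) (regs s x) b1 j) ≡ true
    ok' j with j ≡ᵇ regs s x
    ... | true  = refl
    ... | false = memOk gs j

  put-correct : ∀ {s x} → Good s → suc x < w → Within (comp (put x)) (home s) (home (⟦ B ∣ put x ⟧ s)) (time B 0 (put x))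
  put-correct {s} {x} gs x<w =
    find gs x<w then column-start gs x<w then
    write-right v<N (trans (cell-at (⟦ B ∣ put x ⟧ s) (regs s x) {0} (s≤s z≤n)) (upd-same (mem s) (regs s x) b1)) (cells-agree elsewhere) then
    back (nb-cell (Good-put x gs)) v<N
    where
    v<N : regs s x * w < N
    v<N = in-array {regs s x} {0} (regOk gs x) (s≤s z≤n)
    elsewhere : ∀ j o → ¬ (j ≡ regs s x × o ≡ 0) → cellAt (⟦ B ∣ put x ⟧ s) j o ≡ cellAt s j o
    elsewhere j zero    ne = upd-other (mem s) b1 (λ q → ne (q , refl))
    elsewhere j (suc y) ne = refl

  scan-array : ∀ {g z} → (∀ j → nb (g j) ≡ true) → ∀ c i →
               Within (whl L nb (go R)) (at (lf g (blank ∷ L₀) i) (rg g (blank ∷ z) i c)) (at (lf g (blank ∷ L₀) (i + c)) (blank ∷ z)) (3 * c + 2)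
  scan-array {g} {z} nbg zero    i = retarget (cong (λ c → at (lf g (blank ∷ L₀) c) (blank ∷ z)) (sym (+-identityʳ i))) (whl-stop refl (stay i))
    where
    stay : ∀ i → mv R (mv L (at (lf g (blank ∷ L₀) i) (blank ∷ z))) ≡ at (lf g (blank ∷ L₀) i) (blank ∷ z)
    stay zero    = refl
    stay (suc i) = refl
  scan-array {g} {z} nbg (suc c) i =
    loosen (≤-reflexive (cong (_+ 2) (sym (*-suc 3 c))))
      (whl-loop (nbg i) (stay i) at-right
        (retarget (cong (λ c → at (lf g (blank ∷ L₀) c) (blank ∷ z)) (sym (+-suc i c))) (scan-array nbg c (suc i))))
    where
    stay : ∀ i → mv R (mv L (at (lf g (blank ∷ L₀) i) (rg g (blank ∷ z) i (suc c)))) ≡ at (lf g (blank ∷ L₀) i) (rg g (blank ∷ z) i (suc c))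
    stay zero    = refl
    stay (suc i) = refl

  emit-correct : ∀ {s c O} → Good s → nb c ≡ true → length (out s) ≤ O → Within (comp (emit c)) (home s) (home (⟦ B ∣ emit c ⟧ s)) (time B O (emit c))
  emit-correct {s} {c} {O} gs nc short =
    scan-array (nb-cell gs) N 0 then at-right then
    loosen (+-monoˡ-≤ 2 (*-monoʳ-≤ 3 short))
      (restart (cong (at _) (List.++-identityʳ (out s))) (scan-right (out s) [] (outOk gs) refl)) then
    restart (cong (λ l → at l []) (sym (List.ʳ++-defn (out s))))
      (turn (reverse (out s)) (All-ʳ++ (outOk gs) []) (≤-trans (≤-reflexive (List.length-reverse (out s))) short)
            (trans (List.ʳ++-defn (reverse (out s))) (cong (_++ c ∷ []) (List.reverse-involutive (out s)))))
    where
    l = lf (cell s) (blank ∷ L₀) N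
    at-end : pos (cell s) (out s ++ c ∷ []) N ≡ at l (blank ∷ out s ++ c ∷ [])
    at-end rewrite n∸n≡0 N = refl
    return : ∀ {q} → q ≡ out s ++ c ∷ [] → Within homeC (at l (blank ∷ q)) (home (⟦ B ∣ emit c ⟧ s)) (tHome B)
    return refl = restart at-end (retarget (cong (at (blank ∷ L₀)) (rg-cong 0 N (λ j _ → same j)))
                    -- The last cell of the array has the index `suc k + B * w`, the predecessor of
                    -- `N`.
                    (back {cell s} {out s ++ c ∷ []} (nb-cell {s} gs) {suc k + B * w} ≤-refl))
      where
      same : ∀ p → cell s p ≡ cell (⟦ B ∣ emit c ⟧ s) p
      same p with p % w
      ... | zero  = refl
      ... | suc _ = refl
    turn : ∀ rs → All (λ c → nb c ≡ true) rs → length rs ≤ O → rs ʳ++ (c ∷ []) ≡ out s ++ c ∷ [] →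
           Within (act (λ _ → c) L ⨾ whl R nb (go L) ⨾ homeC) (at (rs ++ blank ∷ l) []) (home (⟦ B ∣ emit c ⟧ s)) (1 + ((3 * O + 2) + tHome B))
    -- With nothing printed so far, the step to the left already reaches the blank behind the array,
    -- and the scan back is empty.
    turn []       _          _     e = (1 , ≤-refl , run-act) then loosen (m≤n+m 2 (3 * O)) (2 , ≤-refl , run-stop refl) then return e
    turn (x ∷ rs) (nx ∷ nbs) short e =
      (1 , ≤-refl , run-act) then loosen (+-monoˡ-≤ 2 (*-monoʳ-≤ 3 short)) (scan-left rs l c [] nbs x nx) then return e

  -- The induction has to carry `Good` and the output length along: registers of at most `B` keep
  -- the head inside the array, and the time of `emit` depends on what has been printed before.
  Correct : Stm → ℕ → State → Set
  Correct p O s = Within (comp p) (home s) (home (⟦ B ∣ p ⟧ s)) (time B O p) × Good (⟦ B ∣ p ⟧ s) ×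
                  length (out (⟦ B ∣ p ⟧ s)) ≤ length (out s) + emits B p

  correct : ∀ p {s O} → ok (suc k) p ≡ true → Good s → length (out s) + emits B p ≤ O → Correct p O s
  correct nop {s} e gs o =
    (rights 0 {0} 1≤ then lefts 0 {0} 1≤) , gs , m≤m+n _ _
    where
    1≤ : 1 ≤ N
    1≤ = s≤s z≤n
  correct (inc x) {s} e gs o =
    inc-correct gs (s≤s (<ᵇ-true e)) , Good-setReg x gs (m⊓n≤n _ B) , m≤m+n _ _
  correct (clr x) {s} e gs o = clr-correct gs (s≤s (<ᵇ-true e)) , Good-setReg x gs z≤n , m≤m+n _ _
  correct (put x) {s} e gs o = put-correct gs (s≤s (<ᵇ-true e)) , Good-put x gs , m≤m+n _ _
  correct (emit c) {s} e gs o = emit-correct gs e (≤-trans (m≤m+n _ 1) o) ,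
    record { memOk = memOk gs ; regOk = regOk gs ; outOk = AllP.++⁺ (outOk gs) (e ∷ []) } ,
    ≤-reflexive (List.length-++ (out s))
  correct (p ⨟ q) {s} e gs o with correct p {s} (∧-conicalˡ _ _ e) gs (≤-trans (+-monoʳ-≤ (length (out s)) (m≤m+n _ _)) o)
  ... | r₁ , g₁ , l₁ with correct q {⟦ B ∣ p ⟧ s} (∧-conicalʳ (ok (suc k) p) _ e) g₁
                          (≤-trans (+-monoˡ-≤ (emits B q) l₁) (≤-trans (≤-reflexive (+-assoc (length (out s)) _ _)) o))
  ... | r₂ , g₂ , l₂ = r₁ then r₂ , g₂ , ≤-trans l₂ (≤-trans (+-monoˡ-≤ (emits B q) l₁) (≤-reflexive (+-assoc (length (out s)) _ _)))
  correct (ifm x c p q) {s} {O} e gs o = branch (eqSym (mem s (regs s x)) c) refl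
    where
    x<w = s≤s (<ᵇ-true {x} (∧-conicalˡ _ _ e))
    e' = ∧-conicalʳ (x <ᵇ suc k) _ e
    v<N = in-array {regs s x} {0} (regOk gs x) (s≤s z≤n)
    reads : cur (pos (cell s) (out s) (regs s x * w)) ≡ mem s (regs s x)
    reads = trans (cur-pos v<N) (cell-at s (regs s x) {0} (s≤s z≤n))
    branch : ∀ b → eqSym (mem s (regs s x)) c ≡ b →
             Within (comp (ifm x c p q)) (home s) (home (if b then ⟦ B ∣ p ⟧ s else ⟦ B ∣ q ⟧ s)) (time B O (ifm x c p q)) ×
             Good (if b then ⟦ B ∣ p ⟧ s else ⟦ B ∣ q ⟧ s) ×
             length (out (if b then ⟦ B ∣ p ⟧ s else ⟦ B ∣ q ⟧ s)) ≤ length (out s) + (emits B p + emits B q)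
    branch true t with correct p {s} (∧-conicalˡ _ _ e') gs (≤-trans (+-monoʳ-≤ (length (out s)) (m≤m+n _ _)) o)
    ... | r , g , l = find gs x<w then column-start gs x<w then
        choose-then (trans (cong (λ z → eqSym z c) reads) t) (probe-pos (cell s) (out s) (regs s x * w))
          (step-home gs v<N then loosen (m≤m+n (time B O p) (time B O q)) r) ,
        g , ≤-trans l (+-monoʳ-≤ (length (out s)) (m≤m+n _ _))
    branch false t with correct q {s} (∧-conicalʳ (ok (suc k) p) _ e') gs (≤-trans (+-monoʳ-≤ (length (out s)) (m≤n+m _ (emits B p))) o)
    ... | r , g , l = find gs x<w then column-start gs x<w then
        choose-else (trans (cong (λ z → eqSym z c) reads) t) (probe-pos (cell s) (out s) (regs s x * w))
          (step-home gs v<N then loosen (m≤n+m (time B O q) (time B O p)) r) ,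
        g , ≤-trans l (+-monoʳ-≤ (length (out s)) (m≤n+m _ (emits B p)))
  correct (ifl x y p q) {s} {O} e gs o = branch (regs s x <ᵇ regs s y) refl
    where
    x<w = s≤s (<ᵇ-true {x} (∧-conicalˡ _ _ e))
    e₁ = ∧-conicalʳ (x <ᵇ suc k) _ e
    y<w = s≤s (<ᵇ-true {y} (∧-conicalˡ _ _ e₁))
    e' = ∧-conicalʳ (y <ᵇ suc k) _ e₁
    v<N = in-array (regOk gs x) y<w
    branch : ∀ b → (regs s x <ᵇ regs s y) ≡ b →
             Within (comp (ifl x y p q)) (home s) (home (if b then ⟦ B ∣ p ⟧ s else ⟦ B ∣ q ⟧ s)) (time B O (ifl x y p q)) ×
             Good (if b then ⟦ B ∣ p ⟧ s else ⟦ B ∣ q ⟧ s) ×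
             length (out (if b then ⟦ B ∣ p ⟧ s else ⟦ B ∣ q ⟧ s)) ≤ length (out s) + (emits B p + emits B q)
    branch true t with correct p {s} (∧-conicalˡ _ _ e') gs (≤-trans (+-monoʳ-≤ (length (out s)) (m≤m+n _ _)) o)
    ... | r , g , l = test gs x<w y<w then
        choose-then (trans (test-value {x = x} gs y<w) t) (probe-pos (cell s) (out s) (suc y + regs s x * w))
          (step-home gs v<N then loosen (m≤m+n (time B O p) (time B O q)) r) ,
        g , ≤-trans l (+-monoʳ-≤ (length (out s)) (m≤m+n _ _))
    branch false t with correct q {s} (∧-conicalʳ (ok (suc k) p) _ e') gs (≤-trans (+-monoʳ-≤ (length (out s)) (m≤n+m _ (emits B p))) o)
    ... | r , g , l = test gs x<w y<w then
        choose-else (trans (test-value {x = x} gs y<w) t) (probe-pos (cell s) (out s) (suc y + regs s x * w))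
          (step-home gs v<N then loosen (m≤n+m (time B O q) (time B O p)) r) ,
        g , ≤-trans l (+-monoʳ-≤ (length (out s)) (m≤n+m _ (emits B p)))
  correct (loop x y p) {s} {O} e gs o with rounds (regs s y ∸ regs s x) s refl gs
    (≤-trans (+-monoʳ-≤ (length (out s)) (*-monoˡ-≤ (emits B p) (≤-trans (m∸n≤m (regs s y) (regs s x)) (regOk gs y)))) o)
    where
    x<w : suc x < w
    x<w = s≤s (<ᵇ-true {x} (∧-conicalˡ _ _ e))
    e₁ = ∧-conicalʳ (x <ᵇ suc k) _ e
    y<w : suc y < w
    y<w = s≤s (<ᵇ-true {y} (∧-conicalˡ _ _ e₁))
    e₂ = ∧-conicalʳ (y <ᵇ suc k) _ e₁
    x≠y : (x ≡ᵇ y) ≡ false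
    x≠y = not-true (∧-conicalˡ _ _ e₂)
    e₃ = ∧-conicalʳ (not (x ≡ᵇ y)) _ e₂
    ¬wrx : wr p x ≡ false
    ¬wrx = not-true (∧-conicalˡ _ _ e₃)
    e₄ = ∧-conicalʳ (not (wr p x)) _ e₃
    ¬wry : wr p y ≡ false
    ¬wry = not-true (∧-conicalˡ _ _ e₄)
    okp : ok (suc k) p ≡ true
    okp = ∧-conicalʳ (not (wr p y)) _ e₄
    f : State → State
    f s = bump B x (⟦ B ∣ p ⟧ s)
    spot : State → Tape
    spot s = pos (cell s) (out s) (suc y + regs s x * w)
    -- At each test the head is on the mark of `y` in the column numbered by `x`, which is 1 exactly
    -- if `x < y`. While this holds, `x < y ≤ B`, so the increment of `x` is not cut off and the
    -- remaining number of rounds drops by one.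
    rounds : ∀ r s → regs s y ∸ regs s x ≡ r → Good s → length (out s) + r * emits B p ≤ O →
             Within (whl L is1 ((go R ⨾ homeC) ⨾ comp p ⨾ incC x ⨾ testC x y)) (spot s) (spot (iterate r f s))
                    (r * (2 + ((1 + tHome B) + (time B O p + (tInc B + tTest B)))) + 2) ×
             Good (iterate r f s) × length (out (iterate r f s)) ≤ length (out s) + r * emits B p
    rounds zero s d gs o =
      whl-stop (trans (test-value {x = x} gs y<w) (≤⇒<ᵇ-false {regs s x} (m∸n≡0⇒m≤n d))) (probe-pos (cell s) (out s) (suc y + regs s x * w)) ,
      gs , m≤m+n _ _
    rounds (suc r) s d gs o with correct p {s} okp gs (≤-trans (+-monoʳ-≤ (length (out s)) (m≤m+n (emits B p) _)) o)
    ... | r₁ , g₁ , l₁ with rounds r (f s) d' (Good-setReg x g₁ (m⊓n≤n _ B)) (≤-trans (+-monoˡ-≤ _ l₁) (≤-trans (≤-reflexive (+-assoc (length (out s)) _ _)) o))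
      where
      x<y : regs s x < regs s y
      x<y = m∸n≢0⇒n<m (λ q → 1+n≢0 (trans (sym d) q))
      same-y : regs (f s) y ≡ regs s y
      same-y = trans (upd-other (regs (⟦ B ∣ p ⟧ s)) _ (λ q → true≢false (trans (cong (x ≡ᵇ_) q) (≡ᵇ-refl x)) x≠y)) (frame p y s ¬wry)
      next-x : regs (f s) x ≡ suc (regs s x)
      next-x = trans (upd-same (regs (⟦ B ∣ p ⟧ s)) x _)
                 (trans (cong (λ z → suc z ⊓ B) (frame p x s ¬wrx)) (m≤n⇒m⊓n≡m (≤-trans x<y (regOk gs y))))
      d' : regs (f s) y ∸ regs (f s) x ≡ r
      d' = trans (cong₂ _∸_ same-y next-x) (suc-injective (trans (sym (suc-∸ x<y)) d))
    ... | r₂ , g₂ , l₂ =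
      loosen (≤-reflexive (cong (2 +_) (sym (+-assoc ((1 + tHome B) + (time B O p + (tInc B + tTest B))) _ 2))))
        (whl-loop (trans (test-value {x = x} gs y<w) (<⇒<ᵇ-true (m∸n≢0⇒n<m {regs s y} {regs s x} (λ q → 1+n≢0 (trans (sym d) q)))))
          (probe-pos (cell s) (out s) (suc y + regs s x * w))
          (step-home gs (in-array (regOk gs x) y<w) then r₁ then inc-correct g₁ x<w then test (Good-setReg x g₁ (m⊓n≤n _ B)) x<w y<w)
          r₂) ,
      g₂ , ≤-trans l₂ (≤-trans (+-monoˡ-≤ _ l₁) (≤-reflexive (+-assoc (length (out s)) _ _)))
  ... | r , g , l = (test gs (s≤s (<ᵇ-true {x} (∧-conicalˡ _ _ e))) (s≤s (<ᵇ-true {y} (∧-conicalˡ _ _ (∧-conicalʳ (x <ᵇ suc k) _ e)))) then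
      loosen (+-monoˡ-≤ 2 (*-monoˡ-≤ _ (≤-trans (m∸n≤m (regs s y) (regs s x)) (regOk gs y)))) r then
      step-home g (in-array (regOk g x) (s≤s (<ᵇ-true {y} (∧-conicalˡ _ _ (∧-conicalʳ (x <ᵇ suc k) _ e)))))) ,
      g , ≤-trans l (+-monoʳ-≤ (length (out s)) (*-monoˡ-≤ (emits B p) (≤-trans (m∸n≤m (regs s y) (regs s x)) (regOk gs y))))

-- Polynomial bounds

Poly : (ℕ → ℕ) → Set
Poly f = ∃ λ a → ∃ λ d → ∀ n → f n ≤ a * suc n ^ d

constᴾ : ∀ c → Poly (λ _ → c)
constᴾ c = c , 0 , λ n → ≤-reflexive (sym (*-identityʳ c))

idᴾ : Poly (λ n → n)
idᴾ = 1 , 1 , λ n → ≤-trans (n≤1+n n) (≤-reflexive (sym (trans (+-identityʳ (suc n ^ 1)) (*-identityʳ (suc n)))))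

_+ᴾ_ : ∀ {f g} → Poly f → Poly g → Poly (λ n → f n + g n)
_+ᴾ_ {f} {g} (a , d , p) (b , e , q) = a + b , d + e , λ n → begin
  f n + g n                                         ≤⟨ +-mono-≤ (p n) (q n) ⟩
  -- The base `suc n` is positive, so raising either exponent to `d + e` does not lower the bound.
  a * suc n ^ d + b * suc n ^ e                     ≤⟨ +-mono-≤ (*-monoʳ-≤ a (^-monoʳ-≤ (suc n) (m≤m+n d e))) (*-monoʳ-≤ b (^-monoʳ-≤ (suc n) (m≤n+m e d))) ⟩
  a * suc n ^ (d + e) + b * suc n ^ (d + e)         ≡⟨ sym (*-distribʳ-+ (suc n ^ (d + e)) a b) ⟩
  (a + b) * suc n ^ (d + e)                         ∎
  where open ≤-Reasoning

_*ᴾ_ : ∀ {f g} → Poly f → Poly g → Poly (λ n → f n * g n)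
_*ᴾ_ {f} {g} (a , d , p) (b , e , q) = a * b , d + e , λ n → begin
  f n * g n                                 ≤⟨ *-mono-≤ (p n) (q n) ⟩
  (a * suc n ^ d) * (b * suc n ^ e)         ≡⟨ [m*n]*[o*p]≡[m*o]*[n*p] a (suc n ^ d) b (suc n ^ e) ⟩
  (a * b) * (suc n ^ d * suc n ^ e)         ≡⟨ cong (a * b *_) (sym (^-distribˡ-+-* (suc n) d e)) ⟩
  (a * b) * suc n ^ (d + e)                 ∎
  where open ≤-Reasoning

infixl 6 _+ᴾ_
infixl 7 _*ᴾ_

-- Loading the input, running a program and delivering the output

nth : List Sym → ℕ → Sym
nth []      _       = sep
nth (x ∷ u) zero    = x
nth (x ∷ u) (suc j) = nth u j

-- The input is consumed from the left; each symbol becomes a column of the array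
-- to the right of the input.  Register 0 starts with the value B.
module Whole (k : ℕ) where
  open Compile (suc k)

  turnC : Cmd
  turnC = go L ⨾ whl R nb (go L)

  fill : Sym → Cmd
  fill s = act (λ _ → s) R

  -- The `b1` behind the symbol is the mark of register 0. Every input symbol contributes one, so
  -- that register starts at the input length without any counting.
  carryC : Sym → Cmd
  carryC s = fill blank ⨾ whl L nb (go R) ⨾ go R ⨾ whl L nb (go R) ⨾ fill s ⨾ fill b1 ⨾ rep k (fill b0) ⨾ turnC ⨾ turnC ⨾ go R

  passC : Cmd
  passC = ite L (λ s → eqSym s b0) (carryC b0) (ite L (λ s → eqSym s b1) (carryC b1) (carryC sep))

  -- The opening step to and fro records a blank left of the input; the one after the scan records
  -- two blanks behind it, between which the empty array lies. The last column, all `sep`, is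
  -- appended when the input is used up.
  initC : Cmd
  initC = go L ⨾ go R ⨾ whl L nb (go R) ⨾ go R ⨾ go L ⨾ turnC ⨾ go R ⨾ whl L nb passC ⨾
          go R ⨾ whl L nb (go R) ⨾ rep (suc (suc k)) (fill sep) ⨾ turnC ⨾ go R

  finC : Cmd
  finC = whl L nb (go R) ⨾ go R

  wholeC : Stm → Cmd
  wholeC p = initC ⨾ comp p ⨾ finC

  NB : List Sym → Set
  NB = All (λ s → nb s ≡ true)

  tTurn tCarry tInit : ℕ → ℕ
  tTurn n = 1 + (3 * n + 2)
  tCarry B = 1 + ((3 * B + 2) + (1 + ((3 * len B + 2) + (1 + (1 + (suc k + (tTurn (len B) + (tTurn B + 1))))))))
  tInit B = 1 + (1 + ((3 * B + 2) + (1 + (1 + (tTurn B + (1 + ((B * (2 + (2 + (2 + tCarry B))) + 2) +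
            (1 + ((3 * len B + 2) + (w + (tTurn (len B) + 1)))))))))))

  turn-back : ∀ {l r q n} xs → NB xs → length xs ≤ n →
              Within turnC (at (xs ʳ++ (blank ∷ l)) (r ∷ q)) (at l (blank ∷ (xs ++ r ∷ q))) (tTurn n)
  turn-back {l} {r} {q} {n} xs nbs short =
    restart (cong (λ z → at z (r ∷ q)) (sym (List.ʳ++-defn xs)))
      (turn (reverse xs) (All-ʳ++ nbs []) (≤-trans (≤-reflexive (List.length-reverse xs)) short)
        (trans (List.ʳ++-defn (reverse xs)) (cong (_++ r ∷ q) (List.reverse-involutive xs))))
    where
    turn : ∀ rs → NB rs → length rs ≤ n → ∀ {v} → rs ʳ++ (r ∷ q) ≡ v →
           Within turnC (at (rs ++ blank ∷ l) (r ∷ q)) (at l (blank ∷ v)) (tTurn n)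
    turn []       _          _     refl = (1 , ≤-refl , run-act) then loosen (m≤n+m 2 (3 * n)) (2 , ≤-refl , run-stop refl)
    turn (x ∷ rs) (nx ∷ nbs) short refl = (1 , ≤-refl , run-act) then loosen (+-monoˡ-≤ 2 (*-monoʳ-≤ 3 short)) (scan-left rs l r q nbs x nx)

  append : ∀ {s l} → Within (fill s) (at l []) (at (s ∷ l) []) 1
  append = 1 , ≤-refl , run-act

  append-many : ∀ {s} n {l} → Within (rep n (fill s)) (at l []) (at (replicate (suc n) s ʳ++ l) []) (suc n)
  append-many zero    = append
  append-many (suc n) = append then append-many n

  col : Sym → List Sym
  col s = s ∷ b1 ∷ replicate (suc k) b0

  NB-replicate : ∀ {s} n → nb s ≡ true → NB (replicate n s)
  NB-replicate zero    e = []
  NB-replicate (suc n) e = e ∷ NB-replicate n e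

  length-col : ∀ s → length (col s) ≡ w
  length-col s = cong (2 +_) (List.length-replicate (suc k))

  carry : ∀ {B s l} rest arr → nb s ≡ true → NB rest → NB arr → length rest ≤ B → length (arr ++ col s) ≤ len B →
          ∀ {x} → Within (carryC s) (at (blank ∷ l) (x ∷ rest ++ blank ∷ arr ++ blank ∷ []))
                     (at (blank ∷ blank ∷ l) (rest ++ blank ∷ (arr ++ col s) ++ blank ∷ [])) (tCarry B)
  carry {B} {s} {l} rest arr ns nbr nba lr la =
    at-right then
    loosen (+-monoˡ-≤ 2 (*-monoʳ-≤ 3 lr)) (scan-right rest (blank ∷ arr ++ blank ∷ []) nbr refl) then
    at-right then
    loosen (+-monoˡ-≤ 2 (*-monoʳ-≤ 3 (≤-trans (List.length-++-≤ˡ arr) la))) (scan-right arr (blank ∷ []) nba refl) then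
    append then append then append-many k then
    restart (cong (λ z → at z (blank ∷ [])) (List.++-ʳ++ arr {col s}))
      (turn-back (arr ++ col s) (AllP.++⁺ nba (ns ∷ refl ∷ NB-replicate (suc k) refl)) la) then
    turn-back rest nbr lr then at-right

  pass : ∀ {B s l} rest arr → nb s ≡ true → NB rest → NB arr → length rest ≤ B → length (arr ++ col s) ≤ len B →
         Within passC (at (blank ∷ l) (s ∷ rest ++ blank ∷ arr ++ blank ∷ []))
                     (at (blank ∷ blank ∷ l) (rest ++ blank ∷ (arr ++ col s) ++ blank ∷ [])) (2 + (2 + tCarry B))
  pass {s = b0}  rest arr ns nbr nba lr la = choose-then refl refl (loosen (m≤n+m _ 2) (carry rest arr ns nbr nba lr la))
  pass {s = b1}  rest arr ns nbr nba lr la = choose-else refl refl (choose-then refl refl (carry rest arr ns nbr nba lr la))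
  pass {s = sep} rest arr ns nbr nba lr la = choose-else refl refl (choose-else refl refl (carry rest arr ns nbr nba lr la))
  pass {s = blank} rest arr () nbr nba lr la

  body : List Sym → List Sym
  body = concatMap col

  length-body : ∀ u → length (body u) ≡ length u * w
  length-body []      = refl
  length-body (s ∷ u) = trans (List.length-++ (col s)) (cong₂ _+_ (length-col s) (length-body u))

  passes : ∀ {B l} u arr → NB u → NB arr → length u ≤ B → length (arr ++ body u) ≤ len B →
           ∃ λ l' → Within (whl L nb passC) (at (blank ∷ l) (u ++ blank ∷ arr ++ blank ∷ []))
                          (at (blank ∷ l') (blank ∷ (arr ++ body u) ++ blank ∷ [])) (length u * (2 + (2 + (2 + tCarry B))) + 2)
  passes {B} {l} [] arr _ nba _ _ = l , retarget (cong (λ z → at (blank ∷ l) (blank ∷ z ++ blank ∷ [])) (sym (List.++-identityʳ arr))) (whl-stop refl refl)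
  passes {B} {l} (s ∷ u) arr (ns ∷ nbu) nba lu la
    with passes {B} {blank ∷ l} u (arr ++ col s) nbu (AllP.++⁺ nba (ns ∷ refl ∷ NB-replicate (suc k) refl)) (≤-trans (n≤1+n _) lu)
           (≤-trans (≤-reflexive (cong length (List.++-assoc arr (col s) (body u)))) la)
  ... | l' , r = l' ,
    loosen (≤-reflexive (cong (2 +_) (sym (+-assoc (2 + (2 + tCarry B)) (length u * _) 2))))
      (whl-loop ns refl
        (pass u arr ns nbu nba (≤-trans (n≤1+n _) lu)
          (≤-trans (List.length-++-≤ˡ (arr ++ col s)) (≤-trans (≤-reflexive (cong length (List.++-assoc arr (col s) (body u)))) la)))
        (retarget (cong (λ z → at (blank ∷ l') (blank ∷ z ++ blank ∷ [])) (List.++-assoc arr (col s) (body u))) r))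

  NB-body : ∀ {u} → NB u → NB (body u)
  NB-body []        = []
  NB-body (ns ∷ nu) = AllP.++⁺ (ns ∷ refl ∷ NB-replicate (suc k) refl) (NB-body nu)

  start-state : List Sym → State
  start-state u = record { regs = λ x → if x ≡ᵇ 0 then length u else 0 ; mem = nth u ; out = [] }

  array : List Sym → List Sym
  array u = body u ++ replicate w sep

  length-array : ∀ u → length (array u) ≡ len (length u)
  length-array u = trans (List.length-++ (body u)) (trans (cong₂ _+_ (length-body u) (List.length-replicate w)) (+-comm (length u * w) w))

  init-run : ∀ u → u ≢ [] → NB u → ∃ λ l → Within initC (at [] u) (at (blank ∷ l) (array u ++ blank ∷ [])) (tInit (length u))
  init-run [] ne _ = contradiction refl ne
  init-run u@(_ ∷ _) _ nbu with passes {length u} {[]} u [] nbu [] ≤-refl (≤-trans (≤-reflexive (length-body u)) (m≤n+m _ w))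
  ... | l , r = blank ∷ l ,
    (1 , ≤-refl , run-act) then at-right {id} {[]} {blank} {u} then
    restart (cong (at (blank ∷ [])) (List.++-identityʳ u)) (scan-right u [] nbu refl) then
    (1 , ≤-refl , run-act) then (1 , ≤-refl , run-act) then
    turn-back u nbu ≤-refl then at-right then r then at-right then
    loosen (+-monoˡ-≤ 2 (*-monoʳ-≤ 3 (≤-trans (≤-reflexive (length-body u)) (m≤n+m _ w)))) (scan-right (body u) (blank ∷ []) (NB-body nbu) refl) then
    append-many (suc (suc k)) then
    restart (cong (λ z → at z (blank ∷ [])) (List.++-ʳ++ (body u) {replicate w sep}))
      (turn-back (array u) (AllP.++⁺ (NB-body nbu) (NB-replicate w refl)) (≤-reflexive (length-array u))) then
    at-right

  module _ (u : List Sym) (nbu : NB u) (L₀ : List Sym) where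
    open Correct (suc k) (length u) L₀

    s₀ : State
    s₀ = start-state u

    NB-nth : ∀ {u} → NB u → ∀ j → nb (nth u j) ≡ true
    NB-nth []       j       = refl
    NB-nth (p ∷ _)  zero    = p
    NB-nth (_ ∷ ps) (suc j) = NB-nth ps j

    good₀ : Good s₀
    good₀ = record { memOk = NB-nth nbu ; outOk = [] ; regOk = λ { zero → ≤-refl ; (suc _) → z≤n } }

    rg-replicate : ∀ {g z a} n i c → (∀ o → o < n → g (o + i) ≡ a) → rg g z i (n + c) ≡ replicate n a ++ rg g z (n + i) c
    rg-replicate zero    i c e = refl
    rg-replicate {g} {z} {a} (suc n) i c e =
      cong₂ _∷_ (e 0 (s≤s z≤n))
        (trans (rg-replicate n (suc i) c (λ o p → trans (cong g (+-suc o i)) (e (suc o) (s≤s p))))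
               (cong (λ x → replicate n a ++ rg g z x c) (+-suc n i)))

    mark-last : ∀ c → c ≤ length u → mark (length u) c ≡ sep
    mark-last c p rewrite ≤⇒<ᵇ-false {length u} p | ≡ᵇ-refl (length u) = refl

    mark-zero : ∀ {j} → j < length u → mark j 0 ≡ b0
    mark-zero {j} p rewrite ≡ᵇ-false j (length u) (<⇒≢ p) = refl

    array-from : ∀ v j → j + length v ≡ length u → (∀ i → nth u (j + i) ≡ nth v i) →
                 rg (cell s₀) (blank ∷ []) (j * w) (suc (length v) * w) ≡ array v ++ blank ∷ []
    -- The last column has the index `length u`, one past the input. The default value `sep` of
    -- `nth` makes its memory cell agree with the `sep` written by `initC`.
    array-from [] j e m rewrite trans (sym (+-identityʳ j)) e =
      cong₂ _∷_ (trans (cell-at s₀ (length u) {0} (s≤s z≤n)) (trans (cong (nth u) (sym (+-identityʳ _))) (m 0)))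
        (cong₂ _∷_ (trans (cell-at s₀ (length u) {1} (s≤s (s≤s z≤n))) (mark-last (length u) ≤-refl))
          (rg-replicate (suc k) (2 + length u * w) 0 (λ o p → trans (cong (cell s₀) (trans (+-suc o (1 + length u * w)) (cong suc (+-suc o (length u * w)))))
             (trans (cell-at s₀ (length u) {2 + o} (s≤s (s≤s p))) (mark-last 0 z≤n)))))
    array-from (a ∷ v) j e m =
      trans (cong₂ _∷_ (trans (cell-at s₀ j {0} (s≤s z≤n)) (trans (cong (nth u) (sym (+-identityʳ j))) (m 0)))
        (cong₂ _∷_ (trans (cell-at s₀ j {1} (s≤s (s≤s z≤n))) (mark-1 j<))
          (rg-replicate (suc k) (2 + j * w) (suc (length v) * w) (λ o p → trans (cong (cell s₀) (trans (+-suc o (1 + j * w)) (cong suc (+-suc o (j * w)))))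
             (trans (cell-at s₀ j {2 + o} (s≤s (s≤s p))) (mark-zero j<))))))
        (trans (cong (col a ++_) (trans (cong (λ i → rg (cell s₀) (blank ∷ []) i (suc (length v) * w))
                                         (cong suc (trans (+-suc k (1 + j * w)) (cong suc (+-suc k (j * w))))))
                                (array-from v (suc j) (trans (sym (+-suc j (length v))) e) (λ i → trans (cong (nth u) (sym (+-suc j i))) (m (suc i))))))
               (sym (trans (cong (_++ blank ∷ []) (List.++-assoc (col a) (body v) _)) (List.++-assoc (col a) (array v) _))))
      where
      j< : j < length u
      j< = ≤-trans (m<m+n j (s≤s z≤n)) (≤-reflexive e)

    started : at (blank ∷ L₀) (array u ++ blank ∷ []) ≡ home s₀
    started = cong (at (blank ∷ L₀)) (sym (array-from u 0 refl (λ _ → refl)))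

  tFin : ℕ → ℕ
  tFin B = (3 * len B + 2) + 1

  total : Stm → ℕ → ℕ
  total p B = tInit B + (time B (emits B p) p + tFin B)

  final-output : ∀ {M : TM} {q l} v → NB v → output {M} (conf M q (at l v)) ≡ v
  final-output []      _  = refl
  final-output (x ∷ v) ps = all-taken ps
    where
    all-taken : ∀ {v} → NB v → takeWhile (λ s → Bool.T? (isNotBlank s)) v ≡ v
    all-taken [] = refl
    all-taken {x ∷ v} (p ∷ ps) rewrite p = cong (x ∷_) (all-taken ps)

  whole-run : ∀ p u → ok (suc (suc k)) p ≡ true → u ≢ [] → NB u →
              ∃ λ l → Within (wholeC p) (at [] u) (at l (out (⟦ length u ∣ p ⟧ (start-state u)))) (total p (length u)) ×
                      NB (out (⟦ length u ∣ p ⟧ (start-state u)))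
  whole-run p u okp ne nbu with init-run u ne nbu
  ... | l , r with Correct.correct (suc k) (length u) l p okp (good₀ u nbu l) ≤-refl
  ... | r' , g , _ = _ , (retarget (started u nbu l) r then r' then
          Correct.scan-array (suc k) (length u) l (Correct.nb-cell (suc k) (length u) l g) (len (length u)) 0 then at-right) ,
        Correct.outOk g

  lenᴾ : Poly len
  lenᴾ = (constᴾ 1 +ᴾ idᴾ) *ᴾ constᴾ w

  tHomeᴾ : Poly tHome
  tHomeᴾ = constᴾ 1 +ᴾ ((constᴾ 3 *ᴾ lenᴾ +ᴾ constᴾ 2) +ᴾ constᴾ 1)

  tFindᴾ : Poly tFind
  tFindᴾ = constᴾ w +ᴾ (idᴾ *ᴾ constᴾ (2 + w) +ᴾ constᴾ 2)

  tTestᴾ : Poly tTest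
  tTestᴾ = tFindᴾ +ᴾ constᴾ (w + w)

  tIncᴾ : Poly tInc
  tIncᴾ = tFindᴾ +ᴾ (constᴾ 1 +ᴾ tHomeᴾ)

  emitsᴾ : ∀ p → Poly (λ B → emits B p)
  emitsᴾ nop           = constᴾ 0
  emitsᴾ (inc x)       = constᴾ 0
  emitsᴾ (clr x)       = constᴾ 0
  emitsᴾ (put x)       = constᴾ 0
  emitsᴾ (emit c)      = constᴾ 1
  emitsᴾ (p ⨟ q)       = emitsᴾ p +ᴾ emitsᴾ q
  emitsᴾ (ifm x c p q) = emitsᴾ p +ᴾ emitsᴾ q
  emitsᴾ (ifl x y p q) = emitsᴾ p +ᴾ emitsᴾ q
  emitsᴾ (loop x y p)  = idᴾ *ᴾ emitsᴾ p

  timeᴾ : ∀ {O} → Poly O → ∀ p → Poly (λ B → time B (O B) p)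
  timeᴾ o nop           = constᴾ 2
  timeᴾ o (inc x)       = tIncᴾ
  timeᴾ o (clr x)       = constᴾ w +ᴾ ((idᴾ *ᴾ constᴾ (2 + w) +ᴾ constᴾ 2) +ᴾ (constᴾ 1 +ᴾ tHomeᴾ))
  timeᴾ o (put x)       = tFindᴾ +ᴾ (constᴾ w +ᴾ (constᴾ 1 +ᴾ tHomeᴾ))
  timeᴾ o (emit c)      = (constᴾ 3 *ᴾ lenᴾ +ᴾ constᴾ 2) +ᴾ (constᴾ 1 +ᴾ ((constᴾ 3 *ᴾ o +ᴾ constᴾ 2) +ᴾ
                            (constᴾ 1 +ᴾ ((constᴾ 3 *ᴾ o +ᴾ constᴾ 2) +ᴾ tHomeᴾ))))
  timeᴾ o (p ⨟ q)       = timeᴾ o p +ᴾ timeᴾ o q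
  timeᴾ o (ifm x c p q) = tFindᴾ +ᴾ (constᴾ w +ᴾ (constᴾ 2 +ᴾ ((constᴾ 1 +ᴾ tHomeᴾ) +ᴾ (timeᴾ o p +ᴾ timeᴾ o q))))
  timeᴾ o (ifl x y p q) = tTestᴾ +ᴾ (constᴾ 2 +ᴾ ((constᴾ 1 +ᴾ tHomeᴾ) +ᴾ (timeᴾ o p +ᴾ timeᴾ o q)))
  timeᴾ o (loop x y p)  = tTestᴾ +ᴾ ((idᴾ *ᴾ (constᴾ 2 +ᴾ ((constᴾ 1 +ᴾ tHomeᴾ) +ᴾ (timeᴾ o p +ᴾ (tIncᴾ +ᴾ tTestᴾ)))) +ᴾ constᴾ 2) +ᴾ (constᴾ 1 +ᴾ tHomeᴾ))

  tTurnᴾ : ∀ {f} → Poly f → Poly (λ n → tTurn (f n))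
  tTurnᴾ p = constᴾ 1 +ᴾ (constᴾ 3 *ᴾ p +ᴾ constᴾ 2)

  tCarryᴾ : Poly tCarry
  tCarryᴾ = constᴾ 1 +ᴾ ((constᴾ 3 *ᴾ idᴾ +ᴾ constᴾ 2) +ᴾ (constᴾ 1 +ᴾ ((constᴾ 3 *ᴾ lenᴾ +ᴾ constᴾ 2) +ᴾ (constᴾ 1 +ᴾ (constᴾ 1 +ᴾ
              (constᴾ (suc k) +ᴾ (tTurnᴾ lenᴾ +ᴾ (tTurnᴾ idᴾ +ᴾ constᴾ 1))))))))

  passesᴾ : Poly (λ B → B * (2 + (2 + (2 + tCarry B))) + 2)
  passesᴾ = idᴾ *ᴾ (constᴾ 2 +ᴾ (constᴾ 2 +ᴾ (constᴾ 2 +ᴾ tCarryᴾ))) +ᴾ constᴾ 2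

  scanᴾ : ∀ {f} → Poly f → Poly (λ n → 3 * f n + 2)
  scanᴾ p = constᴾ 3 *ᴾ p +ᴾ constᴾ 2

  init-tailᴾ = scanᴾ lenᴾ +ᴾ (constᴾ w +ᴾ (tTurnᴾ lenᴾ +ᴾ constᴾ 1))
  init-midᴾ  = tTurnᴾ idᴾ +ᴾ (constᴾ 1 +ᴾ (passesᴾ +ᴾ (constᴾ 1 +ᴾ init-tailᴾ)))
  init-allᴾ  = constᴾ 1 +ᴾ (constᴾ 1 +ᴾ (scanᴾ idᴾ +ᴾ (constᴾ 1 +ᴾ (constᴾ 1 +ᴾ init-midᴾ))))

  tInitᴾ : Poly tInit
  tInitᴾ = init-allᴾ

  tFinᴾ : Poly tFin
  tFinᴾ = scanᴾ lenᴾ +ᴾ constᴾ 1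

  totalᴾ : ∀ p → Poly (total p)
  totalᴾ p = tInitᴾ +ᴾ (timeᴾ (emitsᴾ p) p +ᴾ tFinᴾ)

  halts : ∀ c {l u v n T} → Run c (at [] u) n (at l v) → n ≤ T → NB v →
          ∃ λ cf → exec (machine c) T (initConfig (machine c) u) ≡ just cf × output cf ≡ v
  halts c {l} {u} {v} {n} {T} r n≤T nbv =
    conf (machine c) zero (at l v) ,
    trans (cong (exec (machine c) T) (init (machine c) u)) (machine-runs r n≤T) ,
    final-output {machine c} {zero} {l} v nbv
    where
    init : ∀ M u → initConfig M u ≡ conf M (start M) (at [] u)
    init M []      = refl
    init M (x ∷ u) = refl

  compiled : ∀ p → ok (suc (suc k)) p ≡ true → ∃ λ a → ∃ λ d → ∀ u → u ≢ [] → NB u →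
             ∃ λ cf → exec (machine (wholeC p)) (a * suc (length u) ^ d) (initConfig (machine (wholeC p)) u) ≡ just cf ×
                      output cf ≡ out (⟦ length u ∣ p ⟧ (start-state u))
  compiled p okp = proj₁ (totalᴾ p) , proj₁ (proj₂ (totalᴾ p)) , λ u ne nbu →
    let (l , (n , n≤ , r) , nbo) = whole-run p u okp ne nbu
    in halts (wholeC p) r (≤-trans n≤ (proj₂ (proj₂ (totalᴾ p)) (length u))) nbo

-- Rules for loops and saturating sums

prefix : ∀ {n} → (Fin n → Bool) → ℕ → ℕ
prefix {zero}  p j       = 0
prefix {suc n} p zero    = 0
prefix {suc n} p (suc j) = b2n (p zero) + prefix (p ∘ suc) j

prefix-zero : ∀ {n} (p : Fin n → Bool) → prefix p 0 ≡ 0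
prefix-zero {zero}  p = refl
prefix-zero {suc n} p = refl

prefix-suc : ∀ {n} (p : Fin n → Bool) i → prefix p (suc (toℕ i)) ≡ prefix p (toℕ i) + b2n (p i)
prefix-suc {suc n} p zero    = trans (cong (b2n (p zero) +_) (prefix-zero (p ∘ suc))) (+-identityʳ _)
prefix-suc {suc n} p (suc i) = trans (cong (b2n (p zero) +_) (prefix-suc (p ∘ suc) i)) (sym (+-assoc (b2n (p zero)) _ _))

prefix-all : ∀ {n} (p : Fin n → Bool) → prefix p n ≡ cnt p
prefix-all {zero}  p = refl
prefix-all {suc n} p = cong (b2n (p zero) +_) (prefix-all (p ∘ suc))

prefix≤ : ∀ {n} (p : Fin n → Bool) j → prefix p j ≤ j
prefix≤ {zero}  p j       = z≤n
prefix≤ {suc n} p zero    = z≤n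
prefix≤ {suc n} p (suc j) = +-mono-≤ (b2n≤1 (p zero)) (prefix≤ (p ∘ suc) j)

addTo : ℕ → ℕ → ℕ → Stm
addTo t y u = clr u ⨟ loop u y (inc t)

module Rules (B : ℕ) where
  open Frames B public

  -- The offset `b` serves loops whose counter does not start at 0. With `b = f` and limit `κ` a
  -- loop makes `κ ∸ f` rounds, which replaces subtraction; halving uses `b = 1`.
  loop-from : ∀ b {x y n} p (I : ℕ → State → Set) → (∀ {j s} → I j s → regs s x ≡ b + j × regs s y ≡ b + n) →
              (∀ j s → j < n → I j s → I (suc j) (bump B x (⟦ B ∣ p ⟧ s))) →
              ∀ s → I 0 s → I n (⟦ B ∣ loop x y p ⟧ s)
  loop-from b {x} {y} {n} p I known step s i₀ =
    subst (λ r → I n (iterate r (λ s → bump B x (⟦ B ∣ p ⟧ s)) s))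
          (sym (trans (cong₂ _∸_ (proj₂ (known i₀)) (proj₁ (known i₀))) ([m+n]∸[m+o]≡n∸o b n 0))) (rounds n 0 s refl i₀)
    where
    rounds : ∀ r j s → j + r ≡ n → I j s → I n (iterate r (λ s → bump B x (⟦ B ∣ p ⟧ s)) s)
    rounds zero j s e i = subst (λ z → I z s) (trans (sym (+-identityʳ j)) e) i
    rounds (suc r) j s e i = rounds r (suc j) _ (trans (sym (+-suc j r)) e)
      (step j s (≤-trans (m<m+n j (s≤s z≤n)) (≤-reflexive e)) i)

  loop-rule : ∀ {x y n} p (I : ℕ → State → Set) → (∀ {j s} → I j s → regs s x ≡ j × regs s y ≡ n) →
              (∀ (i : Fin n) s → I (toℕ i) s → I (suc (toℕ i)) (bump B x (⟦ B ∣ p ⟧ s))) →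
              ∀ s → I 0 s → I n (⟦ B ∣ loop x y p ⟧ s)
  loop-rule {x} {y} {n} p I known step = loop-from 0 p I known (λ j s j<n i →
    subst (λ z → I (suc z) (bump B x (⟦ B ∣ p ⟧ s))) (Fin.toℕ-fromℕ< j<n)
          (step (fromℕ< j<n) s (subst (λ z → I z s) (sym (Fin.toℕ-fromℕ< j<n)) i)))

  bump-value : ∀ x s {v} → regs s x ≡ v → regs (bump B x s) x ≡ suc v ⊓ B
  bump-value x s refl = upd-same (regs s) x _

  bump-suc : ∀ x s {v} → regs s x ≡ v → suc v ≤ B → regs (bump B x s) x ≡ suc v
  bump-suc x s e p = trans (bump-value x s e) (m≤n⇒m⊓n≡m p)

  bump-other : ∀ {x z} s → z ≢ x → regs (bump B x s) z ≡ regs s z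
  bump-other s ne = upd-other (regs s) _ ne

  wr-addTo : ∀ {t y u z} → z ≢ t → z ≢ u → wr (addTo t y u) z ≡ false
  wr-addTo {t} {y} {u} {z} z≢t z≢u rewrite ≡ᵇ-false z u z≢u | ≡ᵇ-false z t z≢t = refl

  capped-suc : ∀ a → suc (a ⊓ B) ⊓ B ≡ suc a ⊓ B
  capped-suc a with ≤-total a B
  ... | inj₁ p = cong (λ z → suc z ⊓ B) (m≤n⇒m⊓n≡m p)
  ... | inj₂ p = trans (cong (λ z → suc z ⊓ B) (m≥n⇒m⊓n≡n p)) (trans (m≥n⇒m⊓n≡n (n≤1+n B)) (sym (m≥n⇒m⊓n≡n (m≤n⇒m≤1+n p))))

  -- Here `a` is the uncapped value that register `t` stands for. Capping commutes with adding, so a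
  -- sequence of saturating additions ends at the capped exact sum.
  addTo-value : ∀ {t y u} s → t ≢ y → t ≢ u → y ≢ u → ∀ {a b} → regs s t ≡ a ⊓ B → regs s y ≡ b → b ≤ B →
                regs (⟦ B ∣ addTo t y u ⟧ s) t ≡ (a + b) ⊓ B
  addTo-value {t} {y} {u} s t≢y t≢u y≢u {a} {b} et refl b≤B = proj₂ (proj₂ final)
    where
    I : ℕ → State → Set
    I j s' = regs s' u ≡ j × regs s' y ≡ b × regs s' t ≡ (a + j) ⊓ B
    final : I b (⟦ B ∣ addTo t y u ⟧ s)
    final = loop-rule (inc t) I (λ { (p , q , _) → p , q })
      (λ { i s' (p , q , r) → bump-suc u (bump B t s') (trans (bump-other s' (λ e → t≢u (sym e))) p) (≤-trans (toℕ<n i) b≤B)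
                            , trans (bump-other (bump B t s') y≢u) (trans (bump-other s' (λ e → t≢y (sym e))) q)
                            , trans (bump-other (bump B t s') t≢u)
                                (trans (bump-value t s' r) (trans (capped-suc (a + toℕ i)) (cong (_⊓ B) (sym (+-suc a (toℕ i)))))) })
      (⟦ B ∣ clr u ⟧ s)
      (upd-same (regs s) u 0 , upd-other (regs s) 0 y≢u ,
       trans (upd-other (regs s) 0 t≢u) (trans et (cong (_⊓ B) (sym (+-identityʳ a)))))

  addTo-exact : ∀ {t y u} s → t ≢ y → t ≢ u → y ≢ u → ∀ {a b} → regs s t ≡ a → regs s y ≡ b → a + b ≤ B →
                regs (⟦ B ∣ addTo t y u ⟧ s) t ≡ a + b
  addTo-exact s t≢y t≢u y≢u {a} {b} et ey p =
    trans (addTo-value s t≢y t≢u y≢u (trans et (sym (m≤n⇒m⊓n≡m (≤-trans (m≤m+n a b) p)))) ey (≤-trans (m≤n+m b a) p)) (m≤n⇒m⊓n≡m p)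

-- TOP holds B.  OFF is the address of the adjacency matrix, KK the parameter and FF
-- the number of edges added so far; with k = KK − FF, T2 is 2k and THR is T2² + T2,
-- both capped at B.
TOP ZERO NN OFF KK FF T2 THR NO FOUND : ℕ
TOP = 0
ZERO = 1
NN = 2
OFF = 3
KK = 4
FF = 5
T2 = 6
THR = 7
NO = 8
FOUND = 9

-- t := OFF + x · NN + y, using registers t + 1 and t + 2.
addr : ℕ → ℕ → ℕ → Stm
addr t x y = clr t ⨟ addTo t OFF (1 + t) ⨟ (clr (1 + t) ⨟ loop (1 + t) x (addTo t NN (2 + t))) ⨟ addTo t y (2 + t)

-- Formulas with counting quantifiers and their evaluation

data Fm (v : ℕ) : Set where
  adjF neF : Fin v → Fin v → Fm v
  notF     : Fm v → Fm v
  andF orF : Fm v → Fm v → Fm v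
  cntF     : Fin 8 → Fm (suc v) → Fm v

sem : ∀ {n v} → Graph n → (Fin 8 → ℕ) → Fm v → Vec (Fin n) v → Bool
sem G θ (adjF i j) env = adj G (Vec.lookup env i) (Vec.lookup env j)
sem G θ (neF i j)  env = neᵇ (Vec.lookup env i) (Vec.lookup env j)
sem G θ (notF φ)   env = not (sem G θ φ env)
sem G θ (andF φ ψ) env = sem G θ φ env ∧ sem G θ ψ env
sem G θ (orF φ ψ)  env = sem G θ φ env ∨ sem G θ ψ env
sem G θ (cntF τ φ) env = θ τ <ᵇ cnt (λ x → sem G θ φ (x ∷ env))

-- The truth value is left in register `d` as 0 or 1; registers from `d` on are scratch and those
-- below are kept. In `cntF` the counter of the loop is itself the register of the bound variable,
-- and the body works above it.
ev : ∀ {v} → ℕ → Vec ℕ v → Fm v → Stm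
ev d ρ (adjF i j) = addr (1 + d) (Vec.lookup ρ i) (Vec.lookup ρ j) ⨟ clr d ⨟ ifm (1 + d) b1 (inc d) nop
ev d ρ (neF i j)  = clr d ⨟ ifl (Vec.lookup ρ i) (Vec.lookup ρ j) (inc d) (ifl (Vec.lookup ρ j) (Vec.lookup ρ i) (inc d) nop)
ev d ρ (notF φ)   = ev d ρ φ ⨟ ifl ZERO d (clr d) (inc d)
ev d ρ (andF φ ψ) = ev d ρ φ ⨟ ifl ZERO d (ev d ρ ψ) nop
ev d ρ (orF φ ψ)  = ev d ρ φ ⨟ ifl ZERO d nop (ev d ρ ψ)
ev d ρ (cntF τ φ) = clr (1 + d) ⨟ clr (2 + d) ⨟
                    loop (2 + d) NN (ev (3 + d) ((2 + d) ∷ ρ) φ ⨟ ifl ZERO (3 + d) (inc (1 + d)) nop) ⨟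
                    clr d ⨟ ifl (toℕ τ) (1 + d) (inc d) nop

record Holds {n} (G : Graph n) (θ : Fin 8 → ℕ) (s : State) : Set where
  field
    reg : ∀ τ → regs s (toℕ τ) ≡ θ τ
    adjacency : ∀ i j → mem s (θ (suc (suc (suc zero))) + (toℕ i * n + toℕ j)) ≡ bit (adj G i j)
open Holds

module Eval {n} (B : ℕ) (0<B : 0 < B) (n≤B : n ≤ B) (G : Graph n) (θ : Fin 8 → ℕ)
            (θ-zero : θ (suc zero) ≡ 0) (θ-n : θ (suc (suc zero)) ≡ n)
            (fits : θ (suc (suc (suc zero))) + n * n ≤ B) where

  open Rules B

  off : ℕ
  off = θ (suc (suc (suc zero)))

  Env : State → Set
  Env = Holds G θ

  zero-reg : ∀ {s} → Env s → regs s ZERO ≡ 0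
  zero-reg e = trans (reg e (suc zero)) θ-zero

  n-reg : ∀ {s} → Env s → regs s NN ≡ n
  n-reg e = trans (reg e (suc (suc zero))) θ-n

  off-reg : ∀ {s} → Env s → regs s OFF ≡ off
  off-reg e = reg e (suc (suc (suc zero)))

  Env-keep : ∀ {s} p {d} → 8 ≤ d → (∀ z → z < d → wr p z ≡ false) → puts p ≡ false → Env s → Env (⟦ B ∣ p ⟧ s)
  Env-keep {s} p 8≤d w m e = record
    { reg = λ τ → trans (frame p (toℕ τ) s (w (toℕ τ) (≤-trans (toℕ<n τ) 8≤d))) (reg e τ)
    ; adjacency = λ i j → trans (cong (λ f → f (off + (toℕ i * n + toℕ j))) (frame-mem p s m)) (adjacency e i j) }

  apart : ∀ {z d} → z < d → ∀ i → z ≢ i + d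
  apart z<d i refl = <⇒≱ z<d (m≤n+m _ i)

  wr-addr : ∀ t x y z → z < t → wr (addr t x y) z ≡ false
  wr-addr t x y z z<t rewrite ≡ᵇ-false z t (apart z<t 0) | ≡ᵇ-false z (1 + t) (apart z<t 1) | ≡ᵇ-false z (2 + t) (apart z<t 2) = refl

  row-bound : (i : Fin n) → toℕ i * n + n ≤ n * n
  row-bound i = ≤-trans (≤-reflexive (+-comm (toℕ i * n) n)) (*-monoˡ-≤ n (toℕ<n i))

  addr-value : ∀ {t x y s} (i j : Fin n) → 8 ≤ t → x < t → y < t → regs s NN ≡ n → regs s OFF ≡ off → regs s x ≡ toℕ i → regs s y ≡ toℕ j →
               regs (⟦ B ∣ addr t x y ⟧ s) t ≡ off + (toℕ i * n + toℕ j)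
  addr-value {t} {x} {y} {s} i j 8≤t x<t y<t e-n e-off ex ey =
    trans (addTo-exact s₃ (apart y<t 0 ∘ sym) t≢2+t (apart y<t 2) (proj₂ (proj₂ (proj₂ (proj₂ final)))) (proj₁ (proj₂ (proj₂ (proj₂ final)))) last-bound)
          (+-assoc off (toℕ i * n) (toℕ j))
    where
    low : ∀ {z} → z < 8 → z < t
    low p = ≤-trans p 8≤t
    last-bound : off + toℕ i * n + toℕ j ≤ B
    last-bound = ≤-trans (≤-reflexive (+-assoc off (toℕ i * n) (toℕ j)))
      (≤-trans (+-monoʳ-≤ off (≤-trans (+-monoʳ-≤ (toℕ i * n) (<⇒≤ (toℕ<n j))) (row-bound i))) fits)
    step-bound : ∀ k → k < toℕ i → off + k * n + n ≤ B
    step-bound k k<i = ≤-trans (≤-reflexive (+-assoc off (k * n) n))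
      (≤-trans (+-monoʳ-≤ off (≤-trans (≤-reflexive (+-comm (k * n) n)) (*-monoˡ-≤ n (≤-trans k<i (<⇒≤ (toℕ<n i)))))) fits)
    OFF<t = low {OFF} (s≤s (s≤s (s≤s (s≤s z≤n))))
    NN<t = low {NN} (s≤s (s≤s (s≤s z≤n)))
    s₁ = ⟦ B ∣ clr t ⟧ s
    s₂ = ⟦ B ∣ addTo t OFF (1 + t) ⟧ s₁
    I : ℕ → State → Set
    I k s' = regs s' (1 + t) ≡ k × regs s' x ≡ toℕ i × regs s' NN ≡ n × regs s' y ≡ toℕ j × regs s' t ≡ off + k * n
    early : ∀ {z} → z < t → regs (⟦ B ∣ clr (1 + t) ⟧ s₂) z ≡ regs s z
    early {z} z<t = trans (upd-other (regs s₂) 0 (apart z<t 1))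
      (trans (frame (addTo t OFF (1 + t)) z s₁ (wr-addTo {t} {OFF} {1 + t} {z} (apart z<t 0) (apart z<t 1))) (upd-other (regs s) 0 (apart z<t 0)))
    s₃ = ⟦ B ∣ clr (1 + t) ⨟ loop (1 + t) x (addTo t NN (2 + t)) ⟧ s₂
    t≢2+t : t ≢ 2 + t
    t≢2+t q = <⇒≢ (m≤n+m (suc t) 1) q
    final : I (toℕ i) s₃
    final = loop-rule {1 + t} {x} {toℕ i} (addTo t NN (2 + t)) I (λ { (p , q , _) → p , q })
      (λ { k s' (p , q , r , u , v) →
         let keep : ∀ {z} → z < t → regs (bump B (1 + t) (⟦ B ∣ addTo t NN (2 + t) ⟧ s')) z ≡ regs s' z
             keep {z} z<t = trans (bump-other (⟦ B ∣ addTo t NN (2 + t) ⟧ s') (apart z<t 1))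
                                  (frame (addTo t NN (2 + t)) z s' (wr-addTo {t} {NN} {2 + t} {z} (apart z<t 0) (apart z<t 2)))
         in bump-suc (1 + t) (⟦ B ∣ addTo t NN (2 + t) ⟧ s')
              (trans (frame (addTo t NN (2 + t)) (1 + t) s' (wr-addTo {t} {NN} {2 + t} {1 + t} 1+n≢n (λ z → 1+n≢n (sym z)))) p)
              (≤-trans (toℕ<n k) (≤-trans (<⇒≤ (toℕ<n i)) n≤B))
          , trans (keep x<t) q , trans (keep NN<t) r , trans (keep y<t) u
          , trans (bump-other (⟦ B ∣ addTo t NN (2 + t) ⟧ s') (λ z → 1+n≢n (sym z)))
              (trans (addTo-exact s' (apart NN<t 0 ∘ sym) t≢2+t (apart NN<t 2) v r (step-bound (toℕ k) (toℕ<n k)))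
                (trans (+-assoc off (toℕ k * n) n) (cong (off +_) (+-comm (toℕ k * n) n)))) })
      (⟦ B ∣ clr (1 + t) ⟧ s₂)
      ( upd-same (regs s₂) (1 + t) 0 , trans (early x<t) ex , trans (early NN<t) e-n , trans (early y<t) ey
      , trans (upd-other (regs s₂) 0 (λ z → 1+n≢n (sym z)))
          (trans (addTo-exact s₁ (apart OFF<t 0 ∘ sym) (λ z → 1+n≢n (sym z)) (apart OFF<t 1) (upd-same (regs s) t 0)
                   (trans (upd-other (regs s) 0 (apart OFF<t 0)) e-off) (≤-trans (m≤m+n off (n * n)) fits))
                 (sym (+-identityʳ off))))

  wr-ev : ∀ {v} (φ : Fm v) d ρ z → z < d → wr (ev d ρ φ) z ≡ false
  wr-ev (adjF i j) d ρ z z<d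
    rewrite wr-addr (1 + d) (Vec.lookup ρ i) (Vec.lookup ρ j) z (m≤n⇒m≤1+n z<d) | ≡ᵇ-false z d (apart z<d 0) = refl
  wr-ev (neF i j)  d ρ z z<d rewrite ≡ᵇ-false z d (apart z<d 0) = refl
  wr-ev (notF φ)   d ρ z z<d rewrite wr-ev φ d ρ z z<d | ≡ᵇ-false z d (apart z<d 0) = refl
  wr-ev (andF φ ψ) d ρ z z<d rewrite wr-ev φ d ρ z z<d | wr-ev ψ d ρ z z<d = refl
  wr-ev (orF φ ψ)  d ρ z z<d rewrite wr-ev φ d ρ z z<d | wr-ev ψ d ρ z z<d = refl
  wr-ev (cntF τ φ) d ρ z z<d
    rewrite wr-ev φ (3 + d) ((2 + d) ∷ ρ) z (m≤n⇒m≤1+n (m≤n⇒m≤1+n (m≤n⇒m≤1+n z<d)))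
          | ≡ᵇ-false z d (apart z<d 0) | ≡ᵇ-false z (1 + d) (apart z<d 1) | ≡ᵇ-false z (2 + d) (apart z<d 2) = refl

  puts-ev : ∀ {v} (φ : Fm v) d ρ → puts (ev d ρ φ) ≡ false
  puts-ev (adjF i j) d ρ = refl
  puts-ev (neF i j)  d ρ = refl
  puts-ev (notF φ)   d ρ rewrite puts-ev φ d ρ = refl
  puts-ev (andF φ ψ) d ρ rewrite puts-ev φ d ρ | puts-ev ψ d ρ = refl
  puts-ev (orF φ ψ)  d ρ rewrite puts-ev φ d ρ | puts-ev ψ d ρ = refl
  puts-ev (cntF τ φ) d ρ rewrite puts-ev φ (3 + d) ((2 + d) ∷ ρ) = refl

  prints-ev : ∀ {v} (φ : Fm v) d ρ → prints (ev d ρ φ) ≡ false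
  prints-ev (adjF i j) d ρ = refl
  prints-ev (neF i j)  d ρ = refl
  prints-ev (notF φ)   d ρ rewrite prints-ev φ d ρ = refl
  prints-ev (andF φ ψ) d ρ rewrite prints-ev φ d ρ | prints-ev ψ d ρ = refl
  prints-ev (orF φ ψ)  d ρ rewrite prints-ev φ d ρ | prints-ev ψ d ρ = refl
  prints-ev (cntF τ φ) d ρ rewrite prints-ev φ (3 + d) ((2 + d) ∷ ρ) = refl

  ifl-run : ∀ {x y p q b} s → (regs s x <ᵇ regs s y) ≡ b → ⟦ B ∣ ifl x y p q ⟧ s ≡ (if b then ⟦ B ∣ p ⟧ s else ⟦ B ∣ q ⟧ s)
  ifl-run s refl = refl

  flag-test : ∀ {z f b} → z ≡ 0 → f ≡ b2n b → (z <ᵇ f) ≡ b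
  flag-test {b = true}  refl refl = refl
  flag-test {b = false} refl refl = refl

  flag-run : ∀ {d b} p q s → Env s → regs s d ≡ b2n b → ⟦ B ∣ ifl ZERO d p q ⟧ s ≡ (if b then ⟦ B ∣ p ⟧ s else ⟦ B ∣ q ⟧ s)
  flag-run {d} p q s e f = ifl-run {ZERO} {d} {p} {q} s (flag-test (zero-reg e) f)

  Reads : ∀ {v} → ℕ → Vec ℕ v → Vec (Fin n) v → State → Set
  Reads d ρ env s = ∀ i → Vec.lookup ρ i < d × regs s (Vec.lookup ρ i) ≡ toℕ (Vec.lookup env i)

  Reads-keep : ∀ {v d} {ρ : Vec ℕ v} {env s} p → (∀ z → z < d → wr p z ≡ false) → Reads d ρ env s → Reads d ρ env (⟦ B ∣ p ⟧ s)
  Reads-keep {ρ = ρ} {s = s} p w r i = proj₁ (r i) , trans (frame p (Vec.lookup ρ i) s (w _ (proj₁ (r i)))) (proj₂ (r i))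

  raised : ∀ {d s} → regs s d ≡ 0 → regs (bump B d s) d ≡ 1
  raised {d} {s} e = bump-suc d s e 0<B

  set-flag : ∀ d s b → regs s d ≡ 0 → regs (if b then bump B d s else s) d ≡ b2n b
  set-flag d s true  e = raised {d} {s} e
  set-flag d s false e = e

  eqSym-bit : ∀ b → eqSym (bit b) b1 ≡ b
  eqSym-bit true  = refl
  eqSym-bit false = refl

  ev-value : ∀ {v} (φ : Fm v) d ρ env s → 8 ≤ d → Env s → Reads d ρ env s → regs (⟦ B ∣ ev d ρ φ ⟧ s) d ≡ b2n (sem G θ φ env)
  ev-value (adjF i j) d ρ env s 8≤d e r =
    trans (cong (λ b → regs (if b then bump B d s₂ else s₂) d) test) (set-flag d s₂ (adj G u v) (upd-same (regs s₁) d 0))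
    where
    u = Vec.lookup env i
    v = Vec.lookup env j
    t = 1 + d
    p = addr t (Vec.lookup ρ i) (Vec.lookup ρ j)
    s₁ = ⟦ B ∣ p ⟧ s
    s₂ = ⟦ B ∣ clr d ⟧ s₁
    8≤t = m≤n⇒m≤1+n 8≤d
    there : regs s₂ t ≡ off + (toℕ u * n + toℕ v)
    there = trans (upd-other (regs s₁) 0 1+n≢n)
      (addr-value u v 8≤t (m≤n⇒m≤1+n (proj₁ (r i))) (m≤n⇒m≤1+n (proj₁ (r j))) (n-reg e) (off-reg e) (proj₂ (r i)) (proj₂ (r j)))
    test : eqSym (mem s₂ (regs s₂ t)) b1 ≡ adj G u v
    test = trans (cong (λ a → eqSym (mem s₁ a) b1) there)
      (trans (cong (λ z → eqSym z b1) (adjacency (Env-keep p 8≤t (wr-addr t (Vec.lookup ρ i) (Vec.lookup ρ j)) refl e) u v)) (eqSym-bit (adj G u v)))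
  ev-value (neF i j) d ρ env s 8≤d e r =
    trans (cong₂ (λ a b → regs (if a then bump B d s₁ else (if b then bump B d s₁ else s₁)) d) (cong₂ _<ᵇ_ (now i) (now j)) (cong₂ _<ᵇ_ (now j) (now i)))
          (either (toℕ u <ᵇ toℕ v) (toℕ v <ᵇ toℕ u))
    where
    u = Vec.lookup env i
    v = Vec.lookup env j
    s₁ = ⟦ B ∣ clr d ⟧ s
    now : ∀ i → regs s₁ (Vec.lookup ρ i) ≡ toℕ (Vec.lookup env i)
    now i = trans (upd-other (regs s) 0 (apart (proj₁ (r i)) 0)) (proj₂ (r i))
    either : ∀ a b → regs (if a then bump B d s₁ else (if b then bump B d s₁ else s₁)) d ≡ b2n (a ∨ b)
    either true  b = raised {d} {s₁} (upd-same (regs s) d 0)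
    either false b = set-flag d s₁ b (upd-same (regs s) d 0)
  ev-value (notF φ) d ρ env s 8≤d e r =
    trans (cong (λ s → regs s d) (flag-run (clr d) (inc d) s₁ e₁ f)) (flip (sem G θ φ env) f)
    where
    s₁ = ⟦ B ∣ ev d ρ φ ⟧ s
    f = ev-value φ d ρ env s 8≤d e r
    e₁ = Env-keep (ev d ρ φ) 8≤d (wr-ev φ d ρ) (puts-ev φ d ρ) e
    flip : ∀ b → regs s₁ d ≡ b2n b → regs (if b then ⟦ B ∣ clr d ⟧ s₁ else ⟦ B ∣ inc d ⟧ s₁) d ≡ b2n (not b)
    flip true  f = upd-same (regs s₁) d 0
    flip false f = raised {d} {s₁} f
  ev-value (andF φ ψ) d ρ env s 8≤d e r =
    trans (cong (λ s → regs s d) (flag-run (ev d ρ ψ) nop s₁ e₁ f)) (both (sem G θ φ env) f)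
    where
    s₁ = ⟦ B ∣ ev d ρ φ ⟧ s
    f = ev-value φ d ρ env s 8≤d e r
    e₁ = Env-keep (ev d ρ φ) 8≤d (wr-ev φ d ρ) (puts-ev φ d ρ) e
    both : ∀ b → regs s₁ d ≡ b2n b → regs (if b then ⟦ B ∣ ev d ρ ψ ⟧ s₁ else s₁) d ≡ b2n (b ∧ sem G θ ψ env)
    both true  f = ev-value ψ d ρ env s₁ 8≤d e₁ (Reads-keep {ρ = ρ} {env} (ev d ρ φ) (wr-ev φ d ρ) r)
    both false f = f
  ev-value (orF φ ψ) d ρ env s 8≤d e r =
    trans (cong (λ s → regs s d) (flag-run nop (ev d ρ ψ) s₁ e₁ f)) (either (sem G θ φ env) f)
    where
    s₁ = ⟦ B ∣ ev d ρ φ ⟧ s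
    f = ev-value φ d ρ env s 8≤d e r
    e₁ = Env-keep (ev d ρ φ) 8≤d (wr-ev φ d ρ) (puts-ev φ d ρ) e
    either : ∀ b → regs s₁ d ≡ b2n b → regs (if b then s₁ else ⟦ B ∣ ev d ρ ψ ⟧ s₁) d ≡ b2n (b ∨ sem G θ ψ env)
    either true  f = f
    either false f = ev-value ψ d ρ env s₁ 8≤d e₁ (Reads-keep {ρ = ρ} {env} (ev d ρ φ) (wr-ev φ d ρ) r)
  ev-value (cntF τ φ) d ρ env s 8≤d e r =
    trans (cong (λ b → regs (if b then bump B d s₄ else s₄) d) test) (set-flag d s₄ (θ τ <ᵇ cnt P) (upd-same (regs s₃) d 0))
    where
    P : Fin n → Bool
    P x = sem G θ φ (x ∷ env)
    c = 1 + d
    x = 2 + d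
    f = 3 + d
    8≤f : 8 ≤ f
    8≤f = ≤-trans 8≤d (m≤n+m d 3)
    s₂ = ⟦ B ∣ clr x ⟧ (⟦ B ∣ clr c ⟧ s)
    b = ev f (x ∷ ρ) φ ⨟ ifl ZERO f (inc c) nop
    s₃ = ⟦ B ∣ loop x NN b ⟧ s₂
    s₄ = ⟦ B ∣ clr d ⟧ s₃
    x≢c : x ≢ c
    x≢c = 1+n≢n
    I : ℕ → State → Set
    I j s' = regs s' x ≡ j × Env s' × Reads d ρ env s' × regs s' c ≡ prefix P j
    tick : State → Bool → State
    tick s true  = bump B c s
    tick s false = s
    advance : (i : Fin n) (s' : State) → I (toℕ i) s' → I (suc (toℕ i)) (bump B x (⟦ B ∣ b ⟧ s'))
    advance i s' (px , pe , pr , pc) =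
      subst (λ z → I (suc (toℕ i)) (bump B x z)) (sym (trans (flag-run (inc c) nop u ue uf) (same (P i)))) (ticked (P i) refl)
      where
      u = ⟦ B ∣ ev f (x ∷ ρ) φ ⟧ s'
      wrφ = wr-ev φ f (x ∷ ρ)
      ue : Env u
      ue = Env-keep (ev f (x ∷ ρ) φ) 8≤f wrφ (puts-ev φ f (x ∷ ρ)) pe
      uf : regs u f ≡ b2n (P i)
      uf = ev-value φ f (x ∷ ρ) (i ∷ env) s' 8≤f pe
             (λ { zero → ≤-refl , px ; (suc j) → ≤-trans (proj₁ (pr j)) (m≤n+m d 3) , proj₂ (pr j) })
      ux : regs u x ≡ toℕ i
      ux = trans (frame (ev f (x ∷ ρ) φ) x s' (wrφ x ≤-refl)) px
      uc : regs u c ≡ prefix P (toℕ i)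
      uc = trans (frame (ev f (x ∷ ρ) φ) c s' (wrφ c (m≤n+m (suc c) 1))) pc
      ur : Reads d ρ env u
      ur = Reads-keep {ρ = ρ} {env} (ev f (x ∷ ρ) φ) (λ z z<d → wrφ z (≤-trans z<d (m≤n+m d 3))) pr
      same : ∀ b → (if b then ⟦ B ∣ inc c ⟧ u else ⟦ B ∣ nop ⟧ u) ≡ tick u b
      same true  = refl
      same false = refl
      tick-other : ∀ b z → z ≢ c → regs (tick u b) z ≡ regs u z
      tick-other true  z ne = bump-other u ne
      tick-other false z ne = refl
      tick-mem : ∀ b → mem (tick u b) ≡ mem u
      tick-mem true  = refl
      tick-mem false = refl
      low : ∀ {z} b → z < d → regs (bump B x (tick u b)) z ≡ regs u z
      low {z} b z<d = trans (bump-other (tick u b) (apart z<d 2)) (tick-other b z (apart z<d 1))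
      count : ∀ b → P i ≡ b → regs (tick u b) c ≡ prefix P (suc (toℕ i))
      count true  q = trans (bump-suc c u uc (≤-trans (s≤s (prefix≤ P (toℕ i))) (≤-trans (toℕ<n i) n≤B)))
        (sym (trans (prefix-suc P i) (trans (cong (λ z → prefix P (toℕ i) + b2n z) q) (+-comm _ 1))))
      count false q = trans uc (sym (trans (prefix-suc P i) (trans (cong (λ z → prefix P (toℕ i) + b2n z) q) (+-identityʳ _))))
      ticked : ∀ b → P i ≡ b → I (suc (toℕ i)) (bump B x (tick u b))
      ticked b q =
        bump-suc x (tick u b) (trans (tick-other b x x≢c) ux) (≤-trans (toℕ<n i) n≤B) ,
        record { reg = λ τ → trans (low b (≤-trans (toℕ<n τ) 8≤d)) (reg ue τ)
               ; adjacency = λ i j → trans (cong (λ m → m (off + (toℕ i * n + toℕ j))) (tick-mem b)) (adjacency ue i j) } ,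
        (λ j → proj₁ (ur j) , trans (low b (proj₁ (ur j))) (proj₂ (ur j))) ,
        trans (bump-other (tick u b) (x≢c ∘ sym)) (count b q)
    wr2 : ∀ z → z < d → wr (clr c ⨟ clr x) z ≡ false
    wr2 z z<d rewrite ≡ᵇ-false z c (apart z<d 1) | ≡ᵇ-false z x (apart z<d 2) = refl
    final : I n s₃
    final = loop-rule b I (λ { (p , pe , _) → p , n-reg pe }) advance s₂
      ( upd-same (regs (⟦ B ∣ clr c ⟧ s)) x 0 , Env-keep (clr c ⨟ clr x) 8≤d wr2 refl e , Reads-keep {ρ = ρ} {env} {s} (clr c ⨟ clr x) wr2 r
      , trans (upd-other (regs (⟦ B ∣ clr c ⟧ s)) 0 (x≢c ∘ sym)) (trans (upd-same (regs s) c 0) (sym (prefix-zero P))) )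
    test : (regs s₄ (toℕ τ) <ᵇ regs s₄ c) ≡ (θ τ <ᵇ cnt P)
    test = cong₂ _<ᵇ_
      (trans (upd-other (regs s₃) 0 (apart (≤-trans (toℕ<n τ) 8≤d) 0)) (reg (proj₁ (proj₂ final)) τ))
      (trans (upd-other (regs s₃) 0 1+n≢n) (trans (proj₂ (proj₂ (proj₂ final))) (prefix-all P)))

  -- The program enters through an equation, so that the value of an opaque test is obtained without
  -- unfolding it at the place of use.
  verdict : ∀ {v} (φ : Fm v) d ρ env {p b s} → p ≡ ev d ρ φ → sem G θ φ env ≡ b → 8 ≤ d → Env s → Reads d ρ env s →
            regs (⟦ B ∣ p ⟧ s) d ≡ b2n b
  verdict φ d ρ env {s = s} refl refl 8≤d e r = ev-value φ d ρ env s 8≤d e r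

-- The code of an instance, read by position

nth-++ : ∀ u v j → nth (u ++ v) (length u + j) ≡ nth v j
nth-++ []      v j = refl
nth-++ (x ∷ u) v j = nth-++ u v j

nth-++ˡ : ∀ u v {j} → j < length u → nth (u ++ v) j ≡ nth u j
nth-++ˡ (x ∷ u) v {zero}  _       = refl
nth-++ˡ (x ∷ u) v {suc j} (s≤s p) = nth-++ˡ u v p

nth-replicate : ∀ {n s j} v → j < n → nth (replicate n s ++ v) j ≡ s
nth-replicate {suc n} {j = zero}  v _       = refl
nth-replicate {suc n} {j = suc j} v (s≤s p) = nth-replicate v p

nth-rows : ∀ {A : Set} {m n} (F : A → List Sym) (g : Fin m → A) → (∀ a → length (F a) ≡ n) → ∀ i j → j < n →
           nth (concatMap F (tabulate g)) (toℕ i * n + j) ≡ nth (F (g i)) j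
nth-rows {m = suc m} F g e zero j p = nth-++ˡ (F (g zero)) _ (≤-trans p (≤-reflexive (sym (e (g zero)))))
nth-rows {m = suc m} {n} F g e (suc i) j p =
  trans (cong (nth (F (g zero) ++ concatMap F (tabulate (g ∘ suc)))) (trans (+-assoc n (toℕ i * n) j) (cong (_+ (toℕ i * n + j)) (sym (e (g zero))))))
        (trans (nth-++ (F (g zero)) _ _) (nth-rows F (g ∘ suc) e i j p))

length-rows : ∀ {A : Set} {m n} (F : A → List Sym) (g : Fin m → A) → (∀ a → length (F a) ≡ n) →
              length (concatMap F (tabulate g)) ≡ m * n
length-rows {m = zero}  F g e = refl
length-rows {m = suc m} F g e = trans (List.length-++ (F (g zero))) (cong₂ _+_ (e (g zero)) (length-rows F (g ∘ suc) e))

nth-row : ∀ {A : Set} {m} (f : A → Sym) (g : Fin m → A) j → nth (map f (tabulate g)) (toℕ j) ≡ f (g j)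
nth-row f g zero    = refl
nth-row f g (suc j) = nth-row f (g ∘ suc) j

row : ∀ {n} → Graph n → Fin n → List Sym
row G i = map (λ j → bit (adj G i j)) (allFin _)

length-row : ∀ {n} (G : Graph n) i → length (row G i) ≡ n
length-row {n} G i = trans (List.length-map _ (allFin n)) (List.length-tabulate id)

tail-code : ∀ {n} → Graph n → List Sym
tail-code {n} G = sep ∷ concatMap (row G) (allFin n)

-- The matrix begins behind the numeral, `n` ones and two separators.
start-of : ∀ {n} → Graph n → ℕ → ℕ
start-of {n} G k = length (encNat k) + suc (suc n)

length-code : ∀ {n} (G : Graph n) k → length (encode (inst n G k)) ≡ start-of G k + n * n
length-code {n} G k = begin
  length (encNat k ++ sep ∷ replicate n b1 ++ tail-code G)  ≡⟨ List.length-++ (encNat k) ⟩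
  e + suc (length (replicate n b1 ++ tail-code G))          ≡⟨ cong (λ z → e + suc z) (trans (List.length-++ (replicate n b1)) (cong₂ _+_ (List.length-replicate n) (cong suc (length-rows (row G) id (length-row G))))) ⟩
  e + suc (n + suc (n * n))                                 ≡⟨ cong (λ z → e + suc z) (+-suc n (n * n)) ⟩
  e + suc (suc (n + n * n))                                 ≡⟨ sym (+-assoc e (suc (suc n)) (n * n)) ⟩
  e + suc (suc n) + n * n                                   ∎
  where
  open ≡-Reasoning
  e = length (encNat k)

code-adj : ∀ {n} (G : Graph n) k i j → nth (encode (inst n G k)) (start-of G k + (toℕ i * n + toℕ j)) ≡ bit (adj G i j)
code-adj {n} G k i j = begin
  nth (encode (inst n G k)) (e + suc (suc n) + q)      ≡⟨ cong (nth (encode (inst n G k))) (+-assoc e (suc (suc n)) q) ⟩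
  nth (encode (inst n G k)) (e + suc (suc (n + q)))    ≡⟨ nth-++ (encNat k) _ _ ⟩
  nth (replicate n b1 ++ tail-code G) (suc (n + q))    ≡⟨ cong (nth (replicate n b1 ++ tail-code G)) (trans (sym (+-suc n q)) (cong (_+ suc q) (sym (List.length-replicate n)))) ⟩
  nth (replicate n b1 ++ tail-code G) (length (replicate n b1) + suc q) ≡⟨ nth-++ (replicate n b1) (tail-code G) (suc q) ⟩
  nth (concatMap (row G) (allFin n)) q                 ≡⟨ nth-rows (row G) id (length-row G) i (toℕ j) (toℕ<n j) ⟩
  nth (row G i) (toℕ j)                                ≡⟨ nth-row (λ j → bit (adj G i j)) id j ⟩
  bit (adj G i j)                                      ∎
  where
  open ≡-Reasoning
  e = length (encNat k)
  q = toℕ i * n + toℕ j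

code-digit : ∀ {n} (G : Graph n) k {j} → j < length (encNat k) → nth (encode (inst n G k)) j ≡ nth (encNat k) j
code-digit G k p = nth-++ˡ (encNat k) _ p

code-sep : ∀ {n} (G : Graph n) k → nth (encode (inst n G k)) (length (encNat k)) ≡ sep
code-sep G k = trans (cong (nth (encode (inst _ G k))) (sym (+-identityʳ _))) (nth-++ (encNat k) _ 0)

code-ones : ∀ {n} (G : Graph n) k {j} → j < n → nth (encode (inst n G k)) (length (encNat k) + suc j) ≡ b1
code-ones {n} G k {j} p = trans (nth-++ (encNat k) _ (suc j)) (nth-replicate (tail-code G) p)

code-sep₂ : ∀ {n} (G : Graph n) k → nth (encode (inst n G k)) (length (encNat k) + suc n) ≡ sep
code-sep₂ {n} G k = trans (nth-++ (encNat k) _ (suc n))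
  (trans (cong (nth (replicate n b1 ++ tail-code G)) (trans (sym (+-identityʳ n)) (cong (_+ 0) (sym (List.length-replicate n)))))
         (nth-++ (replicate n b1) (tail-code G) 0))

-- Bijective base 2 has the digits 1 and 2, and `b0` stands for 2.
digit : Sym → ℕ
digit b1 = 1
digit _  = 2

IsDigit : Sym → Set
IsDigit s = s ≡ b0 ⊎ s ≡ b1

encBin-digits : ∀ b → All IsDigit (encBin b)
encBin-digits ℕᵇ.zero  = []
encBin-digits 2[1+ b ] = inj₁ refl ∷ encBin-digits b
encBin-digits 1+[2 b ] = inj₂ refl ∷ encBin-digits b

nth-All : ∀ {P : Sym → Set} {u} → All P u → ∀ {j} → j < length u → P (nth u j)
nth-All (p ∷ _)  {zero}  _       = p
nth-All (_ ∷ ps) {suc j} (s≤s q) = nth-All ps q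

NB-encode : ∀ I → All (λ s → nb s ≡ true) (encode I)
NB-encode (inst n G k) = AllP.++⁺ (All.map digit-nb (encBin-digits (ℕᵇ.fromℕ k)))
    (refl ∷ AllP.++⁺ (AllP.replicate⁺ n refl) (refl ∷ rows (allFin n)))
  where
  digit-nb : ∀ {s} → IsDigit s → nb s ≡ true
  digit-nb (inj₁ refl) = refl
  digit-nb (inj₂ refl) = refl
  bit-nb : ∀ b → nb (bit b) ≡ true
  bit-nb true  = refl
  bit-nb false = refl
  entries : ∀ i js → All (λ s → nb s ≡ true) (map (λ j → bit (adj G i j)) js)
  entries i []       = []
  entries i (j ∷ js) = bit-nb (adj G i j) ∷ entries i js
  rows : ∀ is → All (λ s → nb s ≡ true) (concatMap (row G) is)
  rows []       = []
  rows (i ∷ is) = AllP.++⁺ (entries i (allFin n)) (rows is)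

encode≢[] : ∀ I → encode I ≢ []
encode≢[] (inst n G k) e with encNat k
encode≢[] (inst n G k) () | []
encode≢[] (inst n G k) () | _ ∷ _

value : List Sym → ℕ → ℕ
value u zero    = 0
value u (suc j) = value u j + digit (nth u j) * 2 ^ j

value-∷ : ∀ x u j → value (x ∷ u) (suc j) ≡ digit x + 2 * value u j
value-∷ x u zero    = trans (*-identityʳ (digit x)) (sym (+-identityʳ (digit x)))
value-∷ x u (suc j) = begin
  value (x ∷ u) (suc j) + digit (nth u j) * (2 * 2 ^ j)       ≡⟨ cong₂ _+_ (value-∷ x u j) (x∙yz≈y∙xz (digit (nth u j)) 2 (2 ^ j)) ⟩
  digit x + 2 * value u j + 2 * (digit (nth u j) * 2 ^ j)     ≡⟨ +-assoc (digit x) _ _ ⟩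
  digit x + (2 * value u j + 2 * (digit (nth u j) * 2 ^ j))   ≡⟨ cong (digit x +_) (sym (*-distribˡ-+ 2 (value u j) _)) ⟩
  digit x + 2 * value u (suc j)                               ∎
  where
  open ≡-Reasoning
  x∙yz≈y∙xz : ∀ a b c → a * (b * c) ≡ b * (a * c)
  x∙yz≈y∙xz a b c = trans (sym (*-assoc a b c)) (trans (cong (_* c) (*-comm a b)) (*-assoc b a c))

value-encBin : ∀ b → value (encBin b) (length (encBin b)) ≡ ℕᵇ.toℕ b
value-encBin ℕᵇ.zero  = refl
value-encBin 2[1+ b ] = trans (value-∷ b0 (encBin b) (length (encBin b)))
  (trans (cong (λ z → 2 + 2 * z) (value-encBin b)) (sym (*-suc 2 (ℕᵇ.toℕ b))))
value-encBin 1+[2 b ] = trans (value-∷ b1 (encBin b) (length (encBin b))) (cong (λ z → 1 + 2 * z) (value-encBin b))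

value-encNat : ∀ k → value (encNat k) (length (encNat k)) ≡ k
value-encNat k = trans (value-encBin (ℕᵇ.fromℕ k)) (ℕᵇ.toℕ-fromℕ k)

-- The map `ℕᵇ.toℕ` is injective, so a numeral is identified by its value alone.
encNat-odd : ∀ h → encNat (1 + 2 * h) ≡ b1 ∷ encNat h
encNat-odd h = cong encBin (ℕᵇ.toℕ-injective {_} {1+[2 ℕᵇ.fromℕ h ]} (trans (ℕᵇ.toℕ-fromℕ (1 + 2 * h)) (cong (λ z → 1 + 2 * z) (sym (ℕᵇ.toℕ-fromℕ h)))))

encNat-even : ∀ h → encNat (2 + 2 * h) ≡ b0 ∷ encNat h
encNat-even h = cong encBin (ℕᵇ.toℕ-injective {_} {2[1+ ℕᵇ.fromℕ h ]} (trans (ℕᵇ.toℕ-fromℕ (2 + 2 * h))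
  (trans (sym (*-suc 2 h)) (cong (λ z → 2 * suc z) (sym (ℕᵇ.toℕ-fromℕ h))))))

-- The code of the kernel, written by loops over all vertices

upto : ∀ {n} → (Fin n → List Sym) → ℕ → List Sym
upto {zero}  F j       = []
upto {suc n} F zero    = []
upto {suc n} F (suc j) = F zero ++ upto (F ∘ suc) j

upto-zero : ∀ {n} (F : Fin n → List Sym) → upto F 0 ≡ []
upto-zero {zero}  F = refl
upto-zero {suc n} F = refl

upto-suc : ∀ {n} (F : Fin n → List Sym) i → upto F (suc (toℕ i)) ≡ upto F (toℕ i) ++ F i
upto-suc {suc n} F zero    = trans (cong (F zero ++_) (upto-zero (F ∘ suc))) (List.++-identityʳ (F zero))
upto-suc {suc n} F (suc i) = trans (cong (F zero ++_) (upto-suc (F ∘ suc) i)) (sym (List.++-assoc (F zero) _ _))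

upto-all : ∀ {A : Set} {n} (F : A → List Sym) (g : Fin n → A) → upto (F ∘ g) n ≡ concatMap F (tabulate g)
upto-all {n = zero}  F g = refl
upto-all {n = suc n} F g = cong (F (g zero) ++_) (upto-all F (g ∘ suc))

when : Bool → List Sym → List Sym
when b v = if b then v else []

concatMap-filter : ∀ {A : Set} (p : A → Bool) (F : A → List Sym) xs →
                   concatMap F (filter (λ v → p v Bool.≟ true) xs) ≡ concatMap (λ v → when (p v) (F v)) xs
concatMap-filter p F [] = refl
concatMap-filter p F (x ∷ xs) with p x
... | true  = cong (F x ++_) (concatMap-filter p F xs)
... | false = concatMap-filter p F xs

concatMap-lookup : ∀ {A : Set} (F : A → List Sym) K → concatMap (F ∘ lookup K) (allFin (length K)) ≡ concatMap F K
concatMap-lookup F K = cong concat (trans (List.map-tabulate id (F ∘ lookup K))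
  (trans (sym (List.map-tabulate (lookup K) F)) (cong (map F) (List.tabulate-lookup K))))

concatMap-single : ∀ {A : Set} (f : A → Sym) xs → concatMap (λ v → f v ∷ []) xs ≡ map f xs
concatMap-single f []       = refl
concatMap-single f (x ∷ xs) = cong (f x ∷_) (concatMap-single f xs)

length-filter-tabulate : ∀ {A : Set} {n} (p : A → Bool) (g : Fin n → A) →
                         length (filter (λ v → p v Bool.≟ true) (tabulate g)) ≡ cnt (p ∘ g)
length-filter-tabulate {n = zero}  p g = refl
length-filter-tabulate {n = suc n} p g with p (g zero)
... | true  = cong suc (length-filter-tabulate p (g ∘ suc))
... | false = length-filter-tabulate p (g ∘ suc)

rowOf : ∀ {n} → Graph n → Fin n → List Sym
rowOf {n} G v = upto (λ v' → when (badᵇ G v') (bit (adj G v v') ∷ [])) n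

-- The vertices of the kernel are positions in `keep G`, but the program never renumbers: it runs
-- through all vertices and skips those in no obstruction. This form of the code follows its loops.
kernel-code : ∀ {n} (G : Graph n) k → encode (inst (length (keep G)) (kernel G) k) ≡
              encNat k ++ sep ∷ upto (λ v → when (badᵇ G v) (b1 ∷ [])) n ++ sep ∷ upto (λ v → when (badᵇ G v) (rowOf G v)) n
kernel-code {n} G k = cong (λ z → encNat k ++ sep ∷ z) (cong₂ (λ x y → x ++ sep ∷ y) ones rows)
  where
  K = keep G
  through : (F : Fin n → List Sym) → concatMap F K ≡ upto (λ v → when (badᵇ G v) (F v)) n
  through F = trans (concatMap-filter (badᵇ G) F (allFin n)) (sym (upto-all (λ v → when (badᵇ G v) (F v)) id))
  ones : replicate (length K) b1 ≡ upto (λ v → when (badᵇ G v) (b1 ∷ [])) n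
  ones = trans (all-ones K) (through (λ _ → b1 ∷ []))
    where
    all-ones : ∀ (K : List (Fin n)) → replicate (length K) b1 ≡ concatMap (λ _ → b1 ∷ []) K
    all-ones []      = refl
    all-ones (_ ∷ K) = cong (b1 ∷_) (all-ones K)
  row≡ : ∀ v → map (λ j → bit (adj G v (lookup K j))) (allFin (length K)) ≡ rowOf G v
  row≡ v = trans (sym (concatMap-single (λ j → bit (adj G v (lookup K j))) (allFin (length K))))
             (trans (concatMap-lookup (λ v' → bit (adj G v v') ∷ []) K) (through (λ v' → bit (adj G v v') ∷ [])))
  rows : concatMap (row (kernel G)) (allFin (length K)) ≡ upto (λ v → when (badᵇ G v) (rowOf G v)) n
  rows = trans (List.concatMap-cong (λ i → row≡ (lookup K i)) (allFin (length K)))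
           (trans (concatMap-lookup (rowOf G) K) (through (rowOf G)))

-- The program

pattern 0F = zero
pattern 1F = suc 0F
pattern 2F = suc 1F
pattern 3F = suc 2F
pattern 4F = suc 3F
pattern 5F = suc 4F
pattern 6F = suc 5F
pattern 7F = suc 6F
pattern 8F = suc 7F

obsF : ∀ {v} (a b c d : Fin v) → Fm v
obsF a b c d = andF (adjF a b) (andF (adjF b c) (andF (adjF c d) (andF (notF (adjF a c)) (andF (notF (adjF b d)) (andF (neF a c) (neF b d))))))

quadF : ∀ {v} (a c x y : Fin v) → Fm v
quadF a c x y = orF (obsF a x c y) (orF (obsF c x a y) (orF (obsF a y c x) (obsF c y a x)))

-- Thresholds are given by register: 1 is `ZERO`, which makes the quantifier existential, 6 is `T2`,
-- and 7 is `THR`.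
exF : ∀ {v} → Fm (suc v) → Fm v
exF = cntF 1F

partF : ∀ {v} (a c x : Fin v) → Fm v
partF a c x = exF (quadF (suc a) (suc c) (suc x) 0F)

badF : ∀ {v} → Fin v → Fm v
badF v = exF (exF (partF (suc (suc v)) 1F 0F))

forcedF : ∀ {v} (a c : Fin v) → Fm v
forcedF a c = andF (neF a c) (andF (notF (adjF a c)) (cntF 6F (partF (suc a) (suc c) 0F)))

tooManyF : Fm 0
tooManyF = cntF 7F (badF 0F)

-- Opaque, since unfolding these programs on an abstract state is exponential.
opaque
  test edgeTest tooManyTest : Stm
  test = ev 13 (10 ∷ 11 ∷ []) (forcedF 0F 1F)
  edgeTest = ev 13 (10 ∷ 11 ∷ []) (adjF 0F 1F)
  tooManyTest = ev 13 [] tooManyF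

  badTest : ℕ → Stm
  badTest x = ev 13 (x ∷ []) (badF 0F)

ifFlag : Stm → Stm → Stm
ifFlag = ifl ZERO 13

-- There is no open-ended search: looking for the end of a field takes `B` rounds, which idle once
-- the end is found. Register 12 receives the length of the numeral, 14 holds the current power of
-- two, and a digit 2 adds it twice.
findSep readDigit double scanOnes locate decode parseK parseN parse : Stm
findSep = ifm 12 sep nop (inc 12)
readDigit = ifm 15 b1 (addTo KK 14 16) (addTo KK 14 16 ⨟ addTo KK 14 16)
double = clr 17 ⨟ addTo 17 14 16 ⨟ addTo 14 17 16
scanOnes = ifm OFF b1 (inc OFF ⨟ inc NN) nop
locate = loop 13 TOP findSep
decode = inc 14 ⨟ loop 15 12 (readDigit ⨟ double)
parseK = locate ⨟ decode
parseN = addTo OFF 12 16 ⨟ inc OFF ⨟ loop 18 TOP scanOnes ⨟ inc OFF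
parse = parseK ⨟ parseN

-- In `setT2` the counter 13 starts at `FF` and runs up to `KK`, which makes one round per unit of
-- the remaining budget. The last addition in `setTHR` turns `T2²` into `T2² + T2`.
setT2 setTHR : Stm
setT2 = clr T2 ⨟ clr 13 ⨟ addTo 13 FF 14 ⨟ loop 13 KK (inc T2 ⨟ inc T2)
setTHR = clr THR ⨟ clr 13 ⨟ loop 13 T2 (addTo THR T2 14) ⨟ addTo THR T2 14

-- `FOUND` stops a search after its first hit, because an added edge changes both the partner counts
-- and the threshold. If the budget is spent at that moment, `NO` is raised instead. One round
-- precedes the loop, so there are `B + 1` in all.
addEdgeS hit′ try scan search round guarded rounds : Stm
addEdgeS = addr 13 10 11 ⨟ put 13 ⨟ addr 13 11 10 ⨟ put 13 ⨟ inc FF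
hit′ = inc FOUND ⨟ ifl FF KK addEdgeS (inc NO)
try = ifl ZERO FOUND nop (test ⨟ ifFlag hit′ nop)
scan = clr 11 ⨟ loop 11 NN try
search = clr FOUND ⨟ clr 10 ⨟ loop 10 NN scan
round = setT2 ⨟ search
guarded = ifl ZERO NO nop round
rounds = guarded ⨟ loop 40 TOP guarded

emitList : List Sym → Stm
emitList []      = nop
emitList (c ∷ v) = emit c ⨟ emitList v

pathGraph : Graph 4
pathGraph = record
  { adj = λ i j → (suc (toℕ i) ≡ᵇ toℕ j) ∨ (suc (toℕ j) ≡ᵇ toℕ i)
  ; sym = λ i j → ∨-comm (suc (toℕ i) ≡ᵇ toℕ j) (suc (toℕ j) ≡ᵇ toℕ i)
  ; irrefl = λ { 0F → refl ; 1F → refl ; 2F → refl ; 3F → refl } }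

noInstance : Instance
noInstance = inst 4 pathGraph 0

-- The counter of `halve` starts at 1, so the predecessor is halved. This is what bijective base 2
-- asks for: the lowest digit of `suc v` is 1 for even `v` and 2 for odd `v`, and `v / 2` rounded
-- down remains.
halve digits emitK sizeItem emitSize entry′ emitRow rowItem emitRows emitKernel decide : Stm
halve = clr 15 ⨟ clr 16 ⨟ clr 17 ⨟ inc 17 ⨟ loop 17 13 (ifl ZERO 16 (clr 16 ⨟ inc 15) (inc 16))
digits = halve ⨟ ifl ZERO 16 (emit b0) (emit b1) ⨟ clr 13 ⨟ addTo 13 15 16
emitK = clr 13 ⨟ clr 14 ⨟ addTo 14 FF 15 ⨟ loop 14 KK (inc 13) ⨟ clr 14 ⨟ loop 14 TOP (ifFlag digits nop)
sizeItem = badTest 10 ⨟ ifFlag (emit b1) nop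
emitSize = clr 10 ⨟ loop 10 NN sizeItem
entry′ = badTest 11 ⨟ ifFlag (edgeTest ⨟ ifFlag (emit b1) (emit b0)) nop
emitRow = clr 11 ⨟ loop 11 NN entry′
rowItem = badTest 10 ⨟ ifFlag emitRow nop
emitRows = clr 10 ⨟ loop 10 NN rowItem
emitKernel = emitK ⨟ emit sep ⨟ emitSize ⨟ emit sep ⨟ emitRows
decide = setT2 ⨟ setTHR ⨟ ifl ZERO NO (emitList (encode noInstance)) (tooManyTest ⨟ ifFlag (emitList (encode noInstance)) emitKernel)

opaque
  parsePhase roundsPhase decidePhase : Stm
  parsePhase = parse
  roundsPhase = rounds
  decidePhase = decide

program : Stm
program = parsePhase ⨟ roundsPhase ⨟ decidePhase

-- Several frame facts about one program are bundled into a single Boolean, computed where the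
-- opaque tests unfold and taken apart by `free-wr` elsewhere.
free : ∀ {d} → Stm → Vec ℕ d → Bool
free p []       = true
free p (z ∷ zs) = not (wr p z) ∧ free p zs

free-wr : ∀ {d} p (zs : Vec ℕ d) → free p zs ≡ true → ∀ i → wr p (Vec.lookup zs i) ≡ false
free-wr p (z ∷ zs) e zero    = not-true (∧-conicalˡ _ _ e)
free-wr p (z ∷ zs) e (suc i) = free-wr p zs (∧-conicalʳ (not (wr p z)) _ e) i

lows : Vec ℕ 9
lows = 0 ∷ 1 ∷ 2 ∷ 3 ∷ 4 ∷ 5 ∷ 6 ∷ 7 ∷ 8 ∷ []

opaque
  unfolding test edgeTest tooManyTest badTest parsePhase roundsPhase decidePhase

  phases : parsePhase ≡ parse × roundsPhase ≡ rounds × decidePhase ≡ decide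
  phases = refl , refl , refl

  test-def : test ≡ ev 13 (10 ∷ 11 ∷ []) (forcedF 0F 1F)
  test-def = refl

  edgeTest-def : edgeTest ≡ ev 13 (10 ∷ 11 ∷ []) (adjF 0F 1F)
  edgeTest-def = refl

  tooManyTest-def : tooManyTest ≡ ev 13 [] tooManyF
  tooManyTest-def = refl

  badTest-def : ∀ x → badTest x ≡ ev 13 (x ∷ []) (badF 0F)
  badTest-def x = refl

  -- Registers 0 to 40 are in use; Whole k provides k + 2 of them.
  program-ok : ok 41 program ≡ true
  program-ok = refl

  test-free : free test (9 ∷ 10 ∷ 11 ∷ lows) ≡ true × puts test ≡ false
  test-free = refl , refl

  try-free : free try (1 ∷ 2 ∷ 10 ∷ 11 ∷ []) ≡ true
  try-free = refl

  scan-free : free scan (1 ∷ 2 ∷ 10 ∷ []) ≡ true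
  scan-free = refl

  rounds-free : wr rounds ZERO ≡ false × prints rounds ≡ false
  rounds-free = refl , refl

  guarded-free : free guarded (0 ∷ 1 ∷ 40 ∷ []) ≡ true
  guarded-free = refl

sem-bad : ∀ {n} (G : Graph n) θ → θ 1F ≡ 0 → ∀ v → sem G θ (badF 0F) (v ∷ []) ≡ badᵇ G v
sem-bad G θ e v rewrite e = refl

sem-tooMany : ∀ {n} (G : Graph n) θ → θ 1F ≡ 0 → sem G θ tooManyF [] ≡ (θ 7F <ᵇ cnt (badᵇ G))
sem-tooMany G θ e rewrite e = refl

sem-forced : ∀ {n} (G : Graph n) θ → θ 1F ≡ 0 → ∀ a c → sem G θ (forcedF 0F 1F) (a ∷ c ∷ []) ≡ forcedᵇ G (θ 6F) a c
sem-forced G θ e a c rewrite e = refl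

-- Correctness of parsing

module Parse {n} (G : Graph n) (k : ℕ) where

  u E : List Sym
  u = encode (inst n G k)
  E = encNat k

  B e : ℕ
  B = length u
  e = length E

  open Rules B

  B≡ : B ≡ e + suc (suc n) + n * n
  B≡ = length-code G k

  off≤B : e + suc (suc n) ≤ B
  off≤B = ≤-trans (m≤m+n _ (n * n)) (≤-reflexive (sym B≡))

  e≤B : e ≤ B
  e≤B = ≤-trans (m≤m+n e _) off≤B

  0<B : 0 < B
  0<B = ≤-trans (≤-trans (s≤s z≤n) (m≤n+m (suc (suc n)) e)) off≤B

  n≤B : n ≤ B
  n≤B = ≤-trans (≤-trans (m≤n+m n 2) (m≤n+m (suc (suc n)) e)) off≤B

  n²≤B : n * n ≤ B
  n²≤B = ≤-trans (m≤n+m (n * n) _) (≤-reflexive (sym B≡))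

  cap-+ : ∀ a w → (a + (w ⊓ B)) ⊓ B ≡ (a + w) ⊓ B
  cap-+ a w with ≤-total w B
  ... | inj₁ p = cong (λ z → (a + z) ⊓ B) (m≤n⇒m⊓n≡m p)
  ... | inj₂ p = trans (cong (λ z → (a + z) ⊓ B) (m≥n⇒m⊓n≡n p))
                   (trans (m≥n⇒m⊓n≡n (m≤n+m B a)) (sym (m≥n⇒m⊓n≡n (≤-trans p (m≤n+m w a)))))

  ifm-run : ∀ {x c p q b} s → eqSym (mem s (regs s x)) c ≡ b → ⟦ B ∣ ifm x c p q ⟧ s ≡ (if b then ⟦ B ∣ p ⟧ s else ⟦ B ∣ q ⟧ s)
  ifm-run s refl = refl

  is-digit : ∀ {j} → j < e → IsDigit (nth u j)
  is-digit p = subst IsDigit (sym (code-digit G k p)) (nth-All (encBin-digits (ℕᵇ.fromℕ k)) p)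

  not-sep : ∀ {s} → IsDigit s → eqSym s sep ≡ false
  not-sep (inj₁ refl) = refl
  not-sep (inj₂ refl) = refl

  s₀ : State
  s₀ = Whole.start-state 39 u

  Untouched : Stm → State → Set
  Untouched p s = ∀ z → wr p z ≡ false → regs s z ≡ regs s₀ z

  located : ∀ s → s ≡ s₀ → let s′ = ⟦ B ∣ locate ⟧ s in regs s′ 12 ≡ e × mem s′ ≡ nth u × Untouched locate s′
  located s refl = trans (proj₁ (proj₂ (proj₂ final))) (m≥n⇒m⊓n≡n e≤B) , proj₂ (proj₂ (proj₂ final)) , (λ z w → frame locate z s₀ w)
    where
    I : ℕ → State → Set
    I j s = regs s 13 ≡ j × regs s 0 ≡ B × regs s 12 ≡ j ⊓ e × mem s ≡ nth u
    move : (i : Fin B) (s : State) → I (toℕ i) s → I (suc (toℕ i)) (bump B 13 (⟦ B ∣ findSep ⟧ s))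
    move i s (p , q , r , m) with toℕ i <? e
    ... | yes j<e = subst (λ z → I (suc (toℕ i)) (bump B 13 z)) (sym (ifm-run {12} {sep} {nop} {inc 12} s unread))
            (bump-suc 13 (bump B 12 s) p (toℕ<n i) , q ,
             trans (bump-suc 12 s (trans r (m≤n⇒m⊓n≡m (<⇒≤ j<e))) (toℕ<n i)) (sym (m≤n⇒m⊓n≡m j<e)) , m)
      where
      unread : eqSym (mem s (regs s 12)) sep ≡ false
      unread = trans (cong₂ (λ f a → eqSym (f a) sep) m (trans r (m≤n⇒m⊓n≡m (<⇒≤ j<e)))) (not-sep (is-digit j<e))
    ... | no j≮e = subst (λ z → I (suc (toℕ i)) (bump B 13 z)) (sym (ifm-run {12} {sep} {nop} {inc 12} s found))
            (bump-suc 13 s p (toℕ<n i) , q , trans r (trans (m≥n⇒m⊓n≡n (≮⇒≥ j≮e)) (sym (m≥n⇒m⊓n≡n (m≤n⇒m≤1+n (≮⇒≥ j≮e))))) , m)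
      where
      found : eqSym (mem s (regs s 12)) sep ≡ true
      found = trans (cong₂ (λ f a → eqSym (f a) sep) m (trans r (m≥n⇒m⊓n≡n (≮⇒≥ j≮e)))) (cong (λ z → eqSym z sep) (code-sep G k))
    final : I B (⟦ B ∣ locate ⟧ s₀)
    final = loop-rule {13} {TOP} {B} findSep I (λ { (p , q , _) → p , q }) move s₀ (refl , refl , refl , refl)

  -- Both the partial value and the weight `2 ^ j` are kept capped at `B`. Since capping commutes
  -- with sums, the result is `k ⊓ B` even when `k` is exponential in the input length.
  decoded : ∀ s → regs s 12 ≡ e → mem s ≡ nth u → Untouched locate s →
            let s′ = ⟦ B ∣ decode ⟧ s in regs s′ KK ≡ k ⊓ B × regs s′ 12 ≡ e × mem s′ ≡ nth u × Untouched parseK s′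
  decoded s₁ found unchanged same =
    trans (proj₁ (proj₂ (proj₂ final))) (cong (_⊓ B) (value-encNat k)) , proj₁ (proj₂ final) , proj₂ (proj₂ (proj₂ (proj₂ final))) ,
    (λ z w → trans (frame decode z s₁ (proj₂ (∨-false (wr locate z) w))) (same z (proj₁ (∨-false (wr locate z) w))))
    where
    s₂ = bump B 14 s₁
    I : ℕ → State → Set
    I j s = regs s 15 ≡ j × regs s 12 ≡ e × regs s KK ≡ value E j ⊓ B × regs s 14 ≡ 2 ^ j ⊓ B × mem s ≡ nth u
    addWeight : ∀ {a j} s → regs s KK ≡ a ⊓ B → regs s 14 ≡ 2 ^ j ⊓ B → regs (⟦ B ∣ addTo KK 14 16 ⟧ s) KK ≡ (a + 2 ^ j) ⊓ B
    addWeight {a} {j} s p q = trans (addTo-value {KK} {14} {16} s (λ ()) (λ ()) (λ ()) p q (m⊓n≤n (2 ^ j) B)) (cap-+ a (2 ^ j))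
    read : ∀ j s → j < e → I j s → regs (⟦ B ∣ readDigit ⟧ s) KK ≡ value E (suc j) ⊓ B
    read j s j<e (p , _ , q , r , m) with is-digit j<e
    ... | inj₂ one =
      trans (cong (λ z → regs z KK) (ifm-run {15} {b1} {addTo KK 14 16} {addTo KK 14 16 ⨟ addTo KK 14 16} s
              (cong (λ z → eqSym z b1) (trans (cong₂ (λ f a → f a) m p) one))))
        (trans (addWeight {value E j} {j} s q r)
          (cong (λ z → (value E j + z) ⊓ B) (trans (sym (*-identityˡ (2 ^ j))) (cong (λ z → digit z * 2 ^ j) (trans (sym one) (code-digit G k j<e))))))
    ... | inj₁ none =
      trans (cong (λ z → regs z KK) (ifm-run {15} {b1} {addTo KK 14 16} {addTo KK 14 16 ⨟ addTo KK 14 16} s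
              (cong (λ z → eqSym z b1) (trans (cong₂ (λ f a → f a) m p) none))))
        (trans (addWeight {value E j + 2 ^ j} {j} (⟦ B ∣ addTo KK 14 16 ⟧ s) (addWeight {value E j} {j} s q r) (trans (frame (addTo KK 14 16) 14 s refl) r))
          (cong (_⊓ B) (trans (+-assoc (value E j) (2 ^ j) (2 ^ j))
            (cong (value E j +_) (trans (cong (2 ^ j +_) (sym (+-identityʳ (2 ^ j)))) (cong (λ z → digit z * 2 ^ j) (trans (sym none) (code-digit G k j<e))))))))
    move : ∀ j s → j < e → I j s → I (suc j) (bump B 15 (⟦ B ∣ readDigit ⨟ double ⟧ s))
    move j s j<e i@(p , q , r , w , m) =
      bump-suc 15 s'' (trans (frame double 15 s' refl) (trans (frame readDigit 15 s refl) p)) (≤-trans j<e e≤B) ,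
      trans (frame double 12 s' refl) (trans (frame readDigit 12 s refl) q) ,
      trans (frame double KK s' refl) (read j s j<e i) ,
      weight ,
      trans (frame-mem double s' refl) (trans (frame-mem readDigit s refl) m)
      where
      s' = ⟦ B ∣ readDigit ⟧ s
      s'' = ⟦ B ∣ double ⟧ s'
      w' : regs s' 14 ≡ 2 ^ j ⊓ B
      w' = trans (frame readDigit 14 s refl) w
      copy : regs (⟦ B ∣ clr 17 ⨟ addTo 17 14 16 ⟧ s') 17 ≡ 2 ^ j ⊓ B
      copy = trans (addTo-value {17} {14} {16} (⟦ B ∣ clr 17 ⟧ s') (λ ()) (λ ()) (λ ()) {0} refl w' (m⊓n≤n (2 ^ j) B)) (cap-+ 0 (2 ^ j))
      weight : regs s'' 14 ≡ 2 ^ suc j ⊓ B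
      weight = trans (addTo-value {14} {17} {16} (⟦ B ∣ clr 17 ⨟ addTo 17 14 16 ⟧ s') (λ ()) (λ ()) (λ ()) {2 ^ j}
                        (trans (frame (clr 17 ⨟ addTo 17 14 16) 14 s' refl) w') copy (m⊓n≤n (2 ^ j) B))
                 (trans (cap-+ (2 ^ j) (2 ^ j)) (cong (λ z → (2 ^ j + z) ⊓ B) (sym (+-identityʳ (2 ^ j)))))
    final : I e (⟦ B ∣ decode ⟧ s₁)
    final = loop-from 0 {15} {12} {e} (readDigit ⨟ double) I (λ { (p , q , _) → p , q }) move s₂
      (same 15 refl , found , same KK refl , bump-value 14 s₁ (same 14 refl) , unchanged)

  -- The ones are counted by walking `OFF` across them. It comes to rest on the second separator,
  -- and the last increment moves it to the start of the matrix.
  sized : ∀ s → regs s 12 ≡ e → mem s ≡ nth u → Untouched parseK s →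
          let s′ = ⟦ B ∣ parseN ⟧ s in regs s′ NN ≡ n × regs s′ OFF ≡ e + suc (suc n) × mem s′ ≡ nth u
  sized s₃ found unchanged early =
    trans (proj₁ (proj₂ (proj₂ (proj₂ final)))) n≤ ,
    trans (bump-suc OFF s₅ (trans (proj₁ (proj₂ (proj₂ final))) (cong (λ z → e + suc z) n≤)) (≤-trans (≤-reflexive (sym (+-suc e (suc n)))) off≤B)) (sym (+-suc e (suc n))) ,
    proj₂ (proj₂ (proj₂ (proj₂ final)))
    where
    s₄ = ⟦ B ∣ addTo OFF 12 16 ⨟ inc OFF ⟧ s₃
    s₅ = ⟦ B ∣ loop 18 TOP scanOnes ⟧ s₄
    n≤ : B ⊓ n ≡ n
    n≤ = m≥n⇒m⊓n≡n n≤B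
    I : ℕ → State → Set
    I j s = regs s 18 ≡ j × regs s 0 ≡ B × regs s OFF ≡ e + suc (j ⊓ n) × regs s NN ≡ j ⊓ n × mem s ≡ nth u
    move : ∀ j s → j < B → I j s → I (suc j) (bump B 18 (⟦ B ∣ scanOnes ⟧ s))
    move j s j<B (p , q , r , c , m) with j <? n
    ... | yes j<n = subst (λ z → I (suc j) (bump B 18 z)) (sym (ifm-run {OFF} {b1} {inc OFF ⨟ inc NN} {nop} s one))
            ( bump-suc 18 (bump B NN (bump B OFF s)) p j<B , q
            , trans (bump-suc OFF s r small) (trans (sym (+-suc e (suc (j ⊓ n)))) (cong (λ z → e + suc z) (trans (cong suc (m≤n⇒m⊓n≡m (<⇒≤ j<n))) (sym (m≤n⇒m⊓n≡m j<n)))))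
            , trans (bump-suc NN (bump B OFF s) c (≤-trans (s≤s (m⊓n≤m j n)) j<B)) (trans (cong suc (m≤n⇒m⊓n≡m (<⇒≤ j<n))) (sym (m≤n⇒m⊓n≡m j<n))) , m )
      where
      one : eqSym (mem s (regs s OFF)) b1 ≡ true
      one = trans (cong₂ (λ f a → eqSym (f a) b1) m (trans r (cong (λ z → e + suc z) (m≤n⇒m⊓n≡m (<⇒≤ j<n))))) (cong (λ z → eqSym z b1) (code-ones G k j<n))
      small : suc (e + suc (j ⊓ n)) ≤ B
      small = ≤-trans (≤-reflexive (sym (+-suc e _))) (≤-trans (+-monoʳ-≤ e (s≤s (s≤s (m⊓n≤n j n)))) off≤B)
    ... | no j≮n = subst (λ z → I (suc j) (bump B 18 z)) (sym (ifm-run {OFF} {b1} {inc OFF ⨟ inc NN} {nop} s end))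
            ( bump-suc 18 s p j<B , q , trans r (cong (λ z → e + suc z) (trans j⊓n (sym sj⊓n))) , trans c (trans j⊓n (sym sj⊓n)) , m )
      where
      j⊓n : j ⊓ n ≡ n
      j⊓n = m≥n⇒m⊓n≡n (≮⇒≥ j≮n)
      sj⊓n : suc j ⊓ n ≡ n
      sj⊓n = m≥n⇒m⊓n≡n (m≤n⇒m≤1+n (≮⇒≥ j≮n))
      end : eqSym (mem s (regs s OFF)) b1 ≡ false
      end = trans (cong₂ (λ f a → eqSym (f a) b1) m (trans r (cong (λ z → e + suc z) j⊓n))) (cong (λ z → eqSym z b1) (code-sep₂ G k))
    final : I B s₅
    final = loop-from 0 {18} {TOP} {B} scanOnes I (λ { (p , q , _) → p , q }) move s₄
      ( trans (frame (addTo OFF 12 16 ⨟ inc OFF) 18 s₃ refl) (early 18 refl)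
      , trans (frame (addTo OFF 12 16 ⨟ inc OFF) 0 s₃ refl) (early 0 refl)
      , trans (bump-suc OFF (⟦ B ∣ addTo OFF 12 16 ⟧ s₃) (addTo-exact {OFF} {12} {16} s₃ (λ ()) (λ ()) (λ ()) {0} (early OFF refl) found e≤B)
                (≤-trans (≤-reflexive (+-comm 1 e)) (≤-trans (+-monoʳ-≤ e (s≤s z≤n)) off≤B)))
              (+-comm 1 e)
      , trans (frame (addTo OFF 12 16 ⨟ inc OFF) NN s₃ refl) (early NN refl)
      , trans (frame-mem (addTo OFF 12 16 ⨟ inc OFF) s₃ refl) unchanged )

  record Parsed (s : State) : Set where
    field
      n-read : regs s NN ≡ n
      off-read : regs s OFF ≡ e + suc (suc n)
      k-read : regs s KK ≡ k ⊓ B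
      mem-kept : mem s ≡ nth u
      untouched : Untouched parse s
      silent : out s ≡ []

  sizes : ∀ s → regs s KK ≡ k ⊓ B → regs s 12 ≡ e → mem s ≡ nth u → Untouched parseK s → out s ≡ [] → Parsed (⟦ B ∣ parseN ⟧ s)
  sizes s kk found unchanged same quiet = record
    { n-read = proj₁ r ; off-read = proj₁ (proj₂ r) ; mem-kept = proj₂ (proj₂ r)
    ; k-read = trans (frame parseN KK s refl) kk
    ; untouched = λ z w → trans (frame parseN z s (proj₂ (∨-false (wr parseK z) w))) (same z (proj₁ (∨-false (wr parseK z) w)))
    ; silent = trans (frame-out parseN s refl) quiet }
    where
    r = sized s found unchanged same

  run-parse : ∀ {p} → p ≡ (locate ⨟ decode) ⨟ parseN → Parsed (⟦ B ∣ p ⟧ s₀)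
  run-parse {p} q = in-order q
    (let (a , b , c) = located s₀ refl
         (d , e′ , f , g) = decoded (⟦ B ∣ locate ⟧ s₀) a b c
     in sizes (⟦ B ∣ decode ⟧ (⟦ B ∣ locate ⟧ s₀)) d e′ f g
          (trans (frame-out decode (⟦ B ∣ locate ⟧ s₀) refl) (frame-out locate s₀ refl)))
    where
    in-order : ∀ {p a b c s} → p ≡ (a ⨟ b) ⨟ c → Parsed (⟦ B ∣ c ⟧ (⟦ B ∣ b ⟧ (⟦ B ∣ a ⟧ s))) → Parsed (⟦ B ∣ p ⟧ s)
    in-order refl r = r

-- Correctness of the forcing rounds

module Reduce {n} (B : ℕ) (0<B : 0 < B) (n≤B : n ≤ B) (off : ℕ) (fits : off + n * n ≤ B) (κ : ℕ) (κ≤B : κ ≤ B) where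

  open Rules B

  θ : ℕ → ℕ → ℕ → Fin 8 → ℕ
  θ f t h = Vec.lookup (B ∷ 0 ∷ n ∷ off ∷ κ ∷ f ∷ t ∷ h ∷ [])

  module Ev (G : Graph n) (f t h : ℕ) = Eval B 0<B n≤B G (θ f t h) refl refl fits

  record S (G : Graph n) (f t h : ℕ) (s : State) : Set where
    constructor mkS
    field
      holds : Holds G (θ f t h) s
      clean : regs s NO ≡ 0
  open S public

  Quiet : Stm → Set
  Quiet p = free p lows ≡ true × puts p ≡ false

  quiet-reg : ∀ p → Quiet p → ∀ (z : Fin 9) s → regs (⟦ B ∣ p ⟧ s) (Vec.lookup lows z) ≡ regs s (Vec.lookup lows z)
  quiet-reg p q z s = frame p _ s (free-wr p lows (proj₁ q) z)

  S-keep : ∀ {G f t h s} p → Quiet p → S G f t h s → S G f t h (⟦ B ∣ p ⟧ s)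
  S-keep {s = s} p q (mkS e clean) = mkS (record
    { reg = λ τ → trans (low τ) (reg e τ)
    ; adjacency = λ i j → trans (cong (λ m → m (off + (toℕ i * n + toℕ j))) (frame-mem p s (proj₂ q))) (adjacency e i j) }) 
    (trans (quiet-reg p q 8F s) clean)
    where
    low : ∀ τ → regs (⟦ B ∣ p ⟧ s) (toℕ τ) ≡ regs s (toℕ τ)
    low 0F = quiet-reg p q 0F s
    low 1F = quiet-reg p q 1F s
    low 2F = quiet-reg p q 2F s
    low 3F = quiet-reg p q 3F s
    low 4F = quiet-reg p q 4F s
    low 5F = quiet-reg p q 5F s
    low 6F = quiet-reg p q 6F s
    low 7F = quiet-reg p q 7F s

  cap2 : ℕ → ℕ
  cap2 f = ((κ ∸ f) + (κ ∸ f)) ⊓ B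

  setT2-correct : ∀ {G f t h s} → f ≤ κ → S G f t h s → S G f (cap2 f) h (⟦ B ∣ setT2 ⟧ s)
  setT2-correct {G} {f} {t} {h} {s} f≤κ (mkS e clean) = mkS (record { reg = λ
      { 0F → same 0F refl ; 1F → same 1F refl ; 2F → same 2F refl ; 3F → same 3F refl ; 4F → same 4F refl
      ; 5F → same 5F refl ; 6F → proj₂ (proj₂ final) ; 7F → same 7F refl }
    ; adjacency = λ i j → trans (cong (λ m → m (off + (toℕ i * n + toℕ j))) (frame-mem setT2 s refl)) (adjacency e i j) }) 
    (trans (frame setT2 8 s refl) clean)
    where
    same : (τ : Fin 8) → wr setT2 (toℕ τ) ≡ false → regs (⟦ B ∣ setT2 ⟧ s) (toℕ τ) ≡ θ f t h τ
    same τ w = trans (frame setT2 (toℕ τ) s w) (reg e τ)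
    s₁ = ⟦ B ∣ clr T2 ⨟ clr 13 ⨟ addTo 13 FF 14 ⟧ s
    I : ℕ → State → Set
    I j s = regs s 13 ≡ f + j × regs s KK ≡ f + (κ ∸ f) × regs s T2 ≡ (j + j) ⊓ B
    move : ∀ j s → j < κ ∸ f → I j s → I (suc j) (bump B 13 (⟦ B ∣ inc T2 ⨟ inc T2 ⟧ s))
    move j s p (a , b , c) =
      trans (bump-suc 13 (⟦ B ∣ inc T2 ⨟ inc T2 ⟧ s) a (≤-trans (≤-trans (≤-reflexive (sym (+-suc f j))) (+-monoʳ-≤ f p)) (≤-trans (≤-reflexive (m+[n∸m]≡n f≤κ)) κ≤B))) (sym (+-suc f j)) ,
      b ,
      trans (bump-value T2 (bump B T2 s) (trans (bump-value T2 s c) (capped-suc (j + j))))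
        (trans (capped-suc (suc (j + j))) (cong (λ z → suc z ⊓ B) (sym (+-suc j j))))
    final : I (κ ∸ f) (⟦ B ∣ setT2 ⟧ s)
    final = loop-from f (inc T2 ⨟ inc T2) I (λ { (a , b , _) → a , b }) move s₁
      ( trans (addTo-exact {13} {FF} {14} (⟦ B ∣ clr T2 ⨟ clr 13 ⟧ s) (λ ()) (λ ()) (λ ()) {0} refl (reg e 5F) (≤-trans f≤κ κ≤B)) (sym (+-identityʳ f))
      , trans (frame (clr T2 ⨟ clr 13 ⨟ addTo 13 FF 14) KK s refl) (trans (reg e 4F) (sym (m+[n∸m]≡n f≤κ)))
      , frame (clr 13 ⨟ addTo 13 FF 14) T2 (⟦ B ∣ clr T2 ⟧ s) refl )

  setTHR-correct : ∀ {G f t h s} → t ≤ B → S G f t h s → S G f t ((t * t + t) ⊓ B) (⟦ B ∣ setTHR ⟧ s)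
  setTHR-correct {G} {f} {t} {h} {s} t≤B (mkS e clean) = mkS (record { reg = λ
      { 0F → same 0F refl ; 1F → same 1F refl ; 2F → same 2F refl ; 3F → same 3F refl ; 4F → same 4F refl
      ; 5F → same 5F refl ; 6F → same 6F refl
      ; 7F → addTo-value {THR} {T2} {14} s₂ (λ ()) (λ ()) (λ ()) (proj₂ (proj₂ final)) (proj₁ (proj₂ final)) t≤B }
    ; adjacency = λ i j → trans (cong (λ m → m (off + (toℕ i * n + toℕ j))) (frame-mem setTHR s refl)) (adjacency e i j) }) 
    (trans (frame setTHR 8 s refl) clean)
    where
    same : (τ : Fin 8) → wr setTHR (toℕ τ) ≡ false → regs (⟦ B ∣ setTHR ⟧ s) (toℕ τ) ≡ θ f t h τ
    same τ w = trans (frame setTHR (toℕ τ) s w) (reg e τ)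
    s₁ = ⟦ B ∣ clr THR ⨟ clr 13 ⟧ s
    s₂ = ⟦ B ∣ loop 13 T2 (addTo THR T2 14) ⟧ s₁
    I : ℕ → State → Set
    I j s = regs s 13 ≡ j × regs s T2 ≡ t × regs s THR ≡ (j * t) ⊓ B
    move : ∀ j s → j < t → I j s → I (suc j) (bump B 13 (⟦ B ∣ addTo THR T2 14 ⟧ s))
    move j s p (a , b , c) =
      bump-suc 13 (⟦ B ∣ addTo THR T2 14 ⟧ s) (trans (frame (addTo THR T2 14) 13 s refl) a) (≤-trans p t≤B) ,
      trans (frame (addTo THR T2 14) T2 s refl) b ,
      trans (addTo-value {THR} {T2} {14} s (λ ()) (λ ()) (λ ()) c b t≤B) (cong (_⊓ B) (+-comm (j * t) t))
    final : I t s₂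
    final = loop-from 0 (addTo THR T2 14) I (λ { (a , b , _) → a , b }) move s₁ (refl , reg e 6F , refl)

  data Out (G : Graph n) (f t h : ℕ) (s : State) : Set where
    added  : ∀ a c (fr : forcedᵇ G t a c ≡ true) → f < κ → S (addEdge G a c (forced⇒≢ G {t} fr)) (suc f) t h s → Out G f t h s
    failed : ∀ a c → forcedᵇ G t a c ≡ true → κ ≤ f → 0 < regs s NO → Out G f t h s

  Out-keep : ∀ {G f t h s} p → Quiet p → Out G f t h s → Out G f t h (⟦ B ∣ p ⟧ s)
  Out-keep p q (added a c fr f<κ r) = added a c fr f<κ (S-keep p q r)
  Out-keep {s = s} p q (failed a c fr κ≤f pos) = failed a c fr κ≤f (subst (0 <_) (sym (quiet-reg p q 8F s)) pos)

  cell-address : ∀ (i j a c : Fin n) → toℕ i * n + toℕ j ≡ toℕ a * n + toℕ c → i ≡ a × j ≡ c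
  cell-address i j a c e = Fin.combine-injective i j a c (toℕ-injective
    (trans (Fin.toℕ-combine i j) (trans (cong (_+ toℕ j) (*-comm n (toℕ i))) (trans e
      (trans (cong (_+ toℕ c) (*-comm (toℕ a) n)) (sym (Fin.toℕ-combine a c)))))))

  -- Different pairs have different addresses, by injectivity of `Fin.combine`. The right side is
  -- the form in which `addEdge` tests a pair, so writing two cells yields exactly its adjacency
  -- matrix.
  address-test : ∀ (i j a c : Fin n) → ((off + (toℕ i * n + toℕ j)) ≡ᵇ (off + (toℕ a * n + toℕ c))) ≡ eqᵇ c j ∧ eqᵇ a i
  address-test i j a c with c Fin.≟ j | a Fin.≟ i
  ... | yes refl | yes refl = ≡ᵇ-refl (off + (toℕ i * n + toℕ j))
  ... | no c≢j | q = ≡ᵇ-false _ _ (λ e → c≢j (sym (proj₂ (cell-address i j a c (+-cancelˡ-≡ off _ _ e)))))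
  ... | yes _ | no a≢i = ≡ᵇ-false _ _ (λ e → a≢i (sym (proj₁ (cell-address i j a c (+-cancelˡ-≡ off _ _ e)))))

  hit-correct : ∀ {G f t h s a c} (fr : forcedᵇ G t a c ≡ true) → S G f t h s → regs s 10 ≡ toℕ a → regs s 11 ≡ toℕ c → regs s FOUND ≡ 0 →
                f ≤ κ → regs (⟦ B ∣ hit′ ⟧ s) FOUND ≡ 1 × Out G f t h (⟦ B ∣ hit′ ⟧ s)
  hit-correct {G} {f} {t} {h} {s} {a} {c} fr (mkS e clean) ea ec ef f≤κ =
    trans (frame (ifl FF KK addEdgeS (inc NO)) FOUND s₁ refl) (bump-suc FOUND s ef 0<B) ,
    branch (f <ᵇ κ) refl
    where
    s₁ = bump B FOUND s
    s₂ = ⟦ B ∣ addr 13 10 11 ⟧ s₁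
    s₃ = ⟦ B ∣ put 13 ⟧ s₂
    s₄ = ⟦ B ∣ addr 13 11 10 ⟧ s₃
    s₅ = ⟦ B ∣ put 13 ⟧ s₄
    s₆ = bump B FF s₅
    a≢c = forced⇒≢ G {t} fr
    8≤13 : 8 ≤ 13
    8≤13 = m≤m+n 8 5
    first : regs s₂ 13 ≡ off + (toℕ a * n + toℕ c)
    first = Ev.addr-value G f t h {13} {10} {11} {s₁} a c 8≤13 (m≤m+n 11 2) (m≤m+n 12 1) (reg e 2F) (reg e 3F) ea ec
    second : regs s₄ 13 ≡ off + (toℕ c * n + toℕ a)
    second = Ev.addr-value G f t h {13} {11} {10} {s₃} c a 8≤13 (m≤m+n 12 1) (m≤m+n 11 2)
      (trans (frame (addr 13 10 11) 2 s₁ refl) (reg e 2F)) (trans (frame (addr 13 10 11) 3 s₁ refl) (reg e 3F))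
      (trans (frame (addr 13 10 11) 11 s₁ refl) ec) (trans (frame (addr 13 10 11) 10 s₁ refl) ea)
    memory : ∀ p → mem s₆ p ≡ (if p ≡ᵇ (off + (toℕ c * n + toℕ a)) then b1 else (if p ≡ᵇ (off + (toℕ a * n + toℕ c)) then b1 else mem s p))
    memory p = cong₂ (λ x y → if p ≡ᵇ x then b1 else y) second
      (trans (cong (λ m → m p) (frame-mem (addr 13 11 10) s₃ refl))
        (cong₂ (λ x y → if p ≡ᵇ x then b1 else y) first (cong (λ m → m p) (frame-mem (addr 13 10 11) s₁ refl))))
    pair : ∀ x y g → (if x then b1 else (if y then b1 else bit g)) ≡ bit (g ∨ (y ∨ x))
    pair true  true  true  = refl
    pair true  true  false = refl
    pair true  false true  = refl
    pair true  false false = refl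
    pair false true  true  = refl
    pair false true  false = refl
    pair false false true  = refl
    pair false false false = refl
    low : ∀ z → wr (addr 13 10 11 ⨟ put 13 ⨟ addr 13 11 10 ⨟ put 13) z ≡ false → regs s₅ z ≡ regs s₁ z
    low z w = frame (addr 13 10 11 ⨟ put 13 ⨟ addr 13 11 10 ⨟ put 13) z s₁ w
    grown : f < κ → S (addEdge G a c a≢c) (suc f) t h s₆
    grown f<κ = mkS (record { reg = λ
        { 0F → trans (low 0 refl) (reg e 0F) ; 1F → trans (low 1 refl) (reg e 1F) ; 2F → trans (low 2 refl) (reg e 2F)
        ; 3F → trans (low 3 refl) (reg e 3F) ; 4F → trans (low 4 refl) (reg e 4F)
        ; 5F → bump-suc FF s₅ (trans (low 5 refl) (reg e 5F)) (≤-trans f<κ κ≤B)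
        ; 6F → trans (low 6 refl) (reg e 6F) ; 7F → trans (low 7 refl) (reg e 7F) }
      ; adjacency = λ i j → trans (memory (off + (toℕ i * n + toℕ j)))
          (trans (cong₂ (λ x y → if x then b1 else y) (address-test i j c a)
                   (cong₂ (λ x y → if x then b1 else y) (address-test i j a c) (adjacency e i j)))
                 (pair (eqᵇ a j ∧ eqᵇ c i) (eqᵇ c j ∧ eqᵇ a i) (adj G i j))) })
      (trans (low 8 refl) clean)
    branch : ∀ b → (f <ᵇ κ) ≡ b → Out G f t h (⟦ B ∣ hit′ ⟧ s)
    branch true q = subst (Out G f t h)
      (sym (Ev.ifl-run G f t h {FF} {KK} {addEdgeS} {inc NO} {true} s₁ (trans (cong₂ _<ᵇ_ (reg e 5F) (reg e 4F)) q)))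
      (added a c fr (<ᵇ-true {f} q) (grown (<ᵇ-true {f} q)))
    branch false q = subst (Out G f t h)
      (sym (Ev.ifl-run G f t h {FF} {KK} {addEdgeS} {inc NO} {false} s₁ (trans (cong₂ _<ᵇ_ (reg e 5F) (reg e 4F)) q)))
      (failed a c fr (<ᵇ-false {f} q) (subst (0 <_) (sym (bump-suc NO s₁ clean 0<B)) (s≤s z≤n)))

  -- `C` records which pairs have been found not forced. It is kept only while the search is idle:
  -- after a hit the graph in memory may have changed, and the remaining tries do nothing.
  data Prog (G : Graph n) (f t h : ℕ) (C : Set) (s : State) : Set where
    idle : regs s FOUND ≡ 0 → S G f t h s → C → Prog G f t h C s
    busy : regs s FOUND ≡ 1 → Out G f t h s → Prog G f t h C s

  Prog-keep : ∀ {G f t h C s} p → Quiet p → wr p FOUND ≡ false → Prog G f t h C s → Prog G f t h C (⟦ B ∣ p ⟧ s)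
  Prog-keep {s = s} p q w (idle e r c) = idle (trans (frame p FOUND s w) e) (S-keep p q r) c
  Prog-keep {s = s} p q w (busy e o)   = busy (trans (frame p FOUND s w) e) (Out-keep p q o)

  ifl-run : ∀ {x y b} p q s → (regs s x <ᵇ regs s y) ≡ b → ⟦ B ∣ ifl x y p q ⟧ s ≡ (if b then ⟦ B ∣ p ⟧ s else ⟦ B ∣ q ⟧ s)
  ifl-run p q s refl = refl

  test-keeps : ∀ i s → regs (⟦ B ∣ test ⟧ s) (Vec.lookup (9 ∷ 10 ∷ 11 ∷ lows) i) ≡ regs s (Vec.lookup (9 ∷ 10 ∷ 11 ∷ lows) i)
  test-keeps i s = frame test _ s (free-wr test (9 ∷ 10 ∷ 11 ∷ lows) (proj₁ test-free) i)

  test-quiet : Quiet test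
  test-quiet = ∧-conicalʳ (not (wr test 11)) _ (∧-conicalʳ (not (wr test 10)) _ (∧-conicalʳ (not (wr test 9)) _ (proj₁ test-free))) , proj₂ test-free

  test-value : ∀ {G f t h s a c} → regs s 10 ≡ toℕ a → regs s 11 ≡ toℕ c → S G f t h s →
               regs (⟦ B ∣ test ⟧ s) 13 ≡ b2n (forcedᵇ G t a c)
  test-value {G} {f} {t} {h} {s} {a} {c} ea ec r =
    Ev.verdict G f t h (forcedF 0F 1F) 13 (10 ∷ 11 ∷ []) (a ∷ c ∷ []) test-def (sem-forced G (θ f t h) refl a c) (m≤m+n 8 5) (holds r)
      (λ { 0F → m≤m+n 11 2 , ea ; 1F → m≤m+n 12 1 , ec })

  try-correct : ∀ {G f t h s C a c} → f ≤ κ → regs s 10 ≡ toℕ a → regs s 11 ≡ toℕ c → regs s ZERO ≡ 0 →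
                Prog G f t h C s → Prog G f t h (C × forcedᵇ G t a c ≡ false) (⟦ B ∣ try ⟧ s)
  try-correct {s = s} f≤κ ea ec ez (busy e o) =
    subst (Prog _ _ _ _ _) (sym (ifl-run nop (test ⨟ ifFlag hit′ nop) s (cong₂ _<ᵇ_ ez e))) (busy e o)
  try-correct {G} {f} {t} {h} {s} {C} {a} {c} f≤κ ea ec ez (idle e (mkS en no′) sofar) =
    subst (Prog G f t h (C × forcedᵇ G t a c ≡ false))
      (sym (trans (ifl-run nop (test ⨟ ifFlag hit′ nop) s (cong₂ _<ᵇ_ ez e)) (Ev.flag-run G f t h {13} {forcedᵇ G t a c} hit′ nop s₁ (holds r₁) verdict)))
      (branch (forcedᵇ G t a c) refl)
    where
    s₁ = ⟦ B ∣ test ⟧ s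
    r₁ : S G f t h s₁
    r₁ = S-keep test test-quiet (mkS en no′)
    verdict : regs s₁ 13 ≡ b2n (forcedᵇ G t a c)
    verdict = test-value {a = a} {c} ea ec (mkS en no′)
    branch : ∀ b → forcedᵇ G t a c ≡ b → Prog G f t h (C × forcedᵇ G t a c ≡ false) (if b then ⟦ B ∣ hit′ ⟧ s₁ else s₁)
    branch false q = idle (trans (test-keeps 0F s) e) r₁ (sofar , q)
    branch true  q = let (p , o) = hit-correct q r₁ (trans (test-keeps 1F s) ea) (trans (test-keeps 2F s) ec) (trans (test-keeps 0F s) e) f≤κ
                     in busy p o

  Prog-map : ∀ {G f t h s} {C C' : Set} → (C → C') → Prog G f t h C s → Prog G f t h C' s
  Prog-map g (idle e r c) = idle e r (g c)
  Prog-map g (busy e o)   = busy e o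

  extend : {P : Fin n → Set} (i : Fin n) → (∀ j → toℕ j < toℕ i → P j) → P i → ∀ j → toℕ j < suc (toℕ i) → P j
  extend {P} i below at j (s≤s p) with m≤n⇒m<n∨m≡n p
  ... | inj₁ q = below j q
  ... | inj₂ q = subst P (toℕ-injective (sym q)) at

  scan-correct : ∀ {G f t h s C a} → f ≤ κ → regs s 10 ≡ toℕ a → regs s NN ≡ n → regs s ZERO ≡ 0 →
                 Prog G f t h C s → Prog G f t h (C × (∀ c → forcedᵇ G t a c ≡ false)) (⟦ B ∣ scan ⟧ s)
  scan-correct {G} {f} {t} {h} {s} {C} {a} f≤κ ea en ez r =
    Prog-map (λ { (x , y) → x , λ c → y c (toℕ<n c) }) (proj₂ (proj₂ (proj₂ (proj₂ final))))
    where
    I : ℕ → State → Set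
    I j s = regs s 11 ≡ j × regs s NN ≡ n × regs s 10 ≡ toℕ a × regs s ZERO ≡ 0 ×
            Prog G f t h (C × (∀ c → toℕ c < j → forcedᵇ G t a c ≡ false)) s
    move : (c : Fin n) (s : State) → I (toℕ c) s → I (suc (toℕ c)) (bump B 11 (⟦ B ∣ try ⟧ s))
    move c s (e₁ , e₂ , e₃ , e₄ , r) =
      bump-suc 11 (⟦ B ∣ try ⟧ s) (trans (frame try 11 s (free-wr try (1 ∷ 2 ∷ 10 ∷ 11 ∷ []) try-free 3F)) e₁) (≤-trans (toℕ<n c) n≤B) ,
      trans (frame try NN s (free-wr try (1 ∷ 2 ∷ 10 ∷ 11 ∷ []) try-free 1F)) e₂ , trans (frame try 10 s (free-wr try (1 ∷ 2 ∷ 10 ∷ 11 ∷ []) try-free 2F)) e₃ , trans (frame try ZERO s (free-wr try (1 ∷ 2 ∷ 10 ∷ 11 ∷ []) try-free 0F)) e₄ ,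
      Prog-keep {s = ⟦ B ∣ try ⟧ s} (inc 11) (refl , refl) refl
        (Prog-map (λ { ((x , y) , z) → x , extend c y z }) (try-correct {a = a} {c} f≤κ e₃ e₁ e₄ r))
    final : I n (⟦ B ∣ scan ⟧ s)
    final = loop-rule {11} {NN} {n} try I (λ { (e₁ , e₂ , _) → e₁ , e₂ }) move (⟦ B ∣ clr 11 ⟧ s)
      (refl , en , ea , ez , Prog-keep {s = s} (clr 11) (refl , refl) refl (Prog-map (λ x → x , λ c ()) r))

  search-correct : ∀ {G f t h s} → f ≤ κ → S G f t h s → Prog G f t h (∀ a c → forcedᵇ G t a c ≡ false) (⟦ B ∣ search ⟧ s)
  search-correct {G} {f} {t} {h} {s} f≤κ r = Prog-map (λ x a → x a (toℕ<n a)) (proj₂ (proj₂ (proj₂ final)))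
    where
    I : ℕ → State → Set
    I j s = regs s 10 ≡ j × regs s NN ≡ n × regs s ZERO ≡ 0 ×
            Prog G f t h (∀ a → toℕ a < j → ∀ c → forcedᵇ G t a c ≡ false) s
    move : (a : Fin n) (s : State) → I (toℕ a) s → I (suc (toℕ a)) (bump B 10 (⟦ B ∣ scan ⟧ s))
    move a s (e₁ , e₂ , e₃ , r) =
      bump-suc 10 (⟦ B ∣ scan ⟧ s) (trans (frame scan 10 s (free-wr scan (1 ∷ 2 ∷ 10 ∷ []) scan-free 2F)) e₁) (≤-trans (toℕ<n a) n≤B) ,
      trans (frame scan NN s (free-wr scan (1 ∷ 2 ∷ 10 ∷ []) scan-free 1F)) e₂ , trans (frame scan ZERO s (free-wr scan (1 ∷ 2 ∷ 10 ∷ []) scan-free 0F)) e₃ ,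
      Prog-keep {s = ⟦ B ∣ scan ⟧ s} (inc 10) (refl , refl) refl (Prog-map (λ { (x , y) → extend a x y }) (scan-correct {a = a} f≤κ e₁ e₂ e₃ r))
    s₁ = ⟦ B ∣ clr FOUND ⨟ clr 10 ⟧ s
    r₁ : S G f t h s₁
    r₁ = S-keep {s = s} (clr FOUND ⨟ clr 10) (refl , refl) r
    final : I n (⟦ B ∣ search ⟧ s)
    final = loop-rule {10} {NN} {n} scan I (λ { (e₁ , e₂ , _) → e₁ , e₂ }) move s₁
      (refl , reg (holds r₁) 2F , reg (holds r₁) 1F , idle refl r₁ (λ a ()))

  data Live (G₀ : Graph n) (Done : Graph n → ℕ → Set) (s : State) : Set where
    lost : 0 < regs s NO → ¬ Sol G₀ κ → Live G₀ Done s
    live : ∀ G f t h → S G f t h s → f ≤ κ → (Sol G₀ κ → Sol G (κ ∸ f)) → (Sol G (κ ∸ f) → Sol G₀ κ) → Done G f → Live G₀ Done s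

  Live-keep : ∀ {G₀ D s} p → Quiet p → Live G₀ D s → Live G₀ D (⟦ B ∣ p ⟧ s)
  Live-keep {s = s} p q (lost pos no-sol) = lost (subst (0 <_) (sym (quiet-reg p q 8F s)) pos) no-sol
  Live-keep p q (live G f t h r f≤κ to from d) = live G f t h (S-keep p q r) f≤κ to from d

  Stable : Graph n → ℕ → Set
  Stable G f = ∀ a c → forcedᵇ G (cap2 f) a c ≡ false

  -- The progress measure: a round that finds the graph not stable adds an edge or ends the search
  -- for good.
  Rounds : ℕ → Graph n → ℕ → Set
  Rounds j G f = Stable G f ⊎ j ≤ f

  -- A count is at most `n ≤ B`, so one that exceeds a threshold capped at `B` exceeds the threshold
  -- itself.
  uncap : ∀ {x c} → x ⊓ B < c → c ≤ B → x < c
  uncap {x} p c≤B with ≤-total x B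
  ... | inj₁ q = subst (_< _) (m≤n⇒m⊓n≡m q) p
  ... | inj₂ q = contradiction (subst (_< _) (m≥n⇒m⊓n≡n q) p) (≤⇒≯ c≤B)

  guarded-correct : ∀ {G₀ j s} → regs s ZERO ≡ 0 → Live G₀ (Rounds j) s → Live G₀ (Rounds (suc j)) (⟦ B ∣ guarded ⟧ s)
  guarded-correct {G₀} {j} {s} ez (lost pos no-sol) =
    subst (Live G₀ (Rounds (suc j))) (sym (ifl-run nop round s (trans (cong (_<ᵇ regs s NO) ez) (<⇒<ᵇ-true pos)))) (lost pos no-sol)
  guarded-correct {G₀} {j} {s} ez (live G f t h r f≤κ to from d) =
    subst (Live G₀ (Rounds (suc j))) (sym (ifl-run nop round s (cong₂ _<ᵇ_ ez (clean r)))) (finish (search-correct f≤κ (setT2-correct f≤κ r)))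
    where
    many : ∀ a c → forcedᵇ G (cap2 f) a c ≡ true → (κ ∸ f) + (κ ∸ f) < cnt (partᵇ G a c)
    many a c fr = uncap (forced⇒many G {cap2 f} {a} {c} fr) (≤-trans (cnt≤n (partᵇ G a c)) n≤B)
    counted : ∀ a c → forcedᵇ G (cap2 f) a c ≡ true → j ≤ f
    counted a c fr = Sum.[ (λ stable → ⊥-elim (true≢false fr (stable a c))) , id ]′ d
    finish : ∀ {s} → Prog G f (cap2 f) h (Stable G f) s → Live G₀ (Rounds (suc j)) s
    finish (idle _ r stable) = live G f (cap2 f) h r f≤κ to from (inj₁ stable)
    -- The budget is used up, so `κ ∸ f` is 0, and at budget 0 any partner of the pair excludes a
    -- solution.
    finish (busy _ (failed a c fr κ≤f pos)) = lost pos (λ s →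
      forced-zero G {a} {c} (≤-trans (s≤s z≤n) (many a c fr)) (subst (Sol G) (m≤n⇒m∸n≡0 κ≤f) (to s)))
    finish (busy _ (added a c fr f<κ r)) = live (addEdge G a c a≢c) (suc f) (cap2 f) h r f<κ
      (λ s → forced-down G a≢c (subst (λ z → z + z < cnt (partᵇ G a c)) (suc-∸ f<κ) (many a c fr)) (subst (Sol G) (suc-∸ f<κ) (to s)))
      (λ s → from (subst (Sol G) (sym (suc-∸ f<κ)) (forced-up G a≢c (forced⇒nonEdge G {cap2 f} {a} {c} fr) s)))
      (inj₂ (s≤s (counted a c fr)))
      where
      a≢c = forced⇒≢ G {cap2 f} fr

  rounds-correct : ∀ {G₀ s} → regs s 40 ≡ 0 → S G₀ 0 0 0 s → Live G₀ Stable (⟦ B ∣ rounds ⟧ s)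
  rounds-correct {G₀} {s} e r = settle (proj₂ (proj₂ (proj₂ final)))
    where
    I : ℕ → State → Set
    I j s = regs s 40 ≡ j × regs s TOP ≡ B × regs s ZERO ≡ 0 × Live G₀ (Rounds (suc j)) s
    move : ∀ j s → j < B → I j s → I (suc j) (bump B 40 (⟦ B ∣ guarded ⟧ s))
    move j s j<B (e₁ , e₂ , e₃ , l) =
      bump-suc 40 (⟦ B ∣ guarded ⟧ s) (trans (frame guarded 40 s (free-wr guarded (0 ∷ 1 ∷ 40 ∷ []) guarded-free 2F)) e₁) j<B ,
      trans (frame guarded TOP s (free-wr guarded (0 ∷ 1 ∷ 40 ∷ []) guarded-free 0F)) e₂ , trans (frame guarded ZERO s (free-wr guarded (0 ∷ 1 ∷ 40 ∷ []) guarded-free 1F)) e₃ ,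
      Live-keep {s = ⟦ B ∣ guarded ⟧ s} (inc 40) (refl , refl) (guarded-correct e₃ l)
    final : I B (⟦ B ∣ rounds ⟧ s)
    final = loop-from 0 {40} {TOP} {B} guarded I (λ { (e₁ , e₂ , _) → e₁ , e₂ }) move (⟦ B ∣ guarded ⟧ s)
      ( trans (frame guarded 40 s (free-wr guarded (0 ∷ 1 ∷ 40 ∷ []) guarded-free 2F)) e , trans (frame guarded TOP s (free-wr guarded (0 ∷ 1 ∷ 40 ∷ []) guarded-free 0F)) (reg (holds r) 0F) , trans (frame guarded ZERO s (free-wr guarded (0 ∷ 1 ∷ 40 ∷ []) guarded-free 1F)) (reg (holds r) 1F)
      , guarded-correct (reg (holds r) 1F) (live G₀ 0 0 0 r z≤n id id (inj₂ z≤n)) )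
    settle : ∀ {s} → Live G₀ (Rounds (suc B)) s → Live G₀ Stable s
    settle (lost pos no-sol) = lost pos no-sol
    settle (live G f t h r f≤κ to from (inj₁ st)) = live G f t h r f≤κ to from st
    -- Otherwise every round would have added an edge, `B + 1` in all, more than the budget `κ ≤ B`
    -- allows.
    settle (live G f t h r f≤κ to from (inj₂ p)) = contradiction (≤-trans p (≤-trans f≤κ κ≤B)) 1+n≰n

-- Correctness of the verdict and of the printed kernel

module Output {n} (B : ℕ) (0<B : 0 < B) (n≤B : n ≤ B) (off : ℕ) (fits : off + n * n ≤ B) (κ : ℕ) (κ≤B : κ ≤ B) where

  open Rules B
  open Reduce B 0<B n≤B off fits κ κ≤B

  emitList-out : ∀ v s → out (⟦ B ∣ emitList v ⟧ s) ≡ out s ++ v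
  emitList-out []      s = sym (List.++-identityʳ (out s))
  emitList-out (c ∷ v) s = trans (emitList-out v (⟦ B ∣ emit c ⟧ s)) (List.++-assoc (out s) (c ∷ []) v)

  module _ {G : Graph n} {f t h : ℕ} where

    private
      Sound : State → Set
      Sound = S G f t h

    halve-correct : ∀ {v} s → regs s 13 ≡ suc v → suc v ≤ B → regs s ZERO ≡ 0 →
                    ∃ λ par → ∃ λ half → regs (⟦ B ∣ halve ⟧ s) 15 ≡ half × regs (⟦ B ∣ halve ⟧ s) 16 ≡ b2n par × v ≡ b2n par + 2 * half
    halve-correct {v} s e v<B ez = let (_ , _ , _ , par , half , a , b , c) = final in par , half , a , b , c
      where
      item : Stm
      item = ifl ZERO 16 (clr 16 ⨟ inc 15) (inc 16)
      s₁ = ⟦ B ∣ clr 15 ⨟ clr 16 ⨟ clr 17 ⨟ inc 17 ⟧ s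
      I : ℕ → State → Set
      I j s = regs s 17 ≡ 1 + j × regs s 13 ≡ 1 + v × regs s ZERO ≡ 0 ×
              ∃ λ par → ∃ λ half → regs s 15 ≡ half × regs s 16 ≡ b2n par × j ≡ b2n par + 2 * half
      move : ∀ j s → j < v → I j s → I (suc j) (bump B 17 (⟦ B ∣ item ⟧ s))
      move j s j<v (e₁ , e₂ , e₃ , true , half , a , b , c) =
        subst (λ z → I (suc j) (bump B 17 z)) (sym (ifl-run (clr 16 ⨟ inc 15) (inc 16) s (cong₂ _<ᵇ_ e₃ b)))
          ( bump-suc 17 (⟦ B ∣ clr 16 ⨟ inc 15 ⟧ s) e₁ (≤-trans (s≤s j<v) v<B) , e₂ , e₃ , false , suc half
          , bump-suc 15 (⟦ B ∣ clr 16 ⟧ s) a (≤-trans (s≤s (≤-trans (m≤m+n half _) (≤-trans (n≤1+n _) (≤-reflexive (sym c))))) (≤-trans j<v (<⇒≤ v<B)))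
          , refl , trans (cong suc c) (sym (*-suc 2 half)) )
      move j s j<v (e₁ , e₂ , e₃ , false , half , a , b , c) =
        subst (λ z → I (suc j) (bump B 17 z)) (sym (ifl-run (clr 16 ⨟ inc 15) (inc 16) s (cong₂ _<ᵇ_ e₃ b)))
          ( bump-suc 17 (⟦ B ∣ inc 16 ⟧ s) e₁ (≤-trans (s≤s j<v) v<B) , e₂ , e₃ , true , half
          , a , bump-suc 16 s b 0<B , cong suc c )
      final : I v (⟦ B ∣ halve ⟧ s)
      final = loop-from 1 {17} {13} {v} item I (λ { (e₁ , e₂ , _) → e₁ , e₂ }) move s₁
        ( bump-suc 17 (⟦ B ∣ clr 15 ⨟ clr 16 ⨟ clr 17 ⟧ s) refl 0<B , e , ez , false , 0 , refl , refl , refl )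

    digits-correct : ∀ {v} s → regs s 13 ≡ suc v → suc v ≤ B → regs s ZERO ≡ 0 →
                     ∃ λ half → half ≤ v × regs (⟦ B ∣ digits ⟧ s) 13 ≡ half × out (⟦ B ∣ digits ⟧ s) ++ encNat half ≡ out s ++ encNat (suc v)
    digits-correct {v} s e v<B ez with halve-correct s e v<B ez
    ... | par , half , a , b , c = half , half≤v , copied , printed par b c
      where
      s₁ = ⟦ B ∣ halve ⟧ s
      print : Stm
      print = ifl ZERO 16 (emit b0) (emit b1)
      rest : Stm
      rest = clr 13 ⨟ addTo 13 15 16
      s₂ = ⟦ B ∣ print ⟧ s₁
      half≤v : half ≤ v
      half≤v = ≤-trans (m≤m+n half _) (≤-trans (m≤n+m (2 * half) (b2n par)) (≤-reflexive (sym c)))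
      copied : regs (⟦ B ∣ rest ⟧ s₂) 13 ≡ half
      copied = addTo-exact {13} {15} {16} (⟦ B ∣ clr 13 ⟧ s₂) (λ ()) (λ ()) (λ ()) {0} refl (trans (frame print 15 s₁ refl) a) (≤-trans half≤v (<⇒≤ v<B))
      printed : ∀ par → regs s₁ 16 ≡ b2n par → v ≡ b2n par + 2 * half → out (⟦ B ∣ rest ⟧ s₂) ++ encNat half ≡ out s ++ encNat (suc v)
      printed true b c = trans (cong (_++ encNat half) (trans (frame-out rest s₂ refl)
          (trans (cong out (ifl-run (emit b0) (emit b1) s₁ (cong₂ _<ᵇ_ (trans (frame halve ZERO s refl) ez) b))) (cong (_++ b0 ∷ []) (frame-out halve s refl)))))
        (trans (List.++-assoc (out s) (b0 ∷ []) (encNat half)) (cong (out s ++_) (trans (sym (encNat-even half)) (cong (λ z → encNat (suc z)) (sym c)))))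
      printed false b c = trans (cong (_++ encNat half) (trans (frame-out rest s₂ refl)
          (trans (cong out (ifl-run (emit b0) (emit b1) s₁ (cong₂ _<ᵇ_ (trans (frame halve ZERO s refl) ez) b))) (cong (_++ b1 ∷ []) (frame-out halve s refl)))))
        (trans (List.++-assoc (out s) (b1 ∷ []) (encNat half)) (cong (out s ++_) (trans (sym (encNat-odd half)) (cong (λ z → encNat (suc z)) (sym c)))))

    -- While the number is positive, each round prints a digit and leaves at most its predecessor.
    -- It starts at most at `B`, so `B` rounds reach 0; a positive remainder would exceed `B`
    -- together with the rounds made.
    emitK-out : ∀ s → f ≤ κ → Sound s → out (⟦ B ∣ emitK ⟧ s) ≡ out s ++ encNat (κ ∸ f)
    emitK-out s f≤κ r = finish {⟦ B ∣ emitK ⟧ s} final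
      where
      e = holds r
      s₁ = ⟦ B ∣ clr 13 ⨟ clr 14 ⨟ addTo 14 FF 15 ⟧ s
      s₂ = ⟦ B ∣ loop 14 KK (inc 13) ⟧ s₁
      s₃ = ⟦ B ∣ clr 14 ⟧ s₂
      I : ℕ → State → Set
      I j s = regs s 14 ≡ f + j × regs s KK ≡ f + (κ ∸ f) × regs s 13 ≡ j
      move : ∀ j s → j < κ ∸ f → I j s → I (suc j) (bump B 14 (⟦ B ∣ inc 13 ⟧ s))
      move j s p (a , b , c) =
        trans (bump-suc 14 (⟦ B ∣ inc 13 ⟧ s) a (≤-trans (≤-trans (≤-reflexive (sym (+-suc f j))) (+-monoʳ-≤ f p)) (≤-trans (≤-reflexive (m+[n∸m]≡n f≤κ)) κ≤B))) (sym (+-suc f j)) ,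
        b , bump-suc 13 s c (≤-trans p (≤-trans (m∸n≤m κ f) κ≤B))
      left-over : I (κ ∸ f) s₂
      left-over = loop-from f {14} {KK} {κ ∸ f} (inc 13) I (λ { (a , b , _) → a , b }) move s₁
        ( trans (addTo-exact {14} {FF} {15} (⟦ B ∣ clr 13 ⨟ clr 14 ⟧ s) (λ ()) (λ ()) (λ ()) {0} refl (reg e 5F) (≤-trans f≤κ κ≤B)) (sym (+-identityʳ f))
        , trans (frame (clr 13 ⨟ clr 14 ⨟ addTo 14 FF 15) KK s refl) (trans (reg e 4F) (sym (m+[n∸m]≡n f≤κ)))
        , frame (clr 14 ⨟ addTo 14 FF 15) 13 (⟦ B ∣ clr 13 ⟧ s) refl )
      J : ℕ → State → Set
      J j s' = regs s' 14 ≡ j × regs s' TOP ≡ B × regs s' ZERO ≡ 0 ×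
               ∃ λ v → regs s' 13 ≡ v × (v ≡ 0 ⊎ v + j ≤ B) × out s' ++ encNat v ≡ out s ++ encNat (κ ∸ f)
      body : Stm
      body = ifFlag digits nop
      shrink : ∀ j s' → j < B → J j s' → J (suc j) (bump B 14 (⟦ B ∣ body ⟧ s'))
      shrink j s' p (a , b , c , zero , d , bound , o) =
        subst (λ z → J (suc j) (bump B 14 z)) (sym (ifl-run digits nop s' (cong₂ _<ᵇ_ c d)))
          (bump-suc 14 s' a p , b , c , 0 , d , inj₁ refl , o)
      shrink j s' p (a , b , c , suc v , d , inj₂ bound , o) with digits-correct s' d (≤-trans (m≤m+n (suc v) j) bound) c
      ... | half , half≤v , e₁ , e₂ =
        subst (λ z → J (suc j) (bump B 14 z)) (sym (ifl-run digits nop s' (cong₂ _<ᵇ_ c d)))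
          ( bump-suc 14 (⟦ B ∣ digits ⟧ s') (trans (frame digits 14 s' refl) a) p
          , trans (frame digits TOP s' refl) b , trans (frame digits ZERO s' refl) c , half , e₁
          , inj₂ (≤-trans (≤-reflexive (+-suc half j)) (≤-trans (s≤s (+-monoˡ-≤ j half≤v)) bound)) , trans e₂ o )
      final : J B (⟦ B ∣ loop 14 TOP body ⟧ s₃)
      final = loop-from 0 {14} {TOP} {B} body J (λ { (a , b , _) → a , b }) shrink s₃
        ( refl , trans (frame (clr 13 ⨟ clr 14 ⨟ addTo 14 FF 15 ⨟ loop 14 KK (inc 13) ⨟ clr 14) TOP s refl) (reg e 0F)
        , trans (frame (clr 13 ⨟ clr 14 ⨟ addTo 14 FF 15 ⨟ loop 14 KK (inc 13) ⨟ clr 14) ZERO s refl) (reg e 1F)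
        , κ ∸ f , proj₂ (proj₂ left-over) , inj₂ (≤-trans (≤-reflexive (+-identityʳ _)) (≤-trans (m∸n≤m κ f) κ≤B))
        , cong (_++ encNat (κ ∸ f)) (frame-out (clr 13 ⨟ clr 14 ⨟ addTo 14 FF 15 ⨟ loop 14 KK (inc 13) ⨟ clr 14) s refl) )
      finish : ∀ {s'} → J B s' → out s' ≡ out s ++ encNat (κ ∸ f)
      finish (_ , _ , _ , zero , _ , _ , o) = trans (sym (List.++-identityʳ _)) o
      finish (_ , _ , _ , suc v , _ , inj₂ bound , o) = contradiction bound (m+1+n≰m′ v)
        where
        m+1+n≰m′ : ∀ v → ¬ (suc v + B ≤ B)
        m+1+n≰m′ v q = 1+n≰n (≤-trans (s≤s (m≤n+m B v)) q)

    record Same (s s' : State) : Set where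
      field
        sound : Sound s'
        prints-same : out s' ≡ out s
        row-same : regs s' 10 ≡ regs s 10
        col-same : regs s' 11 ≡ regs s 11

    run-ev : ∀ {v} (φ : Fm v) ρ {p s} → p ≡ ev 13 ρ φ → Sound s → Same s (⟦ B ∣ p ⟧ s)
    run-ev φ ρ {p} {s} refl r = record
      { sound = mkS (Ev.Env-keep G f t h {s} p (m≤m+n 8 5) low (Ev.puts-ev G f t h φ 13 ρ) (holds r))
                    (trans (frame p NO s (low 8 (m≤m+n 9 4))) (clean r))
      ; prints-same = frame-out p s (Ev.prints-ev G f t h φ 13 ρ)
      ; row-same = frame p 10 s (low 10 (m≤m+n 11 2))
      ; col-same = frame p 11 s (low 11 (m≤m+n 12 1)) }
      where
      low : ∀ z → z < 13 → wr p z ≡ false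
      low = Ev.wr-ev G f t h φ 13 ρ

    flag : ∀ {b} p q s → Sound s → regs s 13 ≡ b2n b → ⟦ B ∣ ifFlag p q ⟧ s ≡ (if b then ⟦ B ∣ p ⟧ s else ⟦ B ∣ q ⟧ s)
    flag {b} p q s r e = Ev.flag-run G f t h {13} {b} p q s (holds r) e

    bad-verdict : ∀ x v s → x < 13 → regs s x ≡ toℕ v → Sound s → regs (⟦ B ∣ badTest x ⟧ s) 13 ≡ b2n (badᵇ G v)
    bad-verdict x v s x<13 e r = Ev.verdict G f t h (badF 0F) 13 (x ∷ []) (v ∷ []) (badTest-def x) (sem-bad G (θ f t h) refl v) (m≤m+n 8 5) (holds r)
      (λ { 0F → x<13 , e })

    edge-verdict : ∀ v v' s → regs s 10 ≡ toℕ v → regs s 11 ≡ toℕ v' → Sound s → regs (⟦ B ∣ edgeTest ⟧ s) 13 ≡ b2n (adj G v v')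
    edge-verdict v v' s e e' r = Ev.verdict G f t h (adjF 0F 1F) 13 (10 ∷ 11 ∷ []) (v ∷ v' ∷ []) edgeTest-def refl (m≤m+n 8 5) (holds r)
      (λ { 0F → m≤m+n 11 2 , e ; 1F → m≤m+n 12 1 , e' })

    record Emits (v : List Sym) (s s' : State) : Set where
      field
        sound : Sound s'
        printed : out s' ≡ out s ++ v
        row-same : regs s' 10 ≡ regs s 10

    Col-same : State → State → Set
    Col-same s s' = regs s' 11 ≡ regs s 11

    Same⇒Emits : ∀ {s s'} → Same s s' → Emits [] s s'
    Same⇒Emits {s} m = record { sound = Same.sound m ; row-same = Same.row-same m ; printed = trans (Same.prints-same m) (sym (List.++-identityʳ (out s))) }

    after-test : ∀ {v s s' s''} → Same s s' → Emits v s' s'' → Emits v s s''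
    after-test {v} m q = record { sound = Emits.sound q ; row-same = trans (Emits.row-same q) (Same.row-same m)
                                ; printed = trans (Emits.printed q) (cong (_++ v) (Same.prints-same m)) }

    emit-one : ∀ c s → Sound s → Emits (c ∷ []) s (⟦ B ∣ emit c ⟧ s)
    emit-one c s r = record { sound = S-keep {s = s} (emit c) (refl , refl) r ; printed = refl ; row-same = refl }

    size-correct : ∀ v s → regs s 10 ≡ toℕ v → Sound s → Emits (when (badᵇ G v) (b1 ∷ [])) s (⟦ B ∣ sizeItem ⟧ s)
    size-correct v s e r =
      subst (Emits (when (badᵇ G v) (b1 ∷ [])) s) (sym (flag (emit b1) nop s₁ (Same.sound m) (bad-verdict 10 v s (m≤m+n 11 2) e r)))
        (branch (badᵇ G v))
      where
      s₁ = ⟦ B ∣ badTest 10 ⟧ s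
      m : Same s s₁
      m = run-ev (badF 0F) (10 ∷ []) (badTest-def 10) r
      branch : ∀ b → Emits (when b (b1 ∷ [])) s (if b then ⟦ B ∣ emit b1 ⟧ s₁ else s₁)
      branch true  = after-test m (emit-one b1 s₁ (Same.sound m))
      branch false = Same⇒Emits m

    entry-correct : ∀ v v' s → regs s 10 ≡ toℕ v → regs s 11 ≡ toℕ v' → Sound s →
                    Emits (when (badᵇ G v') (bit (adj G v v') ∷ [])) s (⟦ B ∣ entry′ ⟧ s) × Col-same s (⟦ B ∣ entry′ ⟧ s)
    entry-correct v v' s e e' r =
      subst (λ z → Emits (when (badᵇ G v') (bit (adj G v v') ∷ [])) s z × Col-same s z)
        (sym (flag inner nop s₁ (Same.sound m) (bad-verdict 11 v' s (m≤m+n 12 1) e' r)))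
        (branch (badᵇ G v'))
      where
      inner : Stm
      inner = edgeTest ⨟ ifFlag (emit b1) (emit b0)
      s₁ = ⟦ B ∣ badTest 11 ⟧ s
      s₂ = ⟦ B ∣ edgeTest ⟧ s₁
      m : Same s s₁
      m = run-ev (badF 0F) (11 ∷ []) (badTest-def 11) r
      m₂ : Same s₁ s₂
      m₂ = run-ev (adjF 0F 1F) (10 ∷ 11 ∷ []) edgeTest-def (Same.sound m)
      bit-branch : ∀ b → Emits (bit b ∷ []) s (if b then ⟦ B ∣ emit b1 ⟧ s₂ else ⟦ B ∣ emit b0 ⟧ s₂) ×
                         Col-same s (if b then ⟦ B ∣ emit b1 ⟧ s₂ else ⟦ B ∣ emit b0 ⟧ s₂)
      bit-branch true  = after-test m (after-test m₂ (emit-one b1 s₂ (Same.sound m₂))) , trans (Same.col-same m₂) (Same.col-same m)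
      bit-branch false = after-test m (after-test m₂ (emit-one b0 s₂ (Same.sound m₂))) , trans (Same.col-same m₂) (Same.col-same m)
      branch : ∀ b → Emits (when b (bit (adj G v v') ∷ [])) s (if b then ⟦ B ∣ inner ⟧ s₁ else s₁) × Col-same s (if b then ⟦ B ∣ inner ⟧ s₁ else s₁)
      branch true  = subst (λ z → Emits (bit (adj G v v') ∷ []) s z × Col-same s z)
        (sym (flag (emit b1) (emit b0) s₂ (Same.sound m₂) (edge-verdict v v' s₁ (trans (Same.row-same m) e) (trans (Same.col-same m) e') (Same.sound m))))
        (bit-branch (adj G v v'))
      branch false = Same⇒Emits m , Same.col-same m

    bump-sound : ∀ x s → Quiet (inc x) → Sound s → Sound (bump B x s)
    bump-sound x s q r = S-keep {s = s} (inc x) q r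

    emitRow-correct : ∀ v s → regs s 10 ≡ toℕ v → Sound s → Emits (rowOf G v) s (⟦ B ∣ emitRow ⟧ s)
    emitRow-correct v s e r = record { sound = proj₁ (proj₂ (proj₂ final)) ; row-same = trans (proj₁ (proj₂ final)) (sym e)
                                     ; printed = proj₂ (proj₂ (proj₂ final)) }
      where
      F : Fin n → List Sym
      F v' = when (badᵇ G v') (bit (adj G v v') ∷ [])
      I : ℕ → State → Set
      I j s' = regs s' 11 ≡ j × regs s' 10 ≡ toℕ v × Sound s' × out s' ≡ out s ++ upto F j
      move : (i : Fin n) (s' : State) → I (toℕ i) s' → I (suc (toℕ i)) (bump B 11 (⟦ B ∣ entry′ ⟧ s'))
      move i s' (a , b , c , d) with entry-correct v i s' b a c
      ... | q , k = bump-suc 11 (⟦ B ∣ entry′ ⟧ s') (trans k a) (≤-trans (toℕ<n i) n≤B) , trans (Emits.row-same q) b ,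
                    bump-sound 11 (⟦ B ∣ entry′ ⟧ s') (refl , refl) (Emits.sound q) ,
                    trans (Emits.printed q) (trans (cong (_++ F i) d) (trans (List.++-assoc (out s) (upto F (toℕ i)) (F i)) (cong (out s ++_) (sym (upto-suc F i)))))
      s₁ = ⟦ B ∣ clr 11 ⟧ s
      final : I n (⟦ B ∣ emitRow ⟧ s)
      final = loop-rule {11} {NN} {n} entry′ I (λ { (a , _ , c , _) → a , reg (holds c) 2F }) move s₁
        (refl , e , S-keep {s = s} (clr 11) (refl , refl) r , sym (trans (cong (out s ++_) (upto-zero F)) (List.++-identityʳ (out s))))

    rowItem-correct : ∀ v s → regs s 10 ≡ toℕ v → Sound s → Emits (when (badᵇ G v) (rowOf G v)) s (⟦ B ∣ rowItem ⟧ s)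
    rowItem-correct v s e r =
      subst (Emits (when (badᵇ G v) (rowOf G v)) s) (sym (flag emitRow nop s₁ (Same.sound m) (bad-verdict 10 v s (m≤m+n 11 2) e r)))
        (branch (badᵇ G v))
      where
      s₁ = ⟦ B ∣ badTest 10 ⟧ s
      m : Same s s₁
      m = run-ev (badF 0F) (10 ∷ []) (badTest-def 10) r
      branch : ∀ b → Emits (when b (rowOf G v)) s (if b then ⟦ B ∣ emitRow ⟧ s₁ else s₁)
      branch true  = after-test m (emitRow-correct v s₁ (trans (Same.row-same m) e) (Same.sound m))
      branch false = Same⇒Emits m

    each-vertex : ∀ item (F : Fin n → List Sym) → (∀ v s → regs s 10 ≡ toℕ v → Sound s → Emits (F v) s (⟦ B ∣ item ⟧ s)) →
                  ∀ s → Sound s → Sound (⟦ B ∣ clr 10 ⨟ loop 10 NN item ⟧ s) × out (⟦ B ∣ clr 10 ⨟ loop 10 NN item ⟧ s) ≡ out s ++ upto F n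
    each-vertex item F each s r = proj₁ (proj₂ final) , proj₂ (proj₂ final)
      where
      I : ℕ → State → Set
      I j s' = regs s' 10 ≡ j × Sound s' × out s' ≡ out s ++ upto F j
      move : (i : Fin n) (s' : State) → I (toℕ i) s' → I (suc (toℕ i)) (bump B 10 (⟦ B ∣ item ⟧ s'))
      move i s' (a , c , d) =
        bump-suc 10 (⟦ B ∣ item ⟧ s') (trans (Emits.row-same q) a) (≤-trans (toℕ<n i) n≤B) ,
        bump-sound 10 (⟦ B ∣ item ⟧ s') (refl , refl) (Emits.sound q) ,
        trans (Emits.printed q) (trans (cong (_++ F i) d) (trans (List.++-assoc (out s) (upto F (toℕ i)) (F i)) (cong (out s ++_) (sym (upto-suc F i)))))
        where
        q : Emits (F i) s' (⟦ B ∣ item ⟧ s')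
        q = each i s' a c
      final : I n (⟦ B ∣ clr 10 ⨟ loop 10 NN item ⟧ s)
      final = loop-rule {10} {NN} {n} item I (λ { (a , c , _) → a , reg (holds c) 2F }) move (⟦ B ∣ clr 10 ⟧ s)
        (refl , S-keep {s = s} (clr 10) (refl , refl) r , sym (trans (cong (out s ++_) (upto-zero F)) (List.++-identityʳ (out s))))

    emitKernel-out : ∀ s → f ≤ κ → out s ≡ [] → Sound s → out (⟦ B ∣ emitKernel ⟧ s) ≡ encode (inst (length (keep G)) (kernel G) (κ ∸ f))
    emitKernel-out s f≤κ empty r = begin
      out (⟦ B ∣ emitRows ⟧ s₄)                          ≡⟨ proj₂ rows-out ⟩
      (out s₃ ++ sep ∷ []) ++ Y                          ≡⟨ List.++-assoc (out s₃) (sep ∷ []) Y ⟩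
      out s₃ ++ sep ∷ Y                                  ≡⟨ cong (_++ sep ∷ Y) (proj₂ size-out) ⟩
      ((out s₁ ++ sep ∷ []) ++ X) ++ sep ∷ Y             ≡⟨ List.++-assoc (out s₁ ++ sep ∷ []) X (sep ∷ Y) ⟩
      (out s₁ ++ sep ∷ []) ++ X ++ sep ∷ Y               ≡⟨ List.++-assoc (out s₁) (sep ∷ []) (X ++ sep ∷ Y) ⟩
      out s₁ ++ sep ∷ X ++ sep ∷ Y                       ≡⟨ cong (_++ sep ∷ X ++ sep ∷ Y) (trans (emitK-out s f≤κ r) (cong (_++ encNat (κ ∸ f)) empty)) ⟩
      encNat (κ ∸ f) ++ sep ∷ X ++ sep ∷ Y               ≡⟨ sym (kernel-code G (κ ∸ f)) ⟩
      encode (inst (length (keep G)) (kernel G) (κ ∸ f)) ∎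
      where
      open ≡-Reasoning
      X = upto (λ v → when (badᵇ G v) (b1 ∷ [])) n
      Y = upto (λ v → when (badᵇ G v) (rowOf G v)) n
      s₁ = ⟦ B ∣ emitK ⟧ s
      s₂ = ⟦ B ∣ emit sep ⟧ s₁
      s₃ = ⟦ B ∣ emitSize ⟧ s₂
      s₄ = ⟦ B ∣ emit sep ⟧ s₃
      r₂ : Sound s₂
      r₂ = S-keep {s = s₁} (emit sep) (refl , refl) (S-keep {s = s} emitK (refl , refl) r)
      size-out : Sound s₃ × out s₃ ≡ out s₂ ++ X
      size-out = each-vertex sizeItem (λ v → when (badᵇ G v) (b1 ∷ [])) size-correct s₂ r₂
      rows-out : Sound (⟦ B ∣ emitRows ⟧ s₄) × out (⟦ B ∣ emitRows ⟧ s₄) ≡ out s₄ ++ Y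
      rows-out = each-vertex rowItem (λ v → when (badᵇ G v) (rowOf G v)) rowItem-correct s₄ (S-keep {s = s₃} (emit sep) (refl , refl) (proj₁ size-out))

  data Result (G₀ : Graph n) (v : List Sym) : Set where
    reject : v ≡ encode noInstance → ¬ Sol G₀ κ → Result G₀ v
    accept : ∀ (G : Graph n) f → f ≤ κ → (Sol G₀ κ → Sol G (κ ∸ f)) → (Sol G (κ ∸ f) → Sol G₀ κ) →
             cnt (badᵇ G) ≤ cap2 f * cap2 f + cap2 f → v ≡ encode (inst (length (keep G)) (kernel G) (κ ∸ f)) → Result G₀ v

  too-many : ∀ {G f} → Stable G f → (cap2 f * cap2 f + cap2 f) ⊓ B < cnt (badᵇ G) → ¬ Sol G (κ ∸ f)
  too-many {G} {f} stable big sol = <⇒≱ big′ (subst (λ z → cnt (badᵇ G) ≤ z) bound≡ (bad-bound G (κ ∸ f) (cap2 f) stable sol))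
    where
    t = cap2 f
    bad≤B : cnt (badᵇ G) ≤ B
    bad≤B = ≤-trans (cnt≤n (badᵇ G)) n≤B
    big′ : t * t + t < cnt (badᵇ G)
    big′ = uncap big bad≤B
    exact : t ≡ (κ ∸ f) + (κ ∸ f)
    exact with ≤-total ((κ ∸ f) + (κ ∸ f)) B
    ... | inj₁ q = m≤n⇒m⊓n≡m q
    -- If `t` were cut off it would be `B`, and no count exceeds `B ≤ t * t + t`.
    ... | inj₂ q = contradiction (≤-trans (s≤s (m≤n+m t (t * t))) (≤-trans big′ bad≤B)) (≤⇒≯ (≤-reflexive (sym (m≥n⇒m⊓n≡n q))))
    bound≡ : (κ ∸ f + (κ ∸ f)) * suc t ≡ t * t + t
    bound≡ = trans (cong (_* suc t) (sym exact)) (trans (*-suc t t) (+-comm t (t * t)))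

  decide-correct : ∀ {G₀ s} → regs s ZERO ≡ 0 → out s ≡ [] → Live G₀ Stable s → Result G₀ (out (⟦ B ∣ decide ⟧ s))
  decide-correct {G₀} {s} ez empty l = conclude l
    where
    no-code : List Sym
    no-code = encode noInstance
    say-no yes-branch : Stm
    say-no = emitList (encode noInstance)
    yes-branch = tooManyTest ⨟ ifFlag say-no emitKernel
    s₁ = ⟦ B ∣ setT2 ⟧ s
    s₂ = ⟦ B ∣ setTHR ⟧ s₁
    empty₂ : out s₂ ≡ []
    empty₂ = trans (frame-out setTHR s₁ refl) (trans (frame-out setT2 s refl) empty)
    ez₂ : regs s₂ ZERO ≡ 0
    ez₂ = trans (frame setTHR ZERO s₁ refl) (trans (frame setT2 ZERO s refl) ez)
    says-no : ∀ s → out s ≡ [] → out (⟦ B ∣ say-no ⟧ s) ≡ no-code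
    says-no s e = trans (emitList-out no-code s) (cong (_++ no-code) e)
    conclude : Live G₀ Stable s → Result G₀ (out (⟦ B ∣ decide ⟧ s))
    conclude (lost pos no-sol) =
      subst (λ z → Result G₀ (out z)) (sym (ifl-run say-no yes-branch s₂
        (trans (cong₂ _<ᵇ_ ez₂ (trans (frame setTHR NO s₁ refl) (frame setT2 NO s refl))) (<⇒<ᵇ-true pos))))
        (reject (says-no s₂ empty₂) no-sol)
    conclude (live G f t h r f≤κ to from stable) =
      subst (λ z → Result G₀ (out z)) (sym (trans (ifl-run say-no yes-branch s₂ (cong₂ _<ᵇ_ ez₂ (clean r₂)))
        (flag {G} {f} {cap2 f} {THR′} {THR′ <ᵇ cnt (badᵇ G)} say-no emitKernel s₃ (Same.sound m) too-many-verdict)))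
        (branch (THR′ <ᵇ cnt (badᵇ G)) refl)
      where
      THR′ : ℕ
      THR′ = (cap2 f * cap2 f + cap2 f) ⊓ B
      s₃ = ⟦ B ∣ tooManyTest ⟧ s₂
      r₂ : S G f (cap2 f) THR′ s₂
      r₂ = setTHR-correct {s = s₁} (m⊓n≤n _ B) (setT2-correct {s = s} f≤κ r)
      m : Same {G} {f} {cap2 f} {THR′} s₂ s₃
      m = run-ev tooManyF [] tooManyTest-def r₂
      too-many-verdict : regs s₃ 13 ≡ b2n (THR′ <ᵇ cnt (badᵇ G))
      too-many-verdict = Ev.verdict G f (cap2 f) THR′ tooManyF 13 [] [] tooManyTest-def (sem-tooMany G (θ f (cap2 f) THR′) refl) (m≤m+n 8 5) (holds r₂) (λ ())
      empty₃ : out s₃ ≡ []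
      empty₃ = trans (Same.prints-same m) empty₂
      branch : ∀ b → (THR′ <ᵇ cnt (badᵇ G)) ≡ b → Result G₀ (out (if b then ⟦ B ∣ say-no ⟧ s₃ else ⟦ B ∣ emitKernel ⟧ s₃))
      branch true  q = reject (says-no s₃ empty₃) (λ s → too-many {G} {f} stable (<ᵇ-true {THR′} {cnt (badᵇ G)} q) (to s))
      branch false q = accept G f f≤κ to from (≤-trans (<ᵇ-false {THR′} {cnt (badᵇ G)} q) (m⊓n≤m _ B)) (emitKernel-out {G} {f} {cap2 f} {THR′} s₃ f≤κ empty₃ (Same.sound m))

  decided : ∀ {G s} → S G 0 0 0 s → regs s 40 ≡ 0 → out s ≡ [] → Result G (out (⟦ B ∣ decide ⟧ (⟦ B ∣ rounds ⟧ s)))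
  decided {G} {s} r e quiet = decide-correct {G} {⟦ B ∣ rounds ⟧ s}
    (trans (frame rounds ZERO s (proj₁ rounds-free)) (reg (holds r) 1F)) (trans (frame-out rounds s (proj₂ rounds-free)) quiet)
    (rounds-correct {G} {s} e r)

  phases-correct : ∀ {G p q r s} → q ≡ rounds → r ≡ decide → S G 0 0 0 (⟦ B ∣ p ⟧ s) → regs (⟦ B ∣ p ⟧ s) 40 ≡ 0 →
                   out (⟦ B ∣ p ⟧ s) ≡ [] → Result G (out (⟦ B ∣ p ⨟ q ⨟ r ⟧ s))
  phases-correct {G} {p} {s = s} refl refl = decided {G} {⟦ B ∣ p ⟧ s}

-- On the path 0-1-2-3 the vertex 1 is a partner of the missing pair 0, 2, and one partner is enough
-- at budget 0.
¬Sol-path : ¬ Sol pathGraph 0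
¬Sol-path = forced-zero pathGraph {0F} {2F} (s≤s z≤n)

-- The kernelization and its machine

record Kernel (I : Instance) (v : List Sym) : Set where
  field
    I′ : Instance
    prints-I′ : v ≡ encode I′
    equivalent : YesInstance I ⇔ YesInstance I′
    proper : par I′ ≤ par I
    small : nV I′ ≤ 4 * suc (par I) ^ 7

module Final {n} (G : Graph n) (k : ℕ) where
  open Parse G k using (B; s₀; 0<B; n≤B; n²≤B; B≡; Parsed; run-parse)
  open Parse.Parsed

  off κ : ℕ
  off = length (encNat k) + suc (suc n)
  κ = k ⊓ B

  open Reduce B 0<B n≤B off (≤-reflexive (sym B≡)) κ (m⊓n≤n k B)
  open Output B 0<B n≤B off (≤-reflexive (sym B≡)) κ (m⊓n≤n k B)

  sound : ∀ {s} → Parsed s → S G 0 0 0 s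
  sound r = mkS (record
    { reg = λ { 0F → same 0 refl ; 1F → same 1 refl ; 2F → n-read r ; 3F → off-read r
              ; 4F → k-read r ; 5F → same 5 refl ; 6F → same 6 refl ; 7F → same 7 refl }
    ; adjacency = λ i j → trans (cong (λ m → m (off + (toℕ i * n + toℕ j))) (mem-kept r)) (code-adj G k i j) })
    (same 8 refl)
    where same = untouched r

  result : Result G (out (⟦ B ∣ program ⟧ s₀))
  result = phases-correct {G} {parsePhase} {s = s₀} (proj₁ (proj₂ phases)) (proj₂ (proj₂ phases)) (sound r) (untouched r 40 refl) (silent r)
    where
    r : Parsed (⟦ B ∣ parsePhase ⟧ s₀)
    r = run-parse (proj₁ phases)

  grow : Sol G κ → Sol G k
  grow = Sol-mono G (m⊓n≤m k B)

  -- The matrix is part of the input, so `n * n ≤ B`, and capping the parameter at the input length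
  -- loses no solution.
  shrink : Sol G k → Sol G κ
  shrink = Sol-cap G B n²≤B k

  -- Both factors of `c * suc c` are at most `2 * suc k`. The positive base `suc k` then allows the
  -- exponent to be raised to 7 for every `k`, including 0.
  size-bound : ∀ {c} → c ≤ k + k → c * c + c ≤ 4 * suc k ^ 7
  size-bound {c} c≤ = begin
    c * c + c                        ≡⟨ trans (+-comm (c * c) c) (sym (*-suc c c)) ⟩
    c * suc c                        ≤⟨ *-mono-≤ (≤-trans c≤ (+-mono-≤ (n≤1+n k) (n≤1+n k))) (≤-trans (s≤s c≤) (+-monoʳ-≤ (suc k) (n≤1+n k))) ⟩
    (suc k + suc k) * (suc k + suc k) ≡⟨ cong (λ z → (suc k + z) * (suc k + z)) (sym (+-identityʳ (suc k))) ⟩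
    (2 * suc k) * (2 * suc k)        ≡⟨ [m*n]*[o*p]≡[m*o]*[n*p] 2 (suc k) 2 (suc k) ⟩
    4 * (suc k * suc k)              ≡⟨ cong (λ z → 4 * (suc k * z)) (sym (*-identityʳ (suc k))) ⟩
    4 * suc k ^ 2                    ≤⟨ *-monoʳ-≤ 4 (^-monoʳ-≤ (suc k) (m≤m+n 2 5)) ⟩
    4 * suc k ^ 7                    ∎
    where open ≤-Reasoning

  kernelized : ∀ {v} → Result G v → Kernel (inst n G k) v
  kernelized (reject e no-sol) = record
    { I′ = noInstance ; prints-I′ = e
    ; equivalent = (λ y → ⊥-elim (no-sol (shrink (Yes⇒Sol G k y)))) , (λ y → ⊥-elim (¬Sol-path (Yes⇒Sol pathGraph 0 y)))
    -- The no-instance has 4 vertices, and `suc k ^ 7` is at least 1.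
    ; proper = z≤n ; small = *-monoʳ-≤ 4 (m^n>0 (suc k) 7) }
  kernelized (accept G′ f f≤κ to from few e) = record
    { I′ = inst (length (keep G′)) (kernel G′) (κ ∸ f) ; prints-I′ = e
    ; equivalent = (λ y → Sol⇒Yes (kernel G′) (κ ∸ f) (Sol⇒kernel G′ {κ ∸ f} (to (shrink (Yes⇒Sol G k y))))) ,
                   (λ y → Sol⇒Yes G k (grow (from (kernel⇒Sol G′ {κ ∸ f} (Yes⇒Sol (kernel G′) (κ ∸ f) y)))))
    ; proper = ≤-trans (m∸n≤m κ f) (m⊓n≤m k B)
    ; small = ≤-trans (≤-reflexive (length-filter-tabulate (badᵇ G′) id)) (≤-trans few (size-bound (≤-trans (m⊓n≤m _ B) (+-mono-≤ κ∸f≤k κ∸f≤k)))) }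
    where
    κ∸f≤k = ≤-trans (m∸n≤m κ f) (m⊓n≤m k B)

  answer : Kernel (inst n G k) (out (⟦ length (encode (inst n G k)) ∣ program ⟧ (Whole.start-state 39 (encode (inst n G k)))))
  answer = subst₂ (λ B s → Kernel (inst n G k) (out (⟦ B ∣ program ⟧ s))) refl refl (kernelized result)

-- With the machine and its output function as variables, the conclusion is assembled without
-- looking into the compiled program.
package : (M : TM) (o : List Sym → List Sym) →
          (∃ λ a → ∃ λ d → ∀ u → u ≢ [] → All (λ s → nb s ≡ true) u →
             ∃ λ cf → exec M (a * suc (length u) ^ d) (initConfig M u) ≡ just cf × output cf ≡ o u) →
          (∀ I → Kernel I (o (encode I))) →
          Σ TM λ M → Σ ℕ λ a → Σ ℕ λ d → Σ ℕ λ c → (I : Instance) → Σ (Config M) λ cf → Σ Instance λ I′ →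
            (exec M (a * suc (length (encode I)) ^ d) (initConfig M (encode I)) ≡ just cf)
            × (output cf ≡ encode I′) × (YesInstance I ⇔ YesInstance I′) × (par I′ ≤ par I) × (nV I′ ≤ c * suc (par I) ^ 7)
package M o (a , d , runs) kernels = M , a , d , 4 , λ I →
  let (cf , halts , prints-v) = runs (encode I) (encode≢[] I) (NB-encode I)
      K = kernels I
  in cf , Kernel.I′ K , halts , trans prints-v (Kernel.prints-I′ K) , Kernel.equivalent K , Kernel.proper K , Kernel.small K

theorem3 : Σ TM λ M → Σ ℕ λ a → Σ ℕ λ d → Σ ℕ λ c →
    (I : Instance) → Σ (Config M) λ cf → Σ Instance λ I' →
    (exec M (a * suc (length (encode I)) ^ d) (initConfig M (encode I)) ≡ just cf)
    × (output cf ≡ encode I')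
    × (YesInstance I ⇔ YesInstance I')
    × (par I' ≤ par I)
    × (nV I' ≤ c * suc (par I) ^ 7)
theorem3 = package (machine (Whole.wholeC 39 program)) (λ u → out (⟦ length u ∣ program ⟧ (Whole.start-state 39 u)))
                   (Whole.compiled 39 program program-ok) (λ { (inst n G k) → Final.answer G k })
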